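{- Let $p\ge 1$ and suppose the diagram $D$ contains $\delta_p \cdot (1)$ as a subdiagram in rows $1, \ldots, p$ and columns $1, \ldots, p$. Then there is a filtration $$0 = M_0 \subseteq M_1 \subseteq \cdots \subseteq M_p = S^D$$ of $S^D$ by $S_{|D|}$-submodules such that for each $1 \leq j \leq p$, there is a surjection of $S_{|D|}$-modules $$M_j / M_{j-1} \twoheadrightarrow S^{R_{p\to p-j+1}C_{p\to j}D}.$$
   Context: A diagram is a finite subset $D$ of $\mathbb{N}\times\mathbb{N}$ with $\mathbb{N}=\{1,2,\dots\}$; its elements $(i,j)$ (row $i$, column $j$) are called cells. A filling of $D$ is a bijection $T:D\to\{1,\dots,|D|\}$. $S_{|D|}$ acts on fillings by permuting entries. The row group $\mathbf{R}(T)\le S_{|D|}$ (column group $\mathbf{C}(T)$) consists of the permutations acting on $T$ by permuting entries within their rows (columns). The Young symmetrizer is $y_T=\sum_{p\in \mathbf{R}(T)}\sum_{q\in \mathbf{C}(T)}\mathrm{sgn}(q)\,qp\in\mathbb{C}[S_{|D|}]$. The (generalized) Specht module of $D$ is the left ideal $S^D=\mathbb{C}[S_{|D|}]\,y_T$; its isomorphism type does not depend on $T$. James-Peel moves: $R_{a\to b}D$ is obtained from $D$ by moving each cell $(a,j)$ of row $a$ to $(b,j)$ whenever $(b,j)\notin D$, leaving all other cells in place; $C_{c\to d}D$ is obtained by moving each cell $(i,c)$ of column $c$ to $(i,d)$ whenever $(i,d)\notin D$. In particular $R_{a\to a}D=C_{c\to c}D=D$. In a composite the rightmost move is applied first. $\delta_p=(p-1,p-2,\dots,1)$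 is the staircase partition, and $\delta_p\cdot(1)$ is the diagram consisting of the Ferrers diagram of $\delta_p$ together with the cell $(p,p)$. That $D$ contains $\delta_p\cdot(1)$ as a subdiagram in rows $1,\dots,p$ and columns $1,\dots,p$ means $D\cap(\{1,\dots,p\}\times\{1,\dots,p\})=\{(i,j): i,j\ge1,\ i+j\le p\}\cup\{(p,p)\}$. -}

module Defs where

open import Algebra.Bundles using (Ring; CommutativeRing; CommutativeMonoid)
open import Algebra.Module.Bundles using (LeftModule)
open import Algebra.Module.Morphism.Structures using (module LeftModuleMorphisms)
import Algebra.Properties.Semiring.Exp as SemiringExp
import Algebra.Module.Construct.TensorUnit as TensorUnit
import Algebra.Module.Properties.LeftModule as LeftModuleProperties
import Algebra.Properties.AbelianGroup as AbelianGroupProperties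
import Algebra.Properties.CommutativeMonoid.Sum as CommutativeMonoidSum
import Algebra.Properties.Ring as RingProperties
import Algebra.Solver.Ring.NaturalCoefficients.Default as SemiringSolver
import Algebra.Properties.Semiring.Sum as SemiringSum
open import Data.Bool.Base using (if_then_else_)
open import Data.Fin.Base as Fin using (Fin; zero; suc)
import Data.Fin.Properties as Fin
open import Data.Fin.Permutation as Perm
  using (Permutation′; _⟨$⟩ʳ_; _⟨$⟩ˡ_; insert; remove)
open import Data.Nat.Base as ℕ using (ℕ; zero; suc; NonZero)
import Data.Nat.Properties as ℕ
open import Data.Product.Base using (Σ; ∃; _×_; _,_; proj₁; proj₂)
open import Data.Product.Properties using (≡-dec)
open import Data.Rational.Base as ℚ using (ℚ; 0ℚ; 1ℚ; ½; ∣_∣)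
import Data.Rational.Properties as ℚ
open import Data.Sum.Base using (_⊎_)
open import Data.Vec.Base using (Vec; []; _∷_; map)
open import Data.Vec.Membership.DecPropositional (≡-dec ℕ._≟_ ℕ._≟_) using (_∈?_)
open import Data.Vec.Membership.Propositional using (_∈_; _∉_)
open import Data.Vec.Relation.Unary.All as All using (All; []; _∷_)
open import Data.Vec.Relation.Unary.Any using (here; there)
open import Data.Vec.Relation.Unary.Unique.Propositional using (Unique; []; _∷_)
open import Function.Base using (_∘_)
open import Function.Bundles using (Inverse; _↔_; _⇔_; mk⇔)
open import Function.Definitions using (Surjective)
open import Level using (Level; 0ℓ; _⊔_) renaming (suc to lsuc)
open import Relation.Binary.PropositionalEquality
  using (_≡_; refl; sym; trans; cong; subst)
import Relation.Binary.Reasoning.Setoid as SetoidReasoning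
open import Relation.Nullary using (¬_; Dec; does; yes; no; _×-dec_; ¬?; contradiction)
open import Relation.Nullary.Decidable using (dec⇒maybe; dec-true; dec-false; does-⇔)
open import Relation.Unary using (Pred; Decidable)
open import Tactic.RingSolver.Core.Expression using (_⊕_; _⊗_; ⊝_)
import Tactic.RingSolver.NonReflective as RingSolver
open import Tactic.RingSolver.Core.AlmostCommutativeRing using (fromCommutativeRing)

-- ℝ is the setoid of rational Cauchy sequences, _≈ʳ_ identifying those with null difference

IsCauchy : (ℕ → ℚ) → Set
IsCauchy x = ∀ ε → 0ℚ ℚ.< ε →
  ∃ λ N → ∀ m n → N ℕ.≤ m → N ℕ.≤ n → ∣ x m ℚ.- x n ∣ ℚ.< ε

record ℝ : Set where
  constructor mkℝ
  field
    seq      : ℕ → ℚ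
    isCauchy : IsCauchy seq

open ℝ

infix 4 _≈ʳ_

_≈ʳ_ : ℝ → ℝ → Set
x ≈ʳ y = ∀ ε → 0ℚ ℚ.< ε →
  ∃ λ N → ∀ n → N ℕ.≤ n → ∣ seq x n ℚ.- seq y n ∣ ℚ.< ε

private
  module ℚ-Solver =
    RingSolver (fromCommutativeRing ℚ.+-*-commutativeRing (λ p → dec⇒maybe (0ℚ ℚ.≟ p)))

  abstract
    half : ℚ → ℚ
    half ε = ½ ℚ.* ε

    0<half : ∀ {ε} → 0ℚ ℚ.< ε → 0ℚ ℚ.< half ε
    0<half {ε} = ℚ.*-monoʳ-<-pos ½ {0ℚ} {ε}

    half+half : ∀ ε → half ε ℚ.+ half ε ≡ ε
    half+half ε = trans (sym (ℚ.*-distribʳ-+ ε ½ ½)) (ℚ.*-identityˡ ε)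

  +-small : ∀ {ε a b} → ∣ a ∣ ℚ.< half ε → ∣ b ∣ ℚ.< half ε → ∣ a ℚ.+ b ∣ ℚ.< ε
  +-small {ε} {a} {b} a< b< =
    subst (∣ a ℚ.+ b ∣ ℚ.<_) (half+half ε) (ℚ.≤-<-trans (ℚ.∣p+q∣≤∣p∣+∣q∣ a b) (ℚ.+-mono-< a< b<))

  ∣x-x∣< : ∀ {ε} x → 0ℚ ℚ.< ε → ∣ x ℚ.- x ∣ ℚ.< ε
  ∣x-x∣< x 0<ε rewrite ℚ.+-inverseʳ x = 0<ε

  ∣x-y∣-sym : ∀ x y → ∣ x ℚ.- y ∣ ≡ ∣ y ℚ.- x ∣
  ∣x-y∣-sym x y = trans (cong ∣_∣ (ℚ-Solver.solve 2 (λ x y → x ⊕ ⊝ y , ⊝ (y ⊕ ⊝ x)) refl x y))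
                        (ℚ.∣-p∣≡∣p∣ (y ℚ.- x))

  +-diff : ∀ {ε} x y x′ y′ → ∣ x ℚ.- x′ ∣ ℚ.< half ε → ∣ y ℚ.- y′ ∣ ℚ.< half ε →
           ∣ (x ℚ.+ y) ℚ.- (x′ ℚ.+ y′) ∣ ℚ.< ε
  +-diff {ε} x y x′ y′ p q =
    subst (λ z → ∣ z ∣ ℚ.< ε)
      (ℚ-Solver.solve 4 (λ x y x′ y′ → (x ⊕ ⊝ x′) ⊕ (y ⊕ ⊝ y′) , (x ⊕ y) ⊕ ⊝ (x′ ⊕ y′)) refl x y x′ y′)
      (+-small {ε} {x ℚ.- x′} {y ℚ.- y′} p q)

  neg-diff : ∀ {ε} x x′ → ∣ x ℚ.- x′ ∣ ℚ.< ε → ∣ ℚ.- x ℚ.- (ℚ.- x′) ∣ ℚ.< ε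
  neg-diff x x′ =
    subst (ℚ._< _) (trans (sym (ℚ.∣-p∣≡∣p∣ (x ℚ.- x′)))
                          (cong ∣_∣ (ℚ-Solver.solve 2 (λ x x′ → ⊝ (x ⊕ ⊝ x′) , ⊝ x ⊕ ⊝ (⊝ x′)) refl x x′)))

  Scales : ℚ → ℚ → ℚ → Set
  Scales A ε δ = ∀ a d → ∣ a ∣ ℚ.≤ A → ∣ d ∣ ℚ.< δ → ∣ a ℚ.* d ∣ ℚ.< half ε

  abstract
    scale : ∀ A → ℚ.Positive A → ∀ ε → 0ℚ ℚ.< ε → ∃ λ δ → 0ℚ ℚ.< δ × Scales A ε δ
    scale A A>0 ε 0<ε = A⁻¹ ℚ.* half ε , 0<δ , small
      where
      instance
        A-pos : ℚ.Positive A
        A-pos = A>0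
        A≢0 : ℚ.NonZero A
        A≢0 = ℚ.pos⇒nonZero A
      A⁻¹ : ℚ
      A⁻¹ = ℚ.1/ A
      0<δ : 0ℚ ℚ.< A⁻¹ ℚ.* half ε
      0<δ = subst (ℚ._< A⁻¹ ℚ.* half ε) (ℚ.*-zeroʳ A⁻¹)
        (ℚ.*-monoʳ-<-pos A⁻¹ {{ℚ.1/pos⇒pos A}} {0ℚ} {half ε} (0<half {ε} 0<ε))
      A*δ : A ℚ.* (A⁻¹ ℚ.* half ε) ≡ half ε
      A*δ = trans (sym (ℚ.*-assoc A A⁻¹ (half ε)))
        (trans (cong (ℚ._* half ε) (ℚ.*-inverseʳ A)) (ℚ.*-identityˡ (half ε)))
      small : Scales A ε (A⁻¹ ℚ.* half ε)
      small a d a≤A d<δ = ℚ.≤-<-trans {∣ a ℚ.* d ∣} {A ℚ.* ∣ d ∣} {half ε}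
        (subst (ℚ._≤ A ℚ.* ∣ d ∣) (sym (ℚ.∣p*q∣≡∣p∣*∣q∣ a d))
          (ℚ.*-monoʳ-≤-nonNeg ∣ d ∣ {{ℚ.∣-∣-nonNeg d}} {∣ a ∣} {A} a≤A))
        (subst (A ℚ.* ∣ d ∣ ℚ.<_) A*δ (ℚ.*-monoʳ-<-pos A {∣ d ∣} {A⁻¹ ℚ.* half ε} d<δ))

  *-diff : ∀ {A B ε δ₁ δ₂} → Scales B ε δ₁ → Scales A ε δ₂ → ∀ x y x′ y′ →
           ∣ x ∣ ℚ.≤ A → ∣ y′ ∣ ℚ.≤ B → ∣ x ℚ.- x′ ∣ ℚ.< δ₁ → ∣ y ℚ.- y′ ∣ ℚ.< δ₂ →
           ∣ x ℚ.* y ℚ.- x′ ℚ.* y′ ∣ ℚ.< ε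
  *-diff {ε = ε} scaleB scaleA x y x′ y′ x≤A y′≤B dx dy =
    subst (λ z → ∣ z ∣ ℚ.< ε)
      (ℚ-Solver.solve 4
        (λ x y x′ y′ → (x ⊗ (y ⊕ ⊝ y′)) ⊕ (y′ ⊗ (x ⊕ ⊝ x′)) , (x ⊗ y) ⊕ ⊝ (x′ ⊗ y′)) refl x y x′ y′)
      (+-small {ε} {x ℚ.* (y ℚ.- y′)} {y′ ℚ.* (x ℚ.- x′)}
        (scaleA x (y ℚ.- y′) x≤A dy) (scaleB y′ (x ℚ.- x′) y′≤B dx))

  eventually-bounded : ∀ x → ∃ λ A → ℚ.Positive A × ∃ λ N → ∀ n → N ℕ.≤ n → ∣ seq x n ∣ ℚ.≤ A
  eventually-bounded x with isCauchy x 1ℚ (ℚ.positive⁻¹ 1ℚ)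
  ... | N , close = ∣ seq x N ∣ ℚ.+ 1ℚ , ℚ.nonNeg+pos⇒pos ∣ seq x N ∣ {{ℚ.∣-∣-nonNeg (seq x N)}} 1ℚ , N , bound
    where
    bound : ∀ n → N ℕ.≤ n → ∣ seq x n ∣ ℚ.≤ ∣ seq x N ∣ ℚ.+ 1ℚ
    bound n N≤n = subst (λ z → ∣ z ∣ ℚ.≤ ∣ seq x N ∣ ℚ.+ 1ℚ)
      (ℚ-Solver.solve 2 (λ a b → a ⊕ (b ⊕ ⊝ a) , b) refl (seq x N) (seq x n))
      (ℚ.≤-trans (ℚ.∣p+q∣≤∣p∣+∣q∣ (seq x N) (seq x n ℚ.- seq x N))
        (ℚ.+-monoʳ-≤ ∣ seq x N ∣ (ℚ.<⇒≤ (close n N N≤n ℕ.≤-refl))))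

  ⊔-split : ∀ {M N k} → M ℕ.⊔ N ℕ.≤ k → M ℕ.≤ k × N ℕ.≤ k
  ⊔-split {M} {N} p = ℕ.≤-trans (ℕ.m≤m⊔n M N) p , ℕ.≤-trans (ℕ.m≤n⊔m M N) p

fromℚ : ℚ → ℝ
fromℚ q = mkℝ (λ _ → q) (λ ε 0<ε → 0 , λ _ _ _ _ → ∣x-x∣< q 0<ε)

infixl 6 _+ʳ_
infixl 7 _*ʳ_
infix  8 -ʳ_

_+ʳ_ : ℝ → ℝ → ℝ
x +ʳ y = mkℝ (λ n → seq x n ℚ.+ seq y n) cauchy
  where
  cauchy : IsCauchy (λ n → seq x n ℚ.+ seq y n)
  cauchy ε 0<ε = let M , p = isCauchy x (half ε) (0<half {ε} 0<ε)
                     N , q = isCauchy y (half ε) (0<half {ε} 0<ε) in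
    M ℕ.⊔ N , λ m n m≥ n≥ →
    +-diff {ε} (seq x m) (seq y m) (seq x n) (seq y n)
      (p m n (proj₁ (⊔-split m≥)) (proj₁ (⊔-split n≥)))
      (q m n (proj₂ (⊔-split {M} m≥)) (proj₂ (⊔-split {M} n≥)))

-ʳ_ : ℝ → ℝ
-ʳ x = mkℝ (λ n → ℚ.- seq x n) λ ε 0<ε → let N , p = isCauchy x ε 0<ε in
  N , λ m n m≥ n≥ → neg-diff {ε} (seq x m) (seq x n) (p m n m≥ n≥)

_*ʳ_ : ℝ → ℝ → ℝ
x *ʳ y = mkℝ (λ n → seq x n ℚ.* seq y n) cauchy
  where
  cauchy : IsCauchy (λ n → seq x n ℚ.* seq y n)
  cauchy ε 0<ε =
    let A , A>0 , K , x≤A     = eventually-bounded x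
        B , B>0 , L , y≤B     = eventually-bounded y
        δ₁ , 0<δ₁ , scaleB = scale B B>0 ε 0<ε
        δ₂ , 0<δ₂ , scaleA = scale A A>0 ε 0<ε
        M , p = isCauchy x δ₁ 0<δ₁
        N , q = isCauchy y δ₂ 0<δ₂ in
    (K ℕ.⊔ L) ℕ.⊔ (M ℕ.⊔ N) , λ m n m≥ n≥ →
    let KL≤m , MN≤m = ⊔-split {K ℕ.⊔ L} m≥
        KL≤n , MN≤n = ⊔-split {K ℕ.⊔ L} n≥
    in *-diff {A} {B} {ε} scaleB scaleA (seq x m) (seq y m) (seq x n) (seq y n)
         (x≤A m (proj₁ (⊔-split KL≤m))) (y≤B n (proj₂ (⊔-split {K} KL≤n)))
         (p m n (proj₁ (⊔-split MN≤m)) (proj₁ (⊔-split MN≤n)))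
         (q m n (proj₂ (⊔-split {M} MN≤m)) (proj₂ (⊔-split {M} MN≤n)))

private
  ptwise : ∀ x y → (∀ n → seq x n ≡ seq y n) → x ≈ʳ y
  ptwise x y eq ε 0<ε = 0 , λ n _ →
    subst (λ z → ∣ seq x n ℚ.- z ∣ ℚ.< ε) (eq n) (∣x-x∣< (seq x n) 0<ε)

  ≈ʳ-sym : ∀ {x y} → x ≈ʳ y → y ≈ʳ x
  ≈ʳ-sym {x} {y} x≈y ε 0<ε = let N , p = x≈y ε 0<ε in
    N , λ n n≥ → subst (ℚ._< ε) (∣x-y∣-sym (seq x n) (seq y n)) (p n n≥)

  ≈ʳ-trans : ∀ {x y z} → x ≈ʳ y → y ≈ʳ z → x ≈ʳ z
  ≈ʳ-trans {x} {y} {z} x≈y y≈z ε 0<ε =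
    let M , p = x≈y (half ε) (0<half {ε} 0<ε)
        N , q = y≈z (half ε) (0<half {ε} 0<ε) in
    M ℕ.⊔ N , λ n n≥ →
    subst (λ t → ∣ t ∣ ℚ.< ε)
      (ℚ-Solver.solve 3 (λ a b c → (a ⊕ ⊝ b) ⊕ (b ⊕ ⊝ c) , a ⊕ ⊝ c) refl (seq x n) (seq y n) (seq z n))
      (+-small {ε} {seq x n ℚ.- seq y n} {seq y n ℚ.- seq z n} (p n (proj₁ (⊔-split n≥))) (q n (proj₂ (⊔-split {M} n≥))))

  +ʳ-cong : ∀ {x x′ y y′} → x ≈ʳ x′ → y ≈ʳ y′ → x +ʳ y ≈ʳ x′ +ʳ y′
  +ʳ-cong {x} {x′} {y} {y′} x≈ y≈ ε 0<ε =
    let M , p = x≈ (half ε) (0<half {ε} 0<ε)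
        N , q = y≈ (half ε) (0<half {ε} 0<ε) in
    M ℕ.⊔ N , λ n n≥ →
    +-diff {ε} (seq x n) (seq y n) (seq x′ n) (seq y′ n)
      (p n (proj₁ (⊔-split n≥))) (q n (proj₂ (⊔-split {M} n≥)))

  *ʳ-cong : ∀ {x x′ y y′} → x ≈ʳ x′ → y ≈ʳ y′ → x *ʳ y ≈ʳ x′ *ʳ y′
  *ʳ-cong {x} {x′} {y} {y′} x≈ y≈ ε 0<ε =
    let A , A>0 , K , x≤A     = eventually-bounded x
        B , B>0 , L , y≤B     = eventually-bounded y′
        δ₁ , 0<δ₁ , scaleB = scale B B>0 ε 0<ε
        δ₂ , 0<δ₂ , scaleA = scale A A>0 ε 0<ε
        M , p = x≈ δ₁ 0<δ₁
        N , q = y≈ δ₂ 0<δ₂ in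
    (K ℕ.⊔ L) ℕ.⊔ (M ℕ.⊔ N) , λ n n≥ →
    let KL≤n , MN≤n = ⊔-split {K ℕ.⊔ L} n≥
    in *-diff {A} {B} {ε} scaleB scaleA (seq x n) (seq y n) (seq x′ n) (seq y′ n)
         (x≤A n (proj₁ (⊔-split KL≤n))) (y≤B n (proj₂ (⊔-split {K} KL≤n)))
         (p n (proj₁ (⊔-split MN≤n))) (q n (proj₂ (⊔-split {M} MN≤n)))

  -ʳ-cong : ∀ {x y} → x ≈ʳ y → -ʳ x ≈ʳ -ʳ y
  -ʳ-cong {x} {y} x≈y ε 0<ε = let N , p = x≈y ε 0<ε in
    N , λ n n≥ → neg-diff {ε} (seq x n) (seq y n) (p n n≥)

ℝ-commutativeRing : CommutativeRing 0ℓ 0ℓ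
ℝ-commutativeRing = record
  { Carrier = ℝ
  ; _≈_ = _≈ʳ_
  ; _+_ = _+ʳ_
  ; _*_ = _*ʳ_
  ; -_  = -ʳ_
  ; 0#  = fromℚ 0ℚ
  ; 1#  = fromℚ 1ℚ
  ; isCommutativeRing = record
    { isRing = record
      { +-isAbelianGroup = record
        { isGroup = record
          { isMonoid = record
            { isSemigroup = record
              { isMagma = record
                { isEquivalence = record
                  { refl  = λ {x} → ptwise x x (λ _ → refl)
                  ; sym   = λ {x} {y} → ≈ʳ-sym {x} {y}
                  ; trans = λ {x} {y} {z} → ≈ʳ-trans {x} {y} {z}
                  }
                ; ∙-cong = λ {x} {x′} {y} {y′} → +ʳ-cong {x} {x′} {y} {y′}
                }
              ; assoc = λ x y z → ptwise (x +ʳ y +ʳ z) (x +ʳ (y +ʳ z)) λ n → ℚ.+-assoc (seq x n) (seq y n) (seq z n)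
              }
            ; identity = (λ x → ptwise (fromℚ 0ℚ +ʳ x) x λ n → ℚ.+-identityˡ (seq x n))
                       , (λ x → ptwise (x +ʳ fromℚ 0ℚ) x λ n → ℚ.+-identityʳ (seq x n))
            }
          ; inverse = (λ x → ptwise (-ʳ x +ʳ x) (fromℚ 0ℚ) λ n → ℚ.+-inverseˡ (seq x n))
                    , (λ x → ptwise (x +ʳ -ʳ x) (fromℚ 0ℚ) λ n → ℚ.+-inverseʳ (seq x n))
          ; ⁻¹-cong = λ {x} {y} → -ʳ-cong {x} {y}
          }
        ; comm = λ x y → ptwise (x +ʳ y) (y +ʳ x) λ n → ℚ.+-comm (seq x n) (seq y n)
        }
      ; *-cong = λ {x} {x′} {y} {y′} → *ʳ-cong {x} {x′} {y} {y′}
      ; *-assoc = λ x y z → ptwise (x *ʳ y *ʳ z) (x *ʳ (y *ʳ z)) λ n → ℚ.*-assoc (seq x n) (seq y n) (seq z n)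
      ; *-identity = (λ x → ptwise (fromℚ 1ℚ *ʳ x) x λ n → ℚ.*-identityˡ (seq x n))
                   , (λ x → ptwise (x *ʳ fromℚ 1ℚ) x λ n → ℚ.*-identityʳ (seq x n))
      ; distrib = (λ x y z → ptwise (x *ʳ (y +ʳ z)) (x *ʳ y +ʳ x *ʳ z) λ n → ℚ.*-distribˡ-+ (seq x n) (seq y n) (seq z n))
                , (λ x y z → ptwise ((y +ʳ z) *ʳ x) (y *ʳ x +ʳ z *ʳ x) λ n → ℚ.*-distribʳ-+ (seq x n) (seq y n) (seq z n))
      }
    ; *-comm = λ x y → ptwise (x *ʳ y) (y *ʳ x) λ n → ℚ.*-comm (seq x n) (seq y n)
    }
  }

-- R[i]; the pair (a , b) stands for a + b i

module _ {c ℓ} (R : CommutativeRing c ℓ) where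
  open CommutativeRing R
    renaming (refl to ≈-refl; sym to ≈-sym; trans to ≈-trans)
  private
    module S = SemiringSolver commutativeSemiring
    open S using (_:+_; _:*_; _:=_)

    infixl 6 _+ᶜ_
    infixl 7 _*ᶜ_
    _+ᶜ_ _*ᶜ_ : Carrier × Carrier → Carrier × Carrier → Carrier × Carrier
    (a , b) +ᶜ (a′ , b′) = a + a′ , b + b′
    (a , b) *ᶜ (a′ , b′) = a * a′ - b * b′ , a * b′ + b * a′

  adjoin-i : CommutativeRing c ℓ
  adjoin-i = record
    { Carrier = Carrier × Carrier
    ; _≈_ = λ (a , b) (a′ , b′) → a ≈ a′ × b ≈ b′
    ; _+_ = _+ᶜ_
    ; _*_ = _*ᶜ_
    ; -_  = λ (a , b) → - a , - b
    ; 0#  = 0# , 0#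
    ; 1#  = 1# , 0#
    ; isCommutativeRing = record
      { isRing = record
        { +-isAbelianGroup = record
          { isGroup = record
            { isMonoid = record
              { isSemigroup = record
                { isMagma = record
                  { isEquivalence = record
                    { refl  = ≈-refl , ≈-refl
                    ; sym   = λ (p , q) → ≈-sym p , ≈-sym q
                    ; trans = λ (p , q) (p′ , q′) → ≈-trans p p′ , ≈-trans q q′
                    }
                  ; ∙-cong = λ (p , q) (p′ , q′) → +-cong p p′ , +-cong q q′
                  }
                ; assoc = λ (a , b) (c , d) (e , f) → +-assoc a c e , +-assoc b d f
                }
              ; identity = (λ (a , b) → +-identityˡ a , +-identityˡ b)
                         , (λ (a , b) → +-identityʳ a , +-identityʳ b)
              }
            ; inverse = (λ (a , b) → -‿inverseˡ a , -‿inverseˡ b)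
                      , (λ (a , b) → -‿inverseʳ a , -‿inverseʳ b)
            ; ⁻¹-cong = λ (p , q) → -‿cong p , -‿cong q
            }
          ; comm = λ (a , b) (c , d) → +-comm a c , +-comm b d
          }
        ; *-cong = *ᶜ-cong
        ; *-assoc = *ᶜ-assoc
        ; *-identity = *ᶜ-identityˡ , λ x → ≋-trans (*ᶜ-comm x (1# , 0#)) (*ᶜ-identityˡ x)
        ; distrib = *ᶜ-distribˡ , λ x y z →
            ≋-trans (*ᶜ-comm (y +ᶜ z) x) (≋-trans (*ᶜ-distribˡ x y z)
              (+-cong (proj₁ (*ᶜ-comm x y)) (proj₁ (*ᶜ-comm x z))
              , +-cong (proj₂ (*ᶜ-comm x y)) (proj₂ (*ᶜ-comm x z))))
        }
      ; *-comm = *ᶜ-comm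
      }
    }
    where
    open RingProperties ring using (-0#≈0#; -1*x≈-x)

    infix 4 _≋_
    _≋_ : Carrier × Carrier → Carrier × Carrier → Set _
    (a , b) ≋ (a′ , b′) = a ≈ a′ × b ≈ b′

    ≋-trans : ∀ {x y z} → x ≋ y → y ≋ z → x ≋ z
    ≋-trans (p , q) (p′ , q′) = ≈-trans p p′ , ≈-trans q q′

    *ᶜ-cong : ∀ {x x′ y y′} → x ≋ x′ → y ≋ y′ → x *ᶜ y ≋ x′ *ᶜ y′
    *ᶜ-cong (p , q) (p′ , q′) =
      +-cong (*-cong p p′) (-‿cong (*-cong q q′)) , +-cong (*-cong p q′) (*-cong q p′)

    *ᶜ-comm : ∀ x y → x *ᶜ y ≋ y *ᶜ x
    *ᶜ-comm (a , b) (c , d) =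
        +-cong (*-comm a c) (-‿cong (*-comm b d))
      , ≈-trans (+-comm _ _) (+-cong (*-comm b c) (*-comm a d))

    -- with m = -1# as an extra unknown, the identities below hold in every commutative semiring
    neg : ∀ x → - x ≈ - 1# * x
    neg x = ≈-sym (-1*x≈-x x)

    *ᶜ-assoc : ∀ x y z → x *ᶜ y *ᶜ z ≋ x *ᶜ (y *ᶜ z)
    *ᶜ-assoc (a , b) (c , d) (e , f) =
        ≈-trans (+-cong (*-congʳ (+-congˡ (neg (b * d)))) (neg ((a * d + b * c) * f)))
          (≈-trans
            (S.solve 7 (λ a b c d e f m →
              (a :* c :+ m :* (b :* d)) :* e :+ m :* ((a :* d :+ b :* c) :* f) :=
              a :* (c :* e :+ m :* (d :* f)) :+ m :* (b :* (c :* f :+ d :* e))) ≈-refl a b c d e f (- 1#))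
            (≈-sym (+-cong (*-congˡ (+-congˡ (neg (d * f)))) (neg (b * (c * f + d * e))))))
      , ≈-trans (+-congʳ (*-congʳ (+-congˡ (neg (b * d)))))
          (≈-trans
            (S.solve 7 (λ a b c d e f m →
              (a :* c :+ m :* (b :* d)) :* f :+ (a :* d :+ b :* c) :* e :=
              a :* (c :* f :+ d :* e) :+ b :* (c :* e :+ m :* (d :* f))) ≈-refl a b c d e f (- 1#))
            (≈-sym (+-congˡ (*-congˡ (+-congˡ (neg (d * f)))))))

    *ᶜ-identityˡ : ∀ x → (1# , 0#) *ᶜ x ≋ x
    *ᶜ-identityˡ (a , b) =
        ≈-trans (+-cong (*-identityˡ a) (≈-trans (-‿cong (zeroˡ b)) -0#≈0#)) (+-identityʳ a)
      , ≈-trans (+-cong (*-identityˡ b) (zeroˡ a)) (+-identityʳ b)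

    *ᶜ-distribˡ : ∀ x y z → x *ᶜ (y +ᶜ z) ≋ x *ᶜ y +ᶜ x *ᶜ z
    *ᶜ-distribˡ (a , b) (c , d) (e , f) =
        ≈-trans (+-congˡ (neg (b * (d + f))))
          (≈-trans
            (S.solve 7 (λ a b c d e f m →
              a :* (c :+ e) :+ m :* (b :* (d :+ f)) :=
              (a :* c :+ m :* (b :* d)) :+ (a :* e :+ m :* (b :* f))) ≈-refl a b c d e f (- 1#))
            (≈-sym (+-cong (+-congˡ (neg (b * d))) (+-congˡ (neg (b * f))))))
      , S.solve 6 (λ a b c d e f →
          a :* (d :+ f) :+ b :* (c :+ e) :=
          (a :* d :+ b :* c) :+ (a :* f :+ b :* e)) ≈-refl a b c d e f

ℂ : CommutativeRing 0ℓ 0ℓ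
ℂ = adjoin-i ℝ-commutativeRing

infix  4 _≈ₚ_ _≈ₚ?_
infixl 7 _·_

_≈ₚ_ : ∀ {n} → Permutation′ n → Permutation′ n → Set
_≈ₚ_ = Perm._≈_

_≈ₚ?_ : ∀ {n} (σ τ : Permutation′ n) → Dec (σ ≈ₚ τ)
σ ≈ₚ? τ = Fin.all? λ i → (σ ⟨$⟩ʳ i) Fin.≟ (τ ⟨$⟩ʳ i)

-- products compose from right to left: (σ · τ) ⟨$⟩ʳ i = σ ⟨$⟩ʳ (τ ⟨$⟩ʳ i)
_·_ : ∀ {n} → Permutation′ n → Permutation′ n → Permutation′ n
σ · τ = τ Perm.∘ₚ σ

_⁻¹ : ∀ {n} → Permutation′ n → Permutation′ n
_⁻¹ = Perm.flip

⁻¹-cong : ∀ {n} {σ τ : Permutation′ n} → σ ≈ₚ τ → σ ⁻¹ ≈ₚ τ ⁻¹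
⁻¹-cong {σ = σ} {τ} σ≈τ i =
  trans (cong (σ ⟨$⟩ˡ_) (trans (sym (Perm.inverseʳ τ)) (sym (σ≈τ (τ ⟨$⟩ˡ i))))) (Perm.inverseˡ σ)

inversions : ∀ {n} → Permutation′ n → ℕ
inversions {n} σ = ∑[ i < n ] ∑[ j < n ]
    (if does ((i Fin.<? j) ×-dec ((σ ⟨$⟩ʳ j) Fin.<? (σ ⟨$⟩ʳ i))) then 1 else 0)
  where open CommutativeMonoidSum ℕ.+-0-commutativeMonoid using (sum-syntax)

module PermutationSum {c ℓ} (M : CommutativeMonoid c ℓ) where
  open CommutativeMonoid M
    renaming (_∙_ to _+_; ε to 0#; refl to ≈-refl; sym to ≈-sym; trans to ≈-trans)
  open CommutativeMonoidSum M

  -- Each permutation of Fin (suc n) is  insert zero i π  for exactly one i and one π,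
  -- so f is evaluated once on each element of Sₙ.
  ∑ₚ : ∀ {n} → (Permutation′ n → Carrier) → Carrier
  ∑ₚ {zero}  f = f Perm.id
  ∑ₚ {suc n} f = ∑[ i < suc n ] ∑ₚ (λ π → f (insert zero i π))

  ∑-over : ∀ {n p} {P : Pred (Permutation′ n) p} → Decidable P → (Permutation′ n → Carrier) → Carrier
  ∑-over P? f = ∑ₚ (λ σ → if does (P? σ) then f σ else 0#)

  infixr 6 ∑-over
  syntax ∑-over P? (λ σ → x) = ∑[ σ ∈ P? ] x

  Respectful : ∀ {n} → (Permutation′ n → Carrier) → Set ℓ
  Respectful f = ∀ σ τ → σ ≈ₚ τ → f σ ≈ f τ

  ∑ₚ-cong : ∀ {n} {f g : Permutation′ n → Carrier} → (∀ σ → f σ ≈ g σ) → ∑ₚ f ≈ ∑ₚ g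
  ∑ₚ-cong {zero}  f≈g = f≈g Perm.id
  ∑ₚ-cong {suc n} f≈g = sum-cong-≋ λ i → ∑ₚ-cong λ π → f≈g (insert zero i π)

  ∑ₚ-distrib-+ : ∀ {n} (f g : Permutation′ n → Carrier) → ∑ₚ (λ σ → f σ + g σ) ≈ ∑ₚ f + ∑ₚ g
  ∑ₚ-distrib-+ {zero}  f g = ≈-refl
  ∑ₚ-distrib-+ {suc n} f g =
    ≈-trans (sum-cong-≋ λ i → ∑ₚ-distrib-+ (f ∘ insert zero i) (g ∘ insert zero i))
            (∑-distrib-+ (λ i → ∑ₚ (f ∘ insert zero i)) (λ i → ∑ₚ (g ∘ insert zero i)))

  ∑ₚ-0 : ∀ {n} {f : Permutation′ n → Carrier} → (∀ σ → f σ ≈ 0#) → ∑ₚ f ≈ 0#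
  ∑ₚ-0 {zero}  f≈0 = f≈0 Perm.id
  ∑ₚ-0 {suc n} f≈0 =
    ≈-trans (sum-cong-≋ λ i → ∑ₚ-0 λ π → f≈0 (insert zero i π)) (sum-replicate-zero (suc n))

  ∑ₚ-∑-comm : ∀ {m n} (f : Fin m → Permutation′ n → Carrier) →
              ∑[ i < m ] ∑ₚ (f i) ≈ ∑ₚ (λ σ → ∑[ i < m ] f i σ)
  ∑ₚ-∑-comm {m} {zero}  f = ≈-refl
  ∑ₚ-∑-comm {m} {suc n} f =
    ≈-trans (∑-comm (λ i j → ∑ₚ (f i ∘ insert zero j)))
            (sum-cong-≋ λ j → ∑ₚ-∑-comm (λ i → f i ∘ insert zero j))

  ∑ₚ-comm : ∀ {m n} (f : Permutation′ m → Permutation′ n → Carrier) →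
            ∑ₚ (λ σ → ∑ₚ (f σ)) ≈ ∑ₚ (λ τ → ∑ₚ (λ σ → f σ τ))
  ∑ₚ-comm {zero}  f = ≈-refl
  ∑ₚ-comm {suc m} f =
    ≈-trans (sum-cong-≋ λ i → ∑ₚ-comm (f ∘ insert zero i))
            (∑ₚ-∑-comm (λ i τ → ∑ₚ (λ σ → f (insert zero i σ) τ)))

  ·-insert : ∀ {n} (ρ : Permutation′ (suc n)) i π →
             ρ · insert zero i π ≈ₚ insert zero (ρ ⟨$⟩ʳ i) (remove i ρ · π)
  ·-insert ρ i π zero    = refl
  ·-insert ρ i π (suc k) = Perm.punchIn-permute ρ i (π ⟨$⟩ʳ k)

  insert-cong : ∀ {n} i {π π′ : Permutation′ n} → π ≈ₚ π′ → insert zero i π ≈ₚ insert zero i π′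
  insert-cong i π≈π′ zero    = refl
  insert-cong i π≈π′ (suc k) = cong (Fin.punchIn i) (π≈π′ k)

  ∑ₚ-translate : ∀ {n} (ρ : Permutation′ n) (f : Permutation′ n → Carrier) → Respectful f →
                 ∑ₚ (λ σ → f (ρ · σ)) ≈ ∑ₚ f
  ∑ₚ-translate {zero}  ρ f resp = resp (ρ · Perm.id) Perm.id λ ()
  ∑ₚ-translate {suc n} ρ f resp =
    ≈-trans (sum-cong-≋ λ i →
      ≈-trans (∑ₚ-cong λ π → resp (ρ · insert zero i π) (insert zero (ρ ⟨$⟩ʳ i) (remove i ρ · π)) (·-insert ρ i π))
              (∑ₚ-translate (remove i ρ) (f ∘ insert zero (ρ ⟨$⟩ʳ i)) λ π π′ eq →
                resp (insert zero (ρ ⟨$⟩ʳ i) π) (insert zero (ρ ⟨$⟩ʳ i) π′) (insert-cong (ρ ⟨$⟩ʳ i) {π} {π′} eq)))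
      (≈-sym (sum-permute (λ i → ∑ₚ (f ∘ insert zero i)) ρ))

  ∑ₚ-id : ∀ {n} (f : Permutation′ n → Carrier) → Respectful f →
          (∀ σ → ¬ σ ≈ₚ Perm.id → f σ ≈ 0#) → ∑ₚ f ≈ f Perm.id
  ∑ₚ-id {zero}  f resp f≈0 = ≈-refl
  ∑ₚ-id {suc n} f resp f≈0 = ≈-trans (∙-cong zero-term other-terms) (identityʳ (f Perm.id))
    where
    insert-id : insert {n} {n} zero zero Perm.id ≈ₚ Perm.id
    insert-id zero    = refl
    insert-id (suc k) = refl

    zero-term : ∑ₚ (λ π → f (insert zero zero π)) ≈ f Perm.id
    zero-term = ≈-trans
      (∑ₚ-id (f ∘ insert zero zero) (λ π π′ eq → resp (insert zero zero π) (insert zero zero π′) (insert-cong zero {π} {π′} eq))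
        (λ π π≉id → f≈0 (insert zero zero π) λ eq → π≉id λ k → Fin.suc-injective (eq (suc k))))
      (resp (insert zero zero Perm.id) Perm.id insert-id)

    other-terms : sum (λ i → ∑ₚ (λ π → f (insert zero (suc i) π))) ≈ 0#
    other-terms = ≈-trans
      (sum-cong-≋ λ i → ∑ₚ-0 λ π → f≈0 (insert zero (suc i) π) λ eq → case-absurd (eq zero))
      (sum-replicate-zero n)
      where
      case-absurd : ∀ {i} {A : Set} → _≡_ {A = Fin (suc n)} (suc i) zero → A
      case-absurd ()

-- K[Sₙ]: an element is its coefficient function, and [ σ ] is the basis element σ

module GroupAlgebra {c ℓ} (K : CommutativeRing c ℓ) (n : ℕ) where
  open CommutativeRing K hiding (zero; ring)
    renaming (refl to ≈-refl; sym to ≈-sym; trans to ≈-trans; reflexive to ≈-reflexive)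
  open PermutationSum +-commutativeMonoid
  open SemiringSum semiring using (*-distribˡ-sum; *-distribʳ-sum; sum-cong-≋)
  open SetoidReasoning setoid

  record Element : Set (c ⊔ ℓ) where
    constructor mkElement
    field
      coeff      : Permutation′ n → Carrier
      coeff-cong : ∀ σ τ → σ ≈ₚ τ → coeff σ ≈ coeff τ

  open Element public

  infix  4 _≈ᴬ_
  infixl 6 _+ᴬ_
  infixl 7 _*ᴬ_
  infixr 8 -ᴬ_
  infixr 7 _•_

  _≈ᴬ_ : Element → Element → Set ℓ
  x ≈ᴬ y = ∀ σ → coeff x σ ≈ coeff y σ

  _+ᴬ_ : Element → Element → Element
  x +ᴬ y = mkElement (λ σ → coeff x σ + coeff y σ)
                     (λ σ τ eq → +-cong (coeff-cong x σ τ eq) (coeff-cong y σ τ eq))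

  -ᴬ_ : Element → Element
  -ᴬ x = mkElement (λ σ → - coeff x σ) (λ σ τ eq → -‿cong (coeff-cong x σ τ eq))

  0ᴬ : Element
  0ᴬ = mkElement (λ _ → 0#) (λ _ _ _ → ≈-refl)

  _•_ : Carrier → Element → Element
  r • x = mkElement (λ σ → r * coeff x σ) (λ σ τ eq → *-congˡ (coeff-cong x σ τ eq))

  [_] : Permutation′ n → Element
  [ σ ] = mkElement (λ τ → if does (σ ≈ₚ? τ) then 1# else 0#) respects
    where
    respects : ∀ τ τ′ → τ ≈ₚ τ′ →
      (if does (σ ≈ₚ? τ) then 1# else 0#) ≈ (if does (σ ≈ₚ? τ′) then 1# else 0#)
    respects τ τ′ τ≈τ′ = ≈-reflexive (cong (if_then 1# else 0#) (does-⇔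
      (mk⇔ (λ eq i → trans (eq i) (τ≈τ′ i)) (λ eq i → trans (eq i) (sym (τ≈τ′ i))))
      (σ ≈ₚ? τ) (σ ≈ₚ? τ′)))

  1ᴬ : Element
  1ᴬ = [ Perm.id ]

  _*ᴬ_ : Element → Element → Element
  x *ᴬ y = mkElement (λ σ → ∑ₚ (λ τ → coeff x τ * coeff y (τ ⁻¹ · σ)))
                     (λ σ σ′ eq → ∑ₚ-cong {n} λ τ → *-congˡ (coeff-cong y (τ ⁻¹ · σ) (τ ⁻¹ · σ′) λ i → cong (τ ⟨$⟩ˡ_) (eq i)))

  sgn : Permutation′ n → Carrier
  sgn σ = (- 1#) ^ inversions σ
    where open SemiringExp semiring using (_^_)

  *-distribˡ-∑ₚ : ∀ {m} r (f : Permutation′ m → Carrier) → r * ∑ₚ f ≈ ∑ₚ (λ σ → r * f σ)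
  *-distribˡ-∑ₚ {zero}  r f = ≈-refl
  *-distribˡ-∑ₚ {suc m} r f =
    ≈-trans (*-distribˡ-sum r (λ i → ∑ₚ (f ∘ insert zero i)))
            (sum-cong-≋ λ i → *-distribˡ-∑ₚ r (f ∘ insert zero i))

  *-distribʳ-∑ₚ : ∀ {m} r (f : Permutation′ m → Carrier) → ∑ₚ f * r ≈ ∑ₚ (λ σ → f σ * r)
  *-distribʳ-∑ₚ {zero}  r f = ≈-refl
  *-distribʳ-∑ₚ {suc m} r f =
    ≈-trans (*-distribʳ-sum r (λ i → ∑ₚ (f ∘ insert zero i)))
            (sum-cong-≋ λ i → *-distribʳ-∑ₚ r (f ∘ insert zero i))

  [id]-id : ∀ σ → σ ≈ₚ Perm.id → coeff 1ᴬ σ ≈ 1#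
  [id]-id σ eq = ≈-reflexive
    (cong (if_then 1# else 0#) (dec-true (Perm.id ≈ₚ? σ) (λ i → sym (eq i))))

  [id]-≉id : ∀ σ → ¬ σ ≈ₚ Perm.id → coeff 1ᴬ σ ≈ 0#
  [id]-≉id σ neq = ≈-reflexive
    (cong (if_then 1# else 0#) (dec-false (Perm.id ≈ₚ? σ) (λ eq → neq λ i → sym (eq i))))

  *ᴬ-cong : ∀ {x x′ y y′} → x ≈ᴬ x′ → y ≈ᴬ y′ → x *ᴬ y ≈ᴬ x′ *ᴬ y′
  *ᴬ-cong p q σ = ∑ₚ-cong {n} λ τ → *-cong (p τ) (q (τ ⁻¹ · σ))

  *ᴬ-assoc : ∀ x y z → (x *ᴬ y) *ᴬ z ≈ᴬ x *ᴬ (y *ᴬ z)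
  *ᴬ-assoc x y z σ = begin
    ∑ₚ (λ τ → ∑ₚ (λ ρ → coeff x ρ * coeff y (ρ ⁻¹ · τ)) * coeff z (τ ⁻¹ · σ))
      ≈⟨ ∑ₚ-cong {n} (λ τ → *-distribʳ-∑ₚ {n} (coeff z (τ ⁻¹ · σ)) (λ ρ → coeff x ρ * coeff y (ρ ⁻¹ · τ))) ⟩
    ∑ₚ (λ τ → ∑ₚ (λ ρ → coeff x ρ * coeff y (ρ ⁻¹ · τ) * coeff z (τ ⁻¹ · σ)))
      ≈⟨ ∑ₚ-comm {n} {n} (λ τ ρ → coeff x ρ * coeff y (ρ ⁻¹ · τ) * coeff z (τ ⁻¹ · σ)) ⟩
    ∑ₚ (λ ρ → ∑ₚ (λ τ → coeff x ρ * coeff y (ρ ⁻¹ · τ) * coeff z (τ ⁻¹ · σ)))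
      ≈⟨ ∑ₚ-cong {n} (λ ρ → ∑ₚ-translate {n} ρ (λ τ → coeff x ρ * coeff y (ρ ⁻¹ · τ) * coeff z (τ ⁻¹ · σ)) (resp ρ)) ⟨
    ∑ₚ (λ ρ → ∑ₚ (λ τ → coeff x ρ * coeff y (ρ ⁻¹ · (ρ · τ)) * coeff z ((ρ · τ) ⁻¹ · σ)))
      ≈⟨ ∑ₚ-cong {n} (λ ρ → ∑ₚ-cong {n} λ τ →
           ≈-trans (*-assoc _ _ _)
                   (*-congˡ (*-congʳ (coeff-cong y (ρ ⁻¹ · (ρ · τ)) τ λ i → Perm.inverseˡ ρ)))) ⟩
    ∑ₚ (λ ρ → ∑ₚ (λ τ → coeff x ρ * (coeff y τ * coeff z (τ ⁻¹ · (ρ ⁻¹ · σ)))))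
      ≈⟨ ∑ₚ-cong {n} (λ ρ → *-distribˡ-∑ₚ {n} (coeff x ρ) (λ τ → coeff y τ * coeff z (τ ⁻¹ · (ρ ⁻¹ · σ)))) ⟨
    ∑ₚ (λ ρ → coeff x ρ * ∑ₚ (λ τ → coeff y τ * coeff z (τ ⁻¹ · (ρ ⁻¹ · σ)))) ∎
    where
    resp : ∀ ρ → Respectful (λ τ → coeff x ρ * coeff y (ρ ⁻¹ · τ) * coeff z (τ ⁻¹ · σ))
    resp ρ τ τ′ eq = *-cong
      (*-congˡ (coeff-cong y (ρ ⁻¹ · τ) (ρ ⁻¹ · τ′) λ i → cong (ρ ⟨$⟩ˡ_) (eq i)))
      (coeff-cong z (τ ⁻¹ · σ) (τ′ ⁻¹ · σ) λ i → ⁻¹-cong {σ = τ} {τ′} eq (σ ⟨$⟩ʳ i))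

  *ᴬ-identityˡ : ∀ x → 1ᴬ *ᴬ x ≈ᴬ x
  *ᴬ-identityˡ x σ = ≈-trans
    (∑ₚ-id {n} (λ τ → coeff 1ᴬ τ * coeff x (τ ⁻¹ · σ))
      (λ τ τ′ eq → *-cong (coeff-cong 1ᴬ τ τ′ eq)
        (coeff-cong x (τ ⁻¹ · σ) (τ′ ⁻¹ · σ) λ i → ⁻¹-cong {σ = τ} {τ′} eq (σ ⟨$⟩ʳ i)))
      (λ τ τ≉id → ≈-trans (*-congʳ ([id]-≉id τ τ≉id)) (zeroˡ _)))
    (≈-trans (*-cong ([id]-id Perm.id λ _ → refl) (coeff-cong x (Perm.id ⁻¹ · σ) σ λ _ → refl)) (*-identityˡ _))

  *ᴬ-identityʳ : ∀ x → x *ᴬ 1ᴬ ≈ᴬ x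
  *ᴬ-identityʳ x σ = begin
    ∑ₚ f                    ≈⟨ ∑ₚ-translate {n} σ f resp ⟨
    ∑ₚ (λ τ → f (σ · τ))    ≈⟨ ∑ₚ-id {n} (λ τ → f (σ · τ)) (λ τ τ′ eq → resp (σ · τ) (σ · τ′) λ i → cong (σ ⟨$⟩ʳ_) (eq i)) vanish ⟩
    f (σ · Perm.id)         ≈⟨ *-cong (coeff-cong x (σ · Perm.id) σ λ _ → refl)
                                 ([id]-id ((σ · Perm.id) ⁻¹ · σ) λ i → Perm.inverseˡ σ) ⟩
    coeff x σ * 1#          ≈⟨ *-identityʳ _ ⟩
    coeff x σ               ∎
    where
    f : Permutation′ n → Carrier
    f τ = coeff x τ * coeff 1ᴬ (τ ⁻¹ · σ)

    resp : Respectful f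
    resp τ τ′ eq = *-cong (coeff-cong x τ τ′ eq)
      (coeff-cong 1ᴬ (τ ⁻¹ · σ) (τ′ ⁻¹ · σ) λ i → ⁻¹-cong {σ = τ} {τ′} eq (σ ⟨$⟩ʳ i))

    vanish : ∀ τ → ¬ τ ≈ₚ Perm.id → f (σ · τ) ≈ 0#
    vanish τ τ≉id = ≈-trans (*-congˡ ([id]-≉id ((σ · τ) ⁻¹ · σ) λ eq → τ≉id λ i →
      trans (cong (τ ⟨$⟩ʳ_) (sym (trans (cong (τ ⟨$⟩ˡ_) (sym (Perm.inverseˡ σ))) (eq i))))
            (Perm.inverseʳ τ)))
      (zeroʳ _)

  *ᴬ-distribˡ : ∀ x y z → x *ᴬ (y +ᴬ z) ≈ᴬ x *ᴬ y +ᴬ x *ᴬ z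
  *ᴬ-distribˡ x y z σ = ≈-trans (∑ₚ-cong {n} λ τ → distribˡ _ _ _)
    (∑ₚ-distrib-+ {n} (λ τ → coeff x τ * coeff y (τ ⁻¹ · σ)) (λ τ → coeff x τ * coeff z (τ ⁻¹ · σ)))

  *ᴬ-distribʳ : ∀ x y z → (y +ᴬ z) *ᴬ x ≈ᴬ y *ᴬ x +ᴬ z *ᴬ x
  *ᴬ-distribʳ x y z σ = ≈-trans (∑ₚ-cong {n} λ τ → distribʳ _ _ _)
    (∑ₚ-distrib-+ {n} (λ τ → coeff y τ * coeff x (τ ⁻¹ · σ)) (λ τ → coeff z τ * coeff x (τ ⁻¹ · σ)))

  ring : Ring (c ⊔ ℓ) ℓ
  ring = record
    { Carrier = Element
    ; _≈_ = _≈ᴬ_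
    ; _+_ = _+ᴬ_
    ; _*_ = _*ᴬ_
    ; -_  = -ᴬ_
    ; 0#  = 0ᴬ
    ; 1#  = 1ᴬ
    ; isRing = record
      { +-isAbelianGroup = record
        { isGroup = record
          { isMonoid = record
            { isSemigroup = record
              { isMagma = record
                { isEquivalence = record
                  { refl  = λ σ → ≈-refl
                  ; sym   = λ p σ → ≈-sym (p σ)
                  ; trans = λ p q σ → ≈-trans (p σ) (q σ)
                  }
                ; ∙-cong = λ p q σ → +-cong (p σ) (q σ)
                }
              ; assoc = λ x y z σ → +-assoc _ _ _
              }
            ; identity = (λ x σ → +-identityˡ _) , (λ x σ → +-identityʳ _)
            }
          ; inverse = (λ x σ → -‿inverseˡ _) , (λ x σ → -‿inverseʳ _)
          ; ⁻¹-cong = λ p σ → -‿cong (p σ)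
          }
        ; comm = λ x y σ → +-comm _ _
        }
      ; *-cong = λ {x} {x′} {y} {y′} → *ᴬ-cong {x} {x′} {y} {y′}
      ; *-assoc = *ᴬ-assoc
      ; *-identity = *ᴬ-identityˡ , *ᴬ-identityʳ
      ; distrib = *ᴬ-distribˡ , *ᴬ-distribʳ
      }
    }

module _ {r ℓr} {R : Ring r ℓr} where
  open Ring R using (Carrier)

  record Submodule {m ℓm} (M : LeftModule R m ℓm) p : Set (r ⊔ m ⊔ ℓm ⊔ lsuc p) where
    open LeftModule M
    field
      Member   : Pred Carrierᴹ p
      resp     : ∀ {x y} → x ≈ᴹ y → Member x → Member y
      0-closed : Member 0ᴹ
      +-closed : ∀ {x y} → Member x → Member y → Member (x +ᴹ y)
      *-closed : ∀ a {x} → Member x → Member (a *ₗ x)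

  open Submodule

  module _ {m ℓm p} {M : LeftModule R m ℓm} (N : Submodule M p) where
    open LeftModule M

    private
      module R = Ring R

    neg-closed : ∀ {x} → Member N x → Member N (-ᴹ x)
    neg-closed {x} x∈N = resp N -1*x≈-x (*-closed N (R.- R.1#) x∈N)
      where
      -1*x≈-x : (R.- R.1#) *ₗ x ≈ᴹ -ᴹ x
      -1*x≈-x = LeftModuleProperties.inverseˡ-uniqueᴹ M ((R.- R.1#) *ₗ x) x
        (≈ᴹ-trans (+ᴹ-cong ≈ᴹ-refl (≈ᴹ-sym (*ₗ-identityˡ x)))
          (≈ᴹ-trans (≈ᴹ-sym (*ₗ-distribʳ x (R.- R.1#) R.1#))
            (≈ᴹ-trans (*ₗ-cong (R.-‿inverseˡ R.1#) ≈ᴹ-refl) (*ₗ-zeroˡ x))))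

    toModule : LeftModule R (m ⊔ p) ℓm
    toModule = record
      { Carrierᴹ = Σ Carrierᴹ (Member N)
      ; _≈ᴹ_ = λ x y → proj₁ x ≈ᴹ proj₁ y
      ; _+ᴹ_ = λ (x , x∈N) (y , y∈N) → x +ᴹ y , +-closed N x∈N y∈N
      ; _*ₗ_ = λ a (x , x∈N) → a *ₗ x , *-closed N a x∈N
      ; 0ᴹ = 0ᴹ , 0-closed N
      ; -ᴹ_ = λ (x , x∈N) → -ᴹ x , neg-closed x∈N
      ; isLeftModule = record
        { isLeftSemimodule = record
          { +ᴹ-isCommutativeMonoid = record
            { isMonoid = record
              { isSemigroup = record
                { isMagma = record
                  { isEquivalence = record { refl = ≈ᴹ-refl ; sym = ≈ᴹ-sym ; trans = ≈ᴹ-trans }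
                  ; ∙-cong = +ᴹ-cong
                  }
                ; assoc = λ _ _ _ → +ᴹ-assoc _ _ _
                }
              ; identity = (λ _ → +ᴹ-identityˡ _) , (λ _ → +ᴹ-identityʳ _)
              }
            ; comm = λ _ _ → +ᴹ-comm _ _
            }
          ; isPreleftSemimodule = record
            { *ₗ-cong = *ₗ-cong
            ; *ₗ-zeroˡ = λ _ → *ₗ-zeroˡ _
            ; *ₗ-distribʳ = λ _ _ _ → *ₗ-distribʳ _ _ _
            ; *ₗ-identityˡ = λ _ → *ₗ-identityˡ _
            ; *ₗ-assoc = λ _ _ _ → *ₗ-assoc _ _ _
            ; *ₗ-zeroʳ = λ _ → *ₗ-zeroʳ _
            ; *ₗ-distribˡ = λ _ _ _ → *ₗ-distribˡ _ _ _
            }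
          }
        ; -ᴹ‿cong = -ᴹ‿cong
        ; -ᴹ‿inverse = (λ _ → proj₁ -ᴹ‿inverse _) , (λ _ → proj₂ -ᴹ‿inverse _)
        }
      }

  infixl 6 _/_

  _/_ : ∀ {m ℓm p} (M : LeftModule R m ℓm) → Submodule M p → LeftModule R m p
  _/_ {p = p} M N = record
    { Carrierᴹ = Carrierᴹ
    ; _≈ᴹ_ = _∼_
    ; _+ᴹ_ = _+ᴹ_
    ; _*ₗ_ = _*ₗ_
    ; 0ᴹ = 0ᴹ
    ; -ᴹ_ = -ᴹ_
    ; isLeftModule = record
      { isLeftSemimodule = record
        { +ᴹ-isCommutativeMonoid = record
          { isMonoid = record
            { isSemigroup = record
              { isMagma = record
                { isEquivalence = record { refl = ≈⇒∼ ≈ᴹ-refl ; sym = ∼-sym ; trans = ∼-trans }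
                ; ∙-cong = ∼-+-cong
                }
              ; assoc = λ _ _ _ → ≈⇒∼ (+ᴹ-assoc _ _ _)
              }
            ; identity = (λ _ → ≈⇒∼ (+ᴹ-identityˡ _)) , (λ _ → ≈⇒∼ (+ᴹ-identityʳ _))
            }
          ; comm = λ _ _ → ≈⇒∼ (+ᴹ-comm _ _)
          }
        ; isPreleftSemimodule = record
          { *ₗ-cong = λ {a} {b} a≈b x∼y → ∼-trans (≈⇒∼ (*ₗ-cong a≈b ≈ᴹ-refl)) (∼-*-congˡ b x∼y)
          ; *ₗ-zeroˡ = λ _ → ≈⇒∼ (*ₗ-zeroˡ _)
          ; *ₗ-distribʳ = λ _ _ _ → ≈⇒∼ (*ₗ-distribʳ _ _ _)
          ; *ₗ-identityˡ = λ _ → ≈⇒∼ (*ₗ-identityˡ _)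
          ; *ₗ-assoc = λ _ _ _ → ≈⇒∼ (*ₗ-assoc _ _ _)
          ; *ₗ-zeroʳ = λ _ → ≈⇒∼ (*ₗ-zeroʳ _)
          ; *ₗ-distribˡ = λ _ _ _ → ≈⇒∼ (*ₗ-distribˡ _ _ _)
          }
        }
      ; -ᴹ‿cong = ∼-neg-cong
      ; -ᴹ‿inverse = (λ _ → ≈⇒∼ (proj₁ -ᴹ‿inverse _)) , (λ _ → ≈⇒∼ (proj₂ -ᴹ‿inverse _))
      }
    }
    where
    open LeftModule M
    open AbelianGroupProperties +ᴹ-abelianGroup using (⁻¹-involutive; ⁻¹-∙-comm)
    module R = Ring R

    infix 4 _∼_
    _∼_ : Carrierᴹ → Carrierᴹ → Set p
    x ∼ y = Member N (x +ᴹ -ᴹ y)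

    ≈⇒∼ : ∀ {x y} → x ≈ᴹ y → x ∼ y
    ≈⇒∼ {x} {y} x≈y =
      resp N (≈ᴹ-sym (≈ᴹ-trans (+ᴹ-cong x≈y ≈ᴹ-refl) (proj₂ -ᴹ‿inverse y))) (0-closed N)

    interchange : ∀ a b c d → (a +ᴹ b) +ᴹ (c +ᴹ d) ≈ᴹ (a +ᴹ c) +ᴹ (b +ᴹ d)
    interchange a b c d =
      ≈ᴹ-trans (+ᴹ-assoc a b (c +ᴹ d))
        (≈ᴹ-trans (+ᴹ-cong ≈ᴹ-refl
          (≈ᴹ-trans (≈ᴹ-sym (+ᴹ-assoc b c d))
            (≈ᴹ-trans (+ᴹ-cong (+ᴹ-comm b c) ≈ᴹ-refl) (+ᴹ-assoc c b d))))
          (≈ᴹ-sym (+ᴹ-assoc a c (b +ᴹ d))))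

    ∼-neg-cong : ∀ {x y} → x ∼ y → -ᴹ x ∼ -ᴹ y
    ∼-neg-cong {x} {y} p = resp N (≈ᴹ-sym (⁻¹-∙-comm x (-ᴹ y))) (neg-closed N p)

    ∼-sym : ∀ {x y} → x ∼ y → y ∼ x
    ∼-sym {x} {y} p =
      resp N (≈ᴹ-trans (+ᴹ-comm (-ᴹ x) (-ᴹ -ᴹ y)) (+ᴹ-cong (⁻¹-involutive y) ≈ᴹ-refl)) (∼-neg-cong p)

    ∼-trans : ∀ {x y z} → x ∼ y → y ∼ z → x ∼ z
    ∼-trans {x} {y} {z} p q = resp N
      (≈ᴹ-trans (+ᴹ-assoc x (-ᴹ y) (y +ᴹ -ᴹ z))
        (+ᴹ-cong ≈ᴹ-refl
          (≈ᴹ-trans (≈ᴹ-sym (+ᴹ-assoc (-ᴹ y) y (-ᴹ z)))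
            (≈ᴹ-trans (+ᴹ-cong (proj₁ -ᴹ‿inverse y) ≈ᴹ-refl) (+ᴹ-identityˡ (-ᴹ z))))))
      (+-closed N p q)

    ∼-+-cong : ∀ {x x′ y y′} → x ∼ x′ → y ∼ y′ → x +ᴹ y ∼ x′ +ᴹ y′
    ∼-+-cong {x} {x′} {y} {y′} p q = resp N
      (≈ᴹ-trans (interchange x (-ᴹ x′) y (-ᴹ y′)) (+ᴹ-cong ≈ᴹ-refl (⁻¹-∙-comm x′ y′)))
      (+-closed N p q)

    ∼-*-congˡ : ∀ a {x y} → x ∼ y → a *ₗ x ∼ a *ₗ y
    ∼-*-congˡ a {x} {y} p = resp N
      (≈ᴹ-trans (*ₗ-distribˡ a x (-ᴹ y)) (+ᴹ-cong ≈ᴹ-refl a*-y≈-a*y))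
      (*-closed N a p)
      where
      a*-y≈-a*y : a *ₗ (-ᴹ y) ≈ᴹ -ᴹ (a *ₗ y)
      a*-y≈-a*y = LeftModuleProperties.inverseˡ-uniqueᴹ M (a *ₗ (-ᴹ y)) (a *ₗ y)
        (≈ᴹ-trans (≈ᴹ-sym (*ₗ-distribˡ a (-ᴹ y) y))
          (≈ᴹ-trans (*ₗ-cong R.refl (proj₁ -ᴹ‿inverse y)) (*ₗ-zeroʳ a)))

  infix 4 _⊆ᴹ_

  _⊆ᴹ_ : ∀ {m ℓm p q} {M : LeftModule R m ℓm} → Submodule M p → Submodule M q → Set (m ⊔ p ⊔ q)
  N ⊆ᴹ N′ = ∀ {x} → Member N x → Member N′ x

  IsZero : ∀ {m ℓm p} {M : LeftModule R m ℓm} → Submodule M p → Set (m ⊔ ℓm ⊔ p)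
  IsZero {M = M} N = ∀ {x} → Member N x → x ≈ᴹ 0ᴹ
    where open LeftModule M

  IsWhole : ∀ {m ℓm p} {M : LeftModule R m ℓm} → Submodule M p → Set (m ⊔ p)
  IsWhole N = ∀ x → Member N x

  -- N ∩ N′ as a submodule of N; it is N′ itself when N′ ⊆ N
  _within_ : ∀ {m ℓm p q} {M : LeftModule R m ℓm} →
             Submodule M q → (N : Submodule M p) → Submodule (toModule N) q
  N′ within N = record
    { Member   = λ x → Member N′ (proj₁ x)
    ; resp     = resp N′
    ; 0-closed = 0-closed N′
    ; +-closed = +-closed N′
    ; *-closed = λ a → *-closed N′ a
    }

  infix 4 _↠ᴹ_

  _↠ᴹ_ : ∀ {m ℓm m′ ℓm′} → LeftModule R m ℓm → LeftModule R m′ ℓm′ → Set _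
  M ↠ᴹ M′ = ∃ λ (f : Carrierᴹ M → Carrierᴹ M′) →
      IsLeftModuleHomomorphism f × Surjective (_≈ᴹ_ M) (_≈ᴹ_ M′) f
    where
    open LeftModule
    open LeftModuleMorphisms (rawLeftModule M) (rawLeftModule M′)

  leftIdeal : Carrier → Submodule (TensorUnit.leftModule {R = R}) (r ⊔ ℓr)
  leftIdeal y = record
    { Member   = λ x → ∃ λ a → x ≈ a * y
    ; resp     = λ x≈x′ (a , eq) → a , ≈-trans (≈-sym x≈x′) eq
    ; 0-closed = 0# , ≈-sym (zeroˡ y)
    ; +-closed = λ (a , p) (b , q) → a + b , ≈-trans (+-cong p q) (≈-sym (distribʳ y a b))
    ; *-closed = λ c (a , p) → c * a , ≈-trans (*-congˡ p) (≈-sym (*-assoc c a y))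
    }
    where open Ring R renaming (sym to ≈-sym; trans to ≈-trans)

Cell : Set
Cell = ℕ × ℕ

-- A diagram with exactly n cells; the order in which they are listed is immaterial.  Moving cells
-- keeps the index n, so the fillings of D and of a diagram obtained from D by moves have entries
-- in the same Fin n and their Specht modules are modules over the same ℂ[S n ].
record Diagram (n : ℕ) : Set where
  field
    cells    : Vec Cell n
    unique   : Unique cells
    positive : All (λ (i , j) → 1 ℕ.≤ i × 1 ℕ.≤ j) cells

open Diagram public

infix 4 _∈ᴰ_

_∈ᴰ_ : ∀ {n} → Cell → Diagram n → Set
c ∈ᴰ D = c ∈ cells D

module _ {n} (D : Diagram n) {P : Pred Cell 0ℓ} (P? : Decidable P) (g : Cell → Cell)
         (g-injective : ∀ {c d} → P c → P d → g c ≡ g d → c ≡ d)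
         (g-positive : ∀ {i j} → 1 ℕ.≤ i × 1 ℕ.≤ j → 1 ℕ.≤ proj₁ (g (i , j)) × 1 ℕ.≤ proj₂ (g (i , j)))
         where

  moves? : ∀ c → Dec (P c × g c ∉ cells D)
  moves? c = P? c ×-dec ¬? (g c ∈? cells D)

  moveCell : Cell → Cell
  moveCell c = if does (moves? c) then g c else c

  moveCell-moves : ∀ {c} → P c × g c ∉ cells D → moveCell c ≡ g c
  moveCell-moves {c} moves = cong (if_then g c else c) (dec-true (moves? c) moves)

  moveCell-stays : ∀ {c} → ¬ (P c × g c ∉ cells D) → moveCell c ≡ c
  moveCell-stays {c} stays = cong (if_then g c else c) (dec-false (moves? c) stays)

  private
    moveCell-injective : ∀ {c d} → c ∈ᴰ D → d ∈ᴰ D → moveCell c ≡ moveCell d → c ≡ d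
    moveCell-injective {c} {d} c∈D d∈D eq with moves? c | moves? d
    ... | yes mc | yes md = g-injective (proj₁ mc) (proj₁ md)
      (trans (sym (moveCell-moves mc)) (trans eq (moveCell-moves md)))
    ... | no sc  | no sd  = trans (sym (moveCell-stays sc)) (trans eq (moveCell-stays sd))
    ... | yes mc | no sd  = contradiction (subst (_∈ cells D)
      (sym (trans (sym (moveCell-moves mc)) (trans eq (moveCell-stays sd)))) d∈D) (proj₂ mc)
    ... | no sc  | yes md = contradiction (subst (_∈ cells D)
      (trans (sym (moveCell-stays sc)) (trans eq (moveCell-moves md))) c∈D) (proj₂ md)

    moveCell-positive : ∀ {c} → 1 ℕ.≤ proj₁ c × 1 ℕ.≤ proj₂ c →
                        1 ℕ.≤ proj₁ (moveCell c) × 1 ℕ.≤ proj₂ (moveCell c)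
    moveCell-positive {c} pos with moves? c
    ... | yes mc = subst (λ d → 1 ℕ.≤ proj₁ d × 1 ℕ.≤ proj₂ d) (sym (moveCell-moves mc)) (g-positive pos)
    ... | no  sc = subst (λ d → 1 ℕ.≤ proj₁ d × 1 ℕ.≤ proj₂ d) (sym (moveCell-stays sc)) pos

    map-all : ∀ {A : Set} {m} {xs : Vec A m} {p q} {f : A → A} {S : Pred A p} {T : Pred A q} →
              (∀ {x} → x ∈ xs → S x → T (f x)) → All S xs → All T (map f xs)
    map-all h []         = []
    map-all h (px ∷ pxs) = h (here refl) px ∷ map-all (h ∘ there) pxs

    map-unique : ∀ {A : Set} {m} {xs : Vec A m} {f : A → A} →
                 (∀ {x y} → x ∈ xs → y ∈ xs → f x ≡ f y → x ≡ y) → Unique xs → Unique (map f xs)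
    map-unique inj []         = []
    map-unique inj (x∉ ∷ xs!) =
      map-all (λ y∈xs x≢y fx≡fy → x≢y (inj (here refl) (there y∈xs) fx≡fy)) x∉
      ∷ map-unique (λ p q → inj (there p) (there q)) xs!

  -- moves each cell c of D satisfying P to g c, if that position is not occupied in D
  moveCells : Diagram n
  moveCells = record
    { cells    = map moveCell (cells D)
    ; unique   = map-unique moveCell-injective (unique D)
    ; positive = map-all (λ _ → moveCell-positive) (positive D)
    }

R[_⇒_] C[_⇒_] : ∀ {n} (a b : ℕ) .{{_ : NonZero b}} → Diagram n → Diagram n

R[ a ⇒ b ] D = moveCells D {P = λ (i , j) → i ≡ a} (λ (i , j) → i ℕ.≟ a) (λ (i , j) → b , j)
  (λ { refl refl eq → cong (a ,_) (cong proj₂ eq) })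
  (λ (_ , 1≤j) → ℕ.>-nonZero⁻¹ b , 1≤j)

C[ c ⇒ d ] D = moveCells D {P = λ (i , j) → j ≡ c} (λ (i , j) → j ℕ.≟ c) (λ (i , j) → i , d)
  (λ { refl refl eq → cong (_, c) (cong proj₁ eq) })
  (λ (1≤i , _) → 1≤i , ℕ.>-nonZero⁻¹ d)

-- D ∩ ([p] × [p]) is the Ferrers diagram of δ_p together with the cell (p , p)
Containsδ·1 : ∀ {n} → ℕ → Diagram n → Set
Containsδ·1 p D = ∀ i j → 1 ℕ.≤ i → i ℕ.≤ p → 1 ℕ.≤ j → j ℕ.≤ p →
  (i , j) ∈ᴰ D ⇔ (i ℕ.+ j ℕ.≤ p ⊎ (i , j) ≡ (p , p))

record Filling {n} (D : Diagram n) : Set where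
  constructor filling
  field
    entry : (∃ λ c → c ∈ᴰ D) ↔ Fin n

open Filling public

module _ {n} {D : Diagram n} (T : Filling D) where

  cellOf : Fin n → Cell
  cellOf k = proj₁ (Inverse.from (entry T) k)

  -- σ sends the filling T to σ ∘ T, so it permutes entries within rows when the entries k and σ k
  -- of T always lie in the same row
  RowGroup ColumnGroup : Pred (Permutation′ n) 0ℓ
  RowGroup    σ = ∀ k → proj₁ (cellOf (σ ⟨$⟩ʳ k)) ≡ proj₁ (cellOf k)
  ColumnGroup σ = ∀ k → proj₂ (cellOf (σ ⟨$⟩ʳ k)) ≡ proj₂ (cellOf k)

  rowGroup? : Decidable RowGroup
  rowGroup? σ = Fin.all? λ k → proj₁ (cellOf (σ ⟨$⟩ʳ k)) ℕ.≟ proj₁ (cellOf k)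

  columnGroup? : Decidable ColumnGroup
  columnGroup? σ = Fin.all? λ k → proj₂ (cellOf (σ ⟨$⟩ʳ k)) ℕ.≟ proj₂ (cellOf k)

ℂ[S_] : ℕ → Ring 0ℓ 0ℓ
ℂ[S n ] = GroupAlgebra.ring ℂ n

youngSymmetrizer : ∀ {n} {D : Diagram n} → Filling D → Ring.Carrier ℂ[S n ]
youngSymmetrizer {n} T =
    ∑[ p ∈ rowGroup? T ] ∑[ q ∈ columnGroup? T ] sgn q • [ q · p ]
  where
  open GroupAlgebra ℂ n
  open PermutationSum (Ring.+-commutativeMonoid ring)

Specht : ∀ {n} {D : Diagram n} → Filling D → LeftModule ℂ[S n ] 0ℓ 0ℓ
Specht T = toModule (leftIdeal (youngSymmetrizer T))

{-# OPTIONS --safe #-}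
module Submission where

open import Data.Fin.Base using (Fin; toℕ; fromℕ; inject₁; zero; suc)
open import Data.Nat.Base using (ℕ; suc; _≤_; _∸_)
open import Data.Product.Base using (Σ-syntax; _×_)
open import Level using (0ℓ)
open import Defs

open import Algebra.Bundles using (CommutativeMonoid; CommutativeRing; Ring)
open import Algebra.Module.Bundles using (LeftModule)
open import Algebra.Module.Morphism.Structures using (module LeftModuleMorphisms)
import Algebra.Properties.CommutativeMonoid.Sum as CommutativeMonoidSum
import Algebra.Properties.Group as GroupProperties
import Algebra.Properties.Monoid.Mult as MonoidMult
import Algebra.Properties.Ring as RingProperties
import Algebra.Properties.Semiring.Exp as SemiringExp
import Algebra.Properties.Semiring.Sum as SemiringSum
open import Data.Bool.Base using (true; false; if_then_else_; _∧_)
import Data.Fin.Base as Fin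
open import Data.Fin.Permutation as Perm using (Permutation′; _⟨$⟩ʳ_; _⟨$⟩ˡ_)
import Data.Fin.Properties as Fin
open import Data.Nat.Base as ℕ using (zero; _<_; z≤n; s≤s)
import Data.Nat.Properties as ℕ
open import Data.Product.Base using (∃; ∃₂; _,_; proj₁; proj₂)
open import Data.Rational.Base as ℚ using (ℚ; 0ℚ; 1ℚ; ∣_∣)
import Data.Rational.Properties as ℚ
open import Data.Sum.Base using (_⊎_; inj₁; inj₂)
open import Data.Vec.Base as Vec using (Vec)
open import Data.Vec.Membership.Propositional using (_∈_; _∉_)
open import Data.Vec.Membership.Propositional.Properties using (∈-lookup; index-∈-lookup; ∈-map⁺)
open import Data.Vec.Properties using (lookup-map; map-∘)
open import Data.Vec.Relation.Unary.Any as Any using (here; there)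
open import Data.Vec.Relation.Unary.Any.Properties using (lookup-index)
open import Function.Base using (_∘_)
open import Function.Bundles using (Inverse; _↔_; mk⇔; mk↔ₛ′; module Equivalence)
open import Function.Construct.Composition using (_↔-∘_)
open import Function.Construct.Symmetry using (↔-sym)
open import Level using (_⊔_)
open import Relation.Binary.Definitions using (tri<; tri≈; tri>)
open import Relation.Binary.PropositionalEquality
  using (_≡_; _≢_; _≗_; refl; sym; trans; cong; cong₂; subst; subst₂)
import Relation.Binary.Reasoning.Setoid as SetoidReasoning
open import Relation.Nullary using (¬_; Dec; does; yes; no; _×-dec_; ¬?; contradiction)
open import Relation.Nullary.Decidable using (decidable-stable; dec-true; dec-false; does-⇔)
open import Relation.Unary using (Pred; Decidable)

-- Write C(c) for the signed sum over the column group of c and R(f) for the sum over the row group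
-- of f, so that y_T = C(g) R(f) when T has row labels f and column labels g.  Let c_j be the column
-- labels of D_j = C_{p→j} D and f_j the row labels of E_j = R_{p→p-j+1} D_j.  The product
-- C(c) σ R(f) vanishes as soon as some transposition lies in the column group of c and in the
-- σ-conjugate of the row group of f.  Expanding the middle factor of a triple product, this gives,
-- up to nonzero integers,
--   C(c_j) C(g) R(f) = C(c_j) R(f),    hence  S^{D_j} ⊆ S^D,
--   C(c_j) R(f) R(f_j) = C(c_j) R(f_j),  which generates S^{E_j},
-- while C(c_i) R(f) R(f_j) = 0 for i < j, by counting: rows p and p-j+1 have more columns in common
-- in D_i than in D_j, so every row permutation moves an entry that changes rows in E_j into one of
-- the common columns of D_i.  So M_j = S^{D_1} + ... + S^{D_j}, and right multiplication by R(f_j)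
-- induces the surjection.

-- Row and column moves of labelled cells

-- The integers are group orders. When a middle factor is expanded, a `σ` lying in both groups
-- concerned is absorbed, any sign occurring twice, and every other `σ` gives zero; so the integer
-- is the order of an intersection of two row groups or of two column groups, which is invertible in
-- ℂ. The transpositions that kill terms come from the move itself. Suppose a row permutation
-- carries an entry `x` that changes rows to a place where an occupied cell of the target row blocks
-- the move. The preimage of the entry in that blocking cell already lies in the target row, so
-- after the move `x` shares its row, while their images share a column. Row p-j+1 of the staircase
-- has length j-1: it meets every column i < j and misses column j. This is what separates D_i from
-- D_j. All labellings live on the entries of T, whereas the filling of E_j is arbitrary, so R(f_j)
-- has to be followed by a permutation matching the two sets of entries. Right multiplication
-- descends to the quotient because the earlier generators go to zero, and it is onto because the
-- j-th generator goes to a unit times the generator of S^{E_j}.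

module ℕSum = CommutativeMonoidSum ℕ.+-0-commutativeMonoid

sum-mono-≤ : ∀ {n} {s t : Fin n → ℕ} → (∀ i → s i ≤ t i) → ℕSum.sum s ≤ ℕSum.sum t
sum-mono-≤ {zero}  s≤t = z≤n
sum-mono-≤ {suc n} s≤t = ℕ.+-mono-≤ (s≤t zero) (sum-mono-≤ (s≤t ∘ suc))

sum-mono-< : ∀ {n} {s t : Fin n → ℕ} → (∀ i → s i ≤ t i) → ∀ k → s k < t k →
             ℕSum.sum s < ℕSum.sum t
sum-mono-< s≤t zero    s<t = ℕ.+-mono-<-≤ s<t (sum-mono-≤ (s≤t ∘ suc))
sum-mono-< s≤t (suc k) s<t = ℕ.+-mono-≤-< (s≤t zero) (sum-mono-< (s≤t ∘ suc) k s<t)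

𝟙 : ∀ {P : Set} → Dec P → ℕ
𝟙 P? = if does P? then 1 else 0

𝟙-mono-≤ : ∀ {P Q : Set} (P? : Dec P) (Q? : Dec Q) → (P → Q) → 𝟙 P? ≤ 𝟙 Q?
𝟙-mono-≤ (yes p) (yes q) P⇒Q = ℕ.≤-refl
𝟙-mono-≤ (yes p) (no ¬q) P⇒Q = contradiction (P⇒Q p) ¬q
𝟙-mono-≤ (no ¬p) Q?      P⇒Q = z≤n

𝟙-mono-< : ∀ {P Q : Set} (P? : Dec P) (Q? : Dec Q) → ¬ P → Q → 𝟙 P? < 𝟙 Q?
𝟙-mono-< (yes p) Q?      ¬p q = contradiction p ¬p
𝟙-mono-< (no _)  (yes _) ¬p q = ℕ.≤-refl
𝟙-mono-< (no _)  (no ¬q) ¬p q = contradiction q ¬q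

module _ {n} {A B : Pred (Fin n) 0ℓ} (A? : Decidable A) (B? : Decidable B) where

  -- The preimage of `A` under `σ` has as many elements as `A`, hence more than its proper subset
  -- `B`, and so cannot lie inside `B`.
  pigeonhole : ∀ (σ : Permutation′ n) → (∀ {k} → B k → A k) → ∀ {k₀} → A k₀ → ¬ B k₀ →
               ∃ λ x → A (σ ⟨$⟩ʳ x) × ¬ B x
  pigeonhole σ B⊆A {k₀} k₀∈A k₀∉B
    with Fin.any? (λ x → A? (σ ⟨$⟩ʳ x) ×-dec ¬? (B? x))
  ... | yes found = found
  ... | no  none  = contradiction #A<#A (ℕ.<-irrefl refl)
    where
    A∘σ⊆B : ∀ x → A (σ ⟨$⟩ʳ x) → B x
    A∘σ⊆B x σx∈A = decidable-stable (B? x) λ x∉B → none (x , σx∈A , x∉B)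

    #A<#A : ℕSum.sum (𝟙 ∘ A?) < ℕSum.sum (𝟙 ∘ A?)
    #A<#A = ℕ.≤-<-trans
      (ℕ.≤-trans (ℕ.≤-reflexive (ℕSum.sum-permute (𝟙 ∘ A?) σ))
                 (sum-mono-≤ λ x → 𝟙-mono-≤ (A? (σ ⟨$⟩ʳ x)) (B? x) (A∘σ⊆B x)))
      (sum-mono-< (λ x → 𝟙-mono-≤ (B? x) (A? x) B⊆A) k₀ (𝟙-mono-< (B? k₀) (A? k₀) k₀∉B k₀∈A))

-- With a coordinate of `cellOf T` for `f` this is `RowGroup T` or `ColumnGroup T` by definition. A
-- bare labelling also serves the intermediate diagrams, which come without a filling.
Fixes : ∀ {n} → (Fin n → ℕ) → Pred (Permutation′ n) 0ℓ
Fixes f σ = ∀ k → f (σ ⟨$⟩ʳ k) ≡ f k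

fixes? : ∀ {n} (f : Fin n → ℕ) → Decidable (Fixes f)
fixes? f σ = Fin.all? λ k → f (σ ⟨$⟩ʳ k) ℕ.≟ f k

module _ {n} {f : Fin n → ℕ} where

  Fixes-⁻¹ : ∀ σ → Fixes f σ → Fixes f (σ ⁻¹)
  Fixes-⁻¹ σ fσ k = trans (sym (fσ (σ ⟨$⟩ˡ k))) (cong f (Perm.inverseʳ σ))

  Fixes-· : ∀ σ τ → Fixes f σ → Fixes f τ → Fixes f (σ · τ)
  Fixes-· σ τ fσ fτ k = trans (fσ (τ ⟨$⟩ʳ k)) (fτ k)

  Fixes-resp : ∀ {σ τ} → σ ≈ₚ τ → Fixes f σ → Fixes f τ
  Fixes-resp σ≈τ fσ k = trans (cong f (sym (σ≈τ k))) (fσ k)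

-- For a filling whose entry x lies in row f x and column g x, Blocked f g a b x says that R_{a→b}
-- leaves the entry x of row a in place.  Exchanging f and g gives C_{a→b}.
Blocked : ∀ {n} (f g : Fin n → ℕ) (a b : ℕ) → Pred (Fin n) 0ℓ
Blocked f g a b x = f x ≡ a × ∃ λ y → f y ≡ b × g y ≡ g x

blocked? : ∀ {n} (f g : Fin n → ℕ) a b → Decidable (Blocked f g a b)
blocked? f g a b x = (f x ℕ.≟ a) ×-dec Fin.any? λ y → (f y ℕ.≟ b) ×-dec (g y ℕ.≟ g x)

record IsMove {n} (f f′ g : Fin n → ℕ) (a b : ℕ) : Set where
  field
    moved   : ∀ {x} → f x ≡ a → ¬ Blocked f g a b x → f′ x ≡ b
    blocked : ∀ {x} → Blocked f g a b x → f′ x ≡ a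
    other   : ∀ {x} → f x ≢ a → f′ x ≡ f x

-- Covers the end cases: the column move for `j = p` and the row move for `j = 1`.
move-id : ∀ {n} {f f′ g : Fin n → ℕ} {a} → IsMove f f′ g a a → f′ ≗ f
move-id {f = f} {f′} {g} {a} move x with f x ℕ.≟ a
... | no  fx≢a = IsMove.other move fx≢a
... | yes fx≡a with blocked? f g a a x
...   | yes bl = trans (IsMove.blocked move bl) (sym fx≡a)
...   | no ¬bl = trans (IsMove.moved move fx≡a ¬bl) (sym fx≡a)

module _ {n} {f f′ g : Fin n → ℕ} {a b} (move : IsMove f f′ g a b)
         (σ : Permutation′ n) (fσ : Fixes f σ) where
  open IsMove move

  -- The transposition of σ x and σ y makes C(h) σ R(f′) vanish.
  Collision : (Fin n → ℕ) → Set
  Collision h = ∃₂ λ x y → x ≢ y × f′ x ≡ f′ y × h (σ ⟨$⟩ʳ x) ≡ h (σ ⟨$⟩ʳ y)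

  -- The entry `x` moves into row `b`, while `σ x` shares its `h`-column with an entry `y₀` of row
  -- `b`. Since `σ` preserves the rows of `f`, the preimage of `y₀` lies in row `b` and stays there;
  -- it is the partner of `x`.
  collision : a ≢ b → ∀ h {x} → Blocked f h a b (σ ⟨$⟩ʳ x) → ¬ Blocked f g a b x → Collision h
  collision a≢b h {x} (fσx≡a , y₀ , fy₀≡b , hy₀≡hσx) ¬blocked =
      x , y
    , (λ x≡y → a≢b (trans (sym fx≡a) (trans (cong f x≡y) fy≡b)))
    , trans (moved fx≡a ¬blocked) (sym (trans (other λ fy≡a → a≢b (trans (sym fy≡a) fy≡b)) fy≡b))
    , trans (sym hy₀≡hσx) (cong h (sym (Perm.inverseʳ σ)))
    where
    y : Fin n
    y = σ ⟨$⟩ˡ y₀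
    fx≡a : f x ≡ a
    fx≡a = trans (sym (fσ x)) fσx≡a
    fy≡b : f y ≡ b
    fy≡b = trans (Fixes-⁻¹ σ fσ y₀) fy₀≡b

  -- A row permutation of `f` can violate `f′` only by mixing the blocked and the unblocked entries
  -- of row `a`. By counting, some unblocked entry is then sent to a blocked one.
  fixes-or-collides : Fixes f′ σ ⊎ Collision g
  fixes-or-collides with fixes? f′ σ
  ... | yes f′σ = inj₁ f′σ
  ... | no ¬f′σ with a ℕ.≟ b
  ...   | yes refl = contradiction
    (λ k → trans (move-id move (σ ⟨$⟩ʳ k)) (trans (fσ k) (sym (move-id move k)))) ¬f′σ
  ...   | no a≢b = inj₂ (let k , f′σk≢ = Fin.¬∀⟶∃¬ n _ (λ k → f′ (σ ⟨$⟩ʳ k) ℕ.≟ f′ k) ¬f′σ in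
                         at k f′σk≢ (f k ℕ.≟ a) (bl? k) (bl? (σ ⟨$⟩ʳ k)))
    where
    bl? : Decidable (Blocked f g a b)
    bl? = blocked? f g a b

    at : ∀ k → f′ (σ ⟨$⟩ʳ k) ≢ f′ k → Dec (f k ≡ a) →
         Dec (Blocked f g a b k) → Dec (Blocked f g a b (σ ⟨$⟩ʳ k)) → Collision g
    at k f′σk≢ (no fk≢a) _ _ = contradiction
      (trans (other λ fσk≡a → fk≢a (trans (sym (fσ k)) fσk≡a)) (trans (fσ k) (sym (other fk≢a)))) f′σk≢
    at k f′σk≢ (yes fk≡a) (yes bl) (yes blσ) = contradiction (trans (blocked blσ) (sym (blocked bl))) f′σk≢
    at k f′σk≢ (yes fk≡a) (no ¬bl) (no ¬blσ) =
      contradiction (trans (moved (trans (fσ k) fk≡a) ¬blσ) (sym (moved fk≡a ¬bl))) f′σk≢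
    at k f′σk≢ (yes fk≡a) (no ¬bl) (yes blσ) = collision a≢b g blσ ¬bl
    at k f′σk≢ (yes fk≡a) (yes bl) (no ¬blσ) =
      -- Here `k` itself goes the wrong way, from blocked to unblocked. Comparing the blocked
      -- entries with those other than `k` gives an `x` with `σ x` blocked that is unblocked or
      -- equal to `k`; the latter is excluded because `σ k` is unblocked.
      let x , blσx , ¬x = pigeonhole bl? (λ x → bl? x ×-dec ¬? (x Fin.≟ k)) σ
                            proj₁ bl (λ (_ , k≢k) → k≢k refl)
      in collision a≢b g blσx λ blx →
           ¬x (blx , λ x≡k → ¬blσ (subst (λ z → Blocked f g a b (σ ⟨$⟩ʳ z)) x≡k blσx))

-- The sign of a permutation

module PairSum {c ℓ} (M : CommutativeMonoid c ℓ) where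
  open CommutativeMonoid M renaming (refl to ≈-refl; sym to ≈-sym; trans to ≈-trans)
  open CommutativeMonoidSum M
  open SetoidReasoning setoid

  when : ∀ {P : Set} → Dec P → Carrier → Carrier
  when P? x = if does P? then x else ε

  when-cong : ∀ {P : Set} (P? : Dec P) {x y} → (P → x ≈ y) → when P? x ≈ when P? y
  when-cong (yes p) x≈y = x≈y p
  when-cong (no _)  x≈y = ≈-refl

  when-∙ : ∀ {P : Set} (P? : Dec P) x y → when P? (x ∙ y) ≈ when P? x ∙ when P? y
  when-∙ (yes _) x y = ≈-refl
  when-∙ (no _)  x y = ≈-sym (identityˡ ε)

  ∑∑ : ∀ {n} → (Fin n → Fin n → Carrier) → Carrier
  ∑∑ {n} F = ∑[ i < n ] ∑[ j < n ] F i j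

  ∑∑-cong : ∀ {n} {F G : Fin n → Fin n → Carrier} → (∀ i j → F i j ≈ G i j) → ∑∑ F ≈ ∑∑ G
  ∑∑-cong F≈G = sum-cong-≋ λ i → sum-cong-≋ (F≈G i)

  ∑∑-∙ : ∀ {n} (F G : Fin n → Fin n → Carrier) → ∑∑ (λ i j → F i j ∙ G i j) ≈ ∑∑ F ∙ ∑∑ G
  ∑∑-∙ {n} F G = ≈-trans (sum-cong-≋ λ i → ∑-distrib-+ (F i) (G i))
                     (∑-distrib-+ (λ i → ∑[ j < n ] F i j) (λ i → ∑[ j < n ] G i j))

  ∑< : ∀ {n} → (Fin n → Fin n → Carrier) → Carrier
  ∑< F = ∑∑ λ i j → when (i Fin.<? j) (F i j)

  ∑<-cong : ∀ {n} {F G : Fin n → Fin n → Carrier} →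
            (∀ i j → i Fin.< j → F i j ≈ G i j) → ∑< F ≈ ∑< G
  ∑<-cong F≈G = ∑∑-cong λ i j → when-cong (i Fin.<? j) (F≈G i j)

  ∑<-∙ : ∀ {n} (F G : Fin n → Fin n → Carrier) → ∑< (λ i j → F i j ∙ G i j) ≈ ∑< F ∙ ∑< G
  ∑<-∙ F G = ≈-trans (∑∑-cong λ i j → when-∙ (i Fin.<? j) (F i j) (G i j))
    (∑∑-∙ (λ i j → when (i Fin.<? j) (F i j)) (λ i j → when (i Fin.<? j) (G i j)))

  ∑∑-fold : ∀ {n} (G : Fin n → Fin n → Carrier) → (∀ i → G i i ≈ ε) →
            ∑∑ G ≈ ∑< (λ i j → G i j ∙ G j i)
  ∑∑-fold {n} G Gᵢᵢ≈ε = begin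
    ∑∑ G                                                    ≈⟨ ∑∑-cong split ⟩
    ∑∑ (λ i j → when (i Fin.<? j) (G i j) ∙ when (j Fin.<? i) (G i j))
                                                            ≈⟨ ∑∑-∙ (λ i j → when (i Fin.<? j) (G i j)) (λ i j → when (j Fin.<? i) (G i j)) ⟩
    ∑< G ∙ ∑∑ (λ i j → when (j Fin.<? i) (G i j))           ≈⟨ ∙-congˡ (∑-comm (λ i j → when (j Fin.<? i) (G i j))) ⟩
    ∑< G ∙ ∑< (λ i j → G j i)                               ≈⟨ ∑<-∙ G (λ i j → G j i) ⟨
    ∑< (λ i j → G i j ∙ G j i)                              ∎
    where
    split : ∀ i j → G i j ≈ when (i Fin.<? j) (G i j) ∙ when (j Fin.<? i) (G i j)
    split i j with Fin.<-cmp i j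
    ... | tri< i<j _ j≮i rewrite dec-true (i Fin.<? j) i<j | dec-false (j Fin.<? i) j≮i =
      ≈-sym (identityʳ _)
    ... | tri> i≮j _ j<i rewrite dec-false (i Fin.<? j) i≮j | dec-true (j Fin.<? i) j<i =
      ≈-sym (identityˡ _)
    ... | tri≈ i≮i refl _ rewrite dec-false (i Fin.<? i) i≮i =
      ≈-trans (Gᵢᵢ≈ε i) (≈-sym (identityˡ ε))

  -- A symmetric `F` is a function of unordered pairs, and `τ` permutes those. In `G` the condition
  -- `i < j` is carried along by `τ`, so both indices can be substituted freely; of the two orders
  -- of a pair `G` still keeps exactly one.
  ∑<-permute : ∀ {n} (F : Fin n → Fin n → Carrier) → (∀ i j → F i j ≈ F j i) →
               ∀ (τ : Permutation′ n) → ∑< (λ i j → F (τ ⟨$⟩ʳ i) (τ ⟨$⟩ʳ j)) ≈ ∑< F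
  ∑<-permute {n} F F-sym τ = begin
    ∑< (λ i j → F (τ ⟨$⟩ʳ i) (τ ⟨$⟩ʳ j))  ≈⟨ ∑∑-cong (λ i j → reflexive (cong₂ (λ i′ j′ → when (i′ Fin.<? j′) (F (τ ⟨$⟩ʳ i) (τ ⟨$⟩ʳ j))) (sym (Perm.inverseˡ τ)) (sym (Perm.inverseˡ τ)))) ⟩
    ∑∑ (λ i j → G (τ ⟨$⟩ʳ i) (τ ⟨$⟩ʳ j))  ≈⟨ sum-cong-≋ (λ i → sum-permute (G (τ ⟨$⟩ʳ i)) τ) ⟨
    ∑[ i < n ] ∑[ l < n ] G (τ ⟨$⟩ʳ i) l  ≈⟨ sum-permute (λ k → ∑[ l < n ] G k l) τ ⟨
    ∑∑ G                                  ≈⟨ ∑∑-fold G (λ k → reflexive (cong (if_then F k k else ε) (dec-false ((τ ⟨$⟩ˡ k) Fin.<? (τ ⟨$⟩ˡ k)) (Fin.<-irrefl refl)))) ⟩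
    ∑< (λ k l → G k l ∙ G l k)            ≈⟨ ∑<-cong (λ k l k<l → merge k l k<l) ⟩
    ∑< F                                  ∎
    where
    G : Fin n → Fin n → Carrier
    G k l = when ((τ ⟨$⟩ˡ k) Fin.<? (τ ⟨$⟩ˡ l)) (F k l)

    merge : ∀ k l → k Fin.< l → G k l ∙ G l k ≈ F k l
    merge k l k<l with Fin.<-cmp (τ ⟨$⟩ˡ k) (τ ⟨$⟩ˡ l)
    ... | tri< < _ ≯ rewrite dec-true ((τ ⟨$⟩ˡ k) Fin.<? (τ ⟨$⟩ˡ l)) < | dec-false ((τ ⟨$⟩ˡ l) Fin.<? (τ ⟨$⟩ˡ k)) ≯ =
      identityʳ _
    ... | tri> ≮ _ > rewrite dec-false ((τ ⟨$⟩ˡ k) Fin.<? (τ ⟨$⟩ˡ l)) ≮ | dec-true ((τ ⟨$⟩ˡ l) Fin.<? (τ ⟨$⟩ˡ k)) > =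
      ≈-trans (identityˡ _) (F-sym l k)
    ... | tri≈ _ eq _ = contradiction
      (trans (sym (Perm.inverseʳ τ)) (trans (cong (τ ⟨$⟩ʳ_) eq) (Perm.inverseʳ τ))) (Fin.<⇒≢ k<l)

module Sign {c ℓ} (K : CommutativeRing c ℓ) where
  open CommutativeRing K hiding (zero)
    renaming (refl to ≈-refl; sym to ≈-sym; trans to ≈-trans; reflexive to ≈-reflexive)
  open RingProperties ring using (-1*x≈-x; -‿involutive)
  open SemiringExp semiring using (_^_; ^-homo-*)
  open PairSum *-commutativeMonoid renaming (∑∑ to ∏∏; ∑< to ∏<; ∑∑-cong to ∏∏-cong)
  module Prod = CommutativeMonoidSum *-commutativeMonoid
  open SetoidReasoning setoid

  -- GroupAlgebra.sgn, without its unused index n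
  sgn : ∀ {n} → Permutation′ n → Carrier
  sgn σ = (- 1#) ^ inversions σ

  -1*-1≈1 : - 1# * - 1# ≈ 1#
  -1*-1≈1 = ≈-trans (-1*x≈-x (- 1#)) (-‿involutive 1#)

  ^-sum : ∀ {n} x (s : Fin n → ℕ) → x ^ ℕSum.sum s ≈ Prod.sum (λ i → x ^ s i)
  ^-sum {zero}  x s = ≈-refl
  ^-sum {suc n} x s = ≈-trans (^-homo-* x (s zero) _) (*-congˡ (^-sum x (s ∘ suc)))

  signIf : ∀ {P : Set} → Dec P → Carrier
  signIf P? = when P? (- 1#)

  inverted : ∀ {n} (σ : Permutation′ n) → Fin n → Fin n → Carrier
  inverted σ i j = signIf ((σ ⟨$⟩ʳ j) Fin.<? (σ ⟨$⟩ʳ i))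

  -- Turns the exponent, a count of inversions, into a product over pairs, so that multiplicativity
  -- can be checked factor by factor.
  sgn-∏ : ∀ {n} (σ : Permutation′ n) → sgn σ ≈ ∏< (inverted σ)
  sgn-∏ {n} σ = ≈-trans (^-sum (- 1#) λ i → ℕSum.sum (table i)) (Prod.sum-cong-≋ λ i →
    ≈-trans (^-sum (- 1#) (table i)) (Prod.sum-cong-≋ λ j →
      power (does (i Fin.<? j)) (does ((σ ⟨$⟩ʳ j) Fin.<? (σ ⟨$⟩ʳ i)))))
    where
    table : Fin n → Fin n → ℕ
    table i j = 𝟙 ((i Fin.<? j) ×-dec ((σ ⟨$⟩ʳ j) Fin.<? (σ ⟨$⟩ʳ i)))

    power : ∀ a b → (- 1#) ^ (if a ∧ b then 1 else 0) ≈ (if a then (if b then - 1# else 1#) else 1#)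
    power true  true  = *-identityʳ (- 1#)
    power true  false = ≈-refl
    power false b     = ≈-refl

  sgn-cong : ∀ {n} (σ τ : Permutation′ n) → σ ≈ₚ τ → sgn σ ≈ sgn τ
  sgn-cong σ τ σ≈τ = ≈-trans (sgn-∏ σ) (≈-trans
    (∏∏-cong λ i j → when-cong (i Fin.<? j) λ _ →
      ≈-reflexive (cong₂ (λ a b → signIf (a Fin.<? b)) (σ≈τ j) (σ≈τ i)))
    (≈-sym (sgn-∏ τ)))

  -- Extends `inverted σ` from `k < l` to a function of the unordered pair, as `∑<-permute`
  -- requires.
  invertedPair : ∀ {n} (σ : Permutation′ n) → Fin n → Fin n → Carrier
  invertedPair σ k l = if does (k Fin.<? l) then inverted σ k l else inverted σ l k

  invertedPair-< : ∀ {n} (σ : Permutation′ n) {k l} → k Fin.< l → invertedPair σ k l ≡ inverted σ k l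
  invertedPair-< σ {k} {l} k<l rewrite dec-true (k Fin.<? l) k<l = refl

  invertedPair-> : ∀ {n} (σ : Permutation′ n) {k l} → l Fin.< k → invertedPair σ k l ≡ inverted σ l k
  invertedPair-> σ {k} {l} l<k rewrite dec-false (k Fin.<? l) (Fin.<-asym l<k) = refl

  invertedPair-sym : ∀ {n} (σ : Permutation′ n) k l → invertedPair σ k l ≈ invertedPair σ l k
  invertedPair-sym σ k l with Fin.<-cmp k l
  ... | tri< k<l _ _ = ≈-reflexive (trans (invertedPair-< σ k<l) (sym (invertedPair-> σ k<l)))
  ... | tri≈ _ refl _ = ≈-refl
  ... | tri> _ _ l<k = ≈-reflexive (trans (invertedPair-> σ l<k) (sym (invertedPair-< σ l<k)))

  signIf-yes : ∀ {P : Set} (P? : Dec P) → P → signIf P? ≡ - 1#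
  signIf-yes P? p rewrite dec-true P? p = refl

  signIf-no : ∀ {P : Set} (P? : Dec P) → ¬ P → signIf P? ≡ 1#
  signIf-no P? ¬p rewrite dec-false P? ¬p = refl

  ⟨$⟩ʳ-injective : ∀ {n} (σ : Permutation′ n) {i j} → σ ⟨$⟩ʳ i ≡ σ ⟨$⟩ʳ j → i ≡ j
  ⟨$⟩ʳ-injective σ eq = trans (sym (Perm.inverseˡ σ)) (trans (cong (σ ⟨$⟩ˡ_) eq) (Perm.inverseˡ σ))

  -- The product inverts a pair exactly when one, but not both, of these happen: `τ` inverts the
  -- pair, `σ` inverts its image under `τ`.
  inverted-· : ∀ {n} (σ τ : Permutation′ n) i j → i Fin.< j →
    inverted (σ · τ) i j ≈ invertedPair σ (τ ⟨$⟩ʳ i) (τ ⟨$⟩ʳ j) * inverted τ i j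
  inverted-· σ τ i j i<j with Fin.<-cmp (τ ⟨$⟩ʳ i) (τ ⟨$⟩ʳ j)
  ... | tri< τi<τj _ τj≮τi = ≈-sym (≈-trans
    (*-cong (≈-reflexive (invertedPair-< σ τi<τj)) (≈-reflexive (signIf-no (_ Fin.<? _) τj≮τi)))
    (*-identityʳ _))
  ... | tri≈ _ τi≡τj _ = contradiction (⟨$⟩ʳ-injective τ τi≡τj) (Fin.<⇒≢ i<j)
  ... | tri> _ _ τj<τi = ≈-trans opposite (≈-sym
    (*-cong (≈-reflexive (invertedPair-> σ τj<τi)) (≈-reflexive (signIf-yes (_ Fin.<? _) τj<τi))))
    where
    opposite : inverted σ (τ ⟨$⟩ʳ i) (τ ⟨$⟩ʳ j) ≈ inverted σ (τ ⟨$⟩ʳ j) (τ ⟨$⟩ʳ i) * - 1#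
    opposite with Fin.<-cmp (σ ⟨$⟩ʳ (τ ⟨$⟩ʳ i)) (σ ⟨$⟩ʳ (τ ⟨$⟩ʳ j))
    ... | tri< < _ ≯ = ≈-trans (≈-reflexive (signIf-no (_ Fin.<? _) ≯)) (≈-sym
      (≈-trans (*-congʳ (≈-reflexive (signIf-yes (_ Fin.<? _) <))) -1*-1≈1))
    ... | tri> ≮ _ > = ≈-trans (≈-reflexive (signIf-yes (_ Fin.<? _) >)) (≈-sym
      (≈-trans (*-congʳ (≈-reflexive (signIf-no (_ Fin.<? _) ≮))) (*-identityˡ (- 1#))))
    ... | tri≈ _ eq _ =
      contradiction (⟨$⟩ʳ-injective τ (⟨$⟩ʳ-injective σ eq)) (Fin.<⇒≢ i<j)

  sgn-· : ∀ {n} (σ τ : Permutation′ n) → sgn (σ · τ) ≈ sgn σ * sgn τ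
  sgn-· σ τ = begin
    sgn (σ · τ)                      ≈⟨ sgn-∏ (σ · τ) ⟩
    ∏< (inverted (σ · τ))            ≈⟨ ∑<-cong (inverted-· σ τ) ⟩
    ∏< (λ i j → invertedPair σ (τ ⟨$⟩ʳ i) (τ ⟨$⟩ʳ j) * inverted τ i j)
                                     ≈⟨ ∑<-∙ (λ i j → invertedPair σ (τ ⟨$⟩ʳ i) (τ ⟨$⟩ʳ j)) (inverted τ) ⟩
    ∏< (λ i j → invertedPair σ (τ ⟨$⟩ʳ i) (τ ⟨$⟩ʳ j)) * ∏< (inverted τ)
                                     ≈⟨ *-cong (∑<-permute (invertedPair σ) (invertedPair-sym σ) τ) (≈-sym (sgn-∏ τ)) ⟩
    ∏< (invertedPair σ) * sgn τ      ≈⟨ *-congʳ (∑<-cong λ i j i<j → ≈-reflexive (invertedPair-< σ i<j)) ⟩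
    ∏< (inverted σ) * sgn τ          ≈⟨ *-congʳ (sgn-∏ σ) ⟨
    sgn σ * sgn τ                    ∎

  sgn² : ∀ {n} (σ : Permutation′ n) → sgn σ * sgn σ ≈ 1#
  sgn² σ = square (inversions σ)
    where
    square : ∀ m → (- 1#) ^ m * (- 1#) ^ m ≈ 1#
    square zero    = *-identityˡ 1#
    square (suc m) = begin
      (- 1# * x) * (- 1# * x)    ≈⟨ *-assoc (- 1#) x (- 1# * x) ⟩
      - 1# * (x * (- 1# * x))    ≈⟨ *-congˡ (*-assoc x (- 1#) x) ⟨
      - 1# * ((x * - 1#) * x)    ≈⟨ *-congˡ (*-congʳ (*-comm x (- 1#))) ⟩
      - 1# * ((- 1# * x) * x)    ≈⟨ *-congˡ (*-assoc (- 1#) x x) ⟩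
      - 1# * (- 1# * (x * x))    ≈⟨ *-assoc (- 1#) (- 1#) (x * x) ⟨
      (- 1# * - 1#) * (x * x)    ≈⟨ *-cong -1*-1≈1 (square m) ⟩
      1# * 1#                    ≈⟨ *-identityˡ 1# ⟩
      1#                         ∎
      where
      x : Carrier
      x = (- 1#) ^ m

  sgn-id : ∀ {n} → sgn (Perm.id {n}) ≈ 1#
  sgn-id {n} = begin
    sgn id                        ≈⟨ *-identityʳ (sgn id) ⟨
    sgn id * 1#                   ≈⟨ *-congˡ (sgn² id) ⟨
    sgn id * (sgn id * sgn id)    ≈⟨ *-assoc (sgn id) (sgn id) (sgn id) ⟨
    (sgn id * sgn id) * sgn id    ≈⟨ *-congʳ (sgn² id) ⟩
    1# * sgn id                   ≈⟨ *-identityˡ (sgn id) ⟩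
    sgn id                        ≈⟨ sgn-cong id (id · id) (λ _ → refl) ⟩
    sgn (id · id)                 ≈⟨ sgn-· id id ⟩
    sgn id * sgn id               ≈⟨ sgn² id ⟩
    1#                            ∎
    where
    id : Permutation′ n
    id = Perm.id

  sgn-⁻¹ : ∀ {n} (σ : Permutation′ n) → sgn (σ ⁻¹) ≈ sgn σ
  sgn-⁻¹ {n} σ = begin
    sgn (σ ⁻¹)                     ≈⟨ *-identityˡ (sgn (σ ⁻¹)) ⟨
    1# * sgn (σ ⁻¹)                ≈⟨ *-congʳ (sgn² σ) ⟨
    (sgn σ * sgn σ) * sgn (σ ⁻¹)   ≈⟨ *-assoc (sgn σ) (sgn σ) (sgn (σ ⁻¹)) ⟩
    sgn σ * (sgn σ * sgn (σ ⁻¹))   ≈⟨ *-congˡ (sgn-· σ (σ ⁻¹)) ⟨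
    sgn σ * sgn (σ · σ ⁻¹)         ≈⟨ *-congˡ (sgn-cong (σ · σ ⁻¹) Perm.id (λ _ → Perm.inverseʳ σ)) ⟩
    sgn σ * sgn (Perm.id {n})      ≈⟨ *-congˡ (sgn-id {n}) ⟩
    sgn σ * 1#                     ≈⟨ *-identityʳ (sgn σ) ⟩
    sgn σ                          ∎

  private
    inversions-swap : ∀ m → inversions (Perm.swap (Perm.id {m})) ≡ 1
    inversions-swap m = cong₂ (λ a b → suc a ℕ.+ b) (zeros m) (trans
      (cong₂ ℕ._+_ (zeros m) refl)
      (trans (ℕSum.sum-cong-≗ λ i → trans (ℕSum.sum-cong-≗ (none i)) (zeros m)) (zeros m)))
      where
      zeros : ∀ m → ℕSum.sum {m} (λ _ → 0) ≡ 0
      zeros = ℕSum.sum-replicate-zero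
      none : ∀ (i j : Fin m) → (if does ((suc (suc i) Fin.<? suc (suc j)) ×-dec (suc (suc j) Fin.<? suc (suc i))) then 1 else 0) ≡ 0
      none i j = cong (if_then 1 else 0)
        (dec-false ((suc (suc i) Fin.<? suc (suc j)) ×-dec (suc (suc j) Fin.<? suc (suc i))) λ (i<j , j<i) → Fin.<-asym i<j j<i)

  -- Any two transpositions are conjugate, so it is enough to count the inversions of one of them.
  transposition : ∀ {n} (u v : Fin n) → u ≢ v → ∃ λ (t : Permutation′ n) →
                  sgn t ≈ - 1# × (∀ (f : Fin n → ℕ) → f u ≡ f v → Fixes f t)
  transposition {suc zero} zero zero u≢v = contradiction refl u≢v
  transposition {suc (suc m)} u v u≢v = π · s · π ⁻¹ , sgn-t , fixes
    where
    s π : Permutation′ (suc (suc m))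
    s = Perm.swap Perm.id
    -- `π` sends 0 to `u` and 1 to `v`, so conjugating the swap of 0 and 1 by it exchanges `u` and
    -- `v`.
    π = Perm.insert zero u (Perm.insert zero (Fin.punchOut u≢v) Perm.id)

    sgn-t : sgn (π · s · π ⁻¹) ≈ - 1#
    sgn-t = begin
      sgn (π · s · π ⁻¹)             ≈⟨ sgn-· (π · s) (π ⁻¹) ⟩
      sgn (π · s) * sgn (π ⁻¹)       ≈⟨ *-cong (sgn-· π s) (sgn-⁻¹ π) ⟩
      sgn π * sgn s * sgn π          ≈⟨ *-congʳ (*-comm (sgn π) (sgn s)) ⟩
      sgn s * sgn π * sgn π          ≈⟨ *-assoc (sgn s) (sgn π) (sgn π) ⟩
      sgn s * (sgn π * sgn π)        ≈⟨ *-cong (≈-reflexive (cong ((- 1#) ^_) (inversions-swap m))) (sgn² π) ⟩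
      (- 1#) ^ 1 * 1#                ≈⟨ *-identityʳ _ ⟩
      (- 1#) ^ 1                     ≈⟨ *-identityʳ (- 1#) ⟩
      - 1#                           ∎

    π1≡v : π ⟨$⟩ʳ suc zero ≡ v
    π1≡v = Fin.punchIn-punchOut u≢v

    fixes : ∀ f → f u ≡ f v → Fixes f (π · s · π ⁻¹)
    fixes f fu≡fv k = trans (fixesπ (π ⟨$⟩ˡ k)) (cong f (Perm.inverseʳ π))
      where
      fixesπ : ∀ i → f (π ⟨$⟩ʳ (s ⟨$⟩ʳ i)) ≡ f (π ⟨$⟩ʳ i)
      fixesπ zero          = trans (cong f π1≡v) (sym fu≡fv)
      fixesπ (suc zero)    = trans fu≡fv (cong f (sym π1≡v))
      fixesπ (suc (suc i)) = refl

-- Row and column symmetrizers in K[Sₙ]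

module ∑ₚ-Homomorphism {c ℓ c′ ℓ′} (M : CommutativeMonoid c ℓ) (N : CommutativeMonoid c′ ℓ′) where
  private
    module M = CommutativeMonoid M
    module N = CommutativeMonoid N
    module M∑ = CommutativeMonoidSum M
    module N∑ = CommutativeMonoidSum N

  ∑ₚ-homo : ∀ (h : M.Carrier → N.Carrier) → h M.ε N.≈ N.ε →
            (∀ x y → h (x M.∙ y) N.≈ h x N.∙ h y) →
            ∀ {n} (F : Permutation′ n → M.Carrier) →
            h (PermutationSum.∑ₚ M F) N.≈ PermutationSum.∑ₚ N (h ∘ F)
  ∑ₚ-homo h h-ε h-∙ {zero}  F = N.refl
  ∑ₚ-homo h h-ε h-∙ {suc n} F =
    N.trans (sum-homo λ i → PermutationSum.∑ₚ M (F ∘ Perm.insert zero i))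
            (N∑.sum-cong-≋ λ i → ∑ₚ-homo h h-ε h-∙ (F ∘ Perm.insert zero i))
    where
    sum-homo : ∀ {m} (s : Fin m → M.Carrier) → h (M∑.sum s) N.≈ N∑.sum (h ∘ s)
    sum-homo {zero}  s = h-ε
    sum-homo {suc m} s = N.trans (h-∙ (s zero) _) (N.∙-congˡ (sum-homo (s ∘ suc)))

module ℕ∑ₚ = PermutationSum ℕ.+-0-commutativeMonoid

term≤sum : ∀ {m} (s : Fin m → ℕ) i → s i ≤ ℕSum.sum s
term≤sum s zero    = ℕ.m≤m+n _ _
term≤sum s (suc i) = ℕ.≤-trans (term≤sum (s ∘ suc) i) (ℕ.m≤n+m _ _)

id-term≤∑ₚ : ∀ {n} (F : Permutation′ n → ℕ) → ℕ∑ₚ.Respectful F → F Perm.id ≤ ℕ∑ₚ.∑ₚ F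
id-term≤∑ₚ {zero}  F F-resp = ℕ.≤-refl
id-term≤∑ₚ {suc n} F F-resp = begin
  F Perm.id                                       ≡⟨ F-resp Perm.id (Perm.insert zero zero Perm.id) insert-id ⟩
  F (Perm.insert zero zero Perm.id)               ≤⟨ id-term≤∑ₚ (F ∘ Perm.insert zero zero) (λ σ τ eq → F-resp _ _ (ℕ∑ₚ.insert-cong zero {σ} {τ} eq)) ⟩
  ℕ∑ₚ.∑ₚ (F ∘ Perm.insert zero zero)              ≤⟨ term≤sum (λ i → ℕ∑ₚ.∑ₚ (F ∘ Perm.insert zero i)) zero ⟩
  ℕ∑ₚ.∑ₚ F                                        ∎
  where
  open ℕ.≤-Reasoning
  insert-id : Perm.id ≈ₚ Perm.insert {n} zero zero Perm.id
  insert-id zero    = refl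
  insert-id (suc k) = refl

module Symmetrizers {c ℓ} (K : CommutativeRing c ℓ) (n : ℕ) where
  open CommutativeRing K hiding (zero; ring)
    renaming (refl to ≈-refl; sym to ≈-sym; trans to ≈-trans; reflexive to ≈-reflexive)
  open GroupAlgebra K n
  open PermutationSum +-commutativeMonoid
  open Sign K using (sgn-cong; sgn-·; sgn²; sgn-⁻¹; transposition)
  open SetoidReasoning setoid
  module A = Ring ring

  if-cong : ∀ {P Q : Set} (P? : Dec P) (Q? : Dec Q) → (P → Q) → (Q → P) → ∀ {x y} → x ≈ y →
            (if does P? then x else 0#) ≈ (if does Q? then y else 0#)
  if-cong (yes _) (yes _) P⇒Q Q⇒P x≈y = x≈y
  if-cong (no _)  (no _)  P⇒Q Q⇒P x≈y = ≈-refl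
  if-cong (yes p) (no ¬q) P⇒Q Q⇒P x≈y = contradiction (P⇒Q p) ¬q
  if-cong (no ¬p) (yes q) P⇒Q Q⇒P x≈y = contradiction (Q⇒P q) ¬p

  row col : (Fin n → ℕ) → Element
  row f = mkElement (λ σ → if does (fixes? f σ) then 1# else 0#) λ σ τ eq →
    if-cong (fixes? f σ) (fixes? f τ) (Fixes-resp {σ = σ} {τ} eq) (Fixes-resp {σ = τ} {σ} (sym ∘ eq)) ≈-refl
  col g = mkElement (λ σ → if does (fixes? g σ) then sgn σ else 0#) λ σ τ eq →
    if-cong (fixes? g σ) (fixes? g τ) (Fixes-resp {σ = σ} {τ} eq) (Fixes-resp {σ = τ} {σ} (sym ∘ eq)) (sgn-cong σ τ eq)

  row-⇔ : ∀ f f′ {σ τ} → (Fixes f σ → Fixes f′ τ) → (Fixes f′ τ → Fixes f σ) →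
          coeff (row f) σ ≈ coeff (row f′) τ
  row-⇔ f f′ {σ} {τ} to from = if-cong (fixes? f σ) (fixes? f′ τ) to from ≈-refl

  col-yes : ∀ g σ → Fixes g σ → coeff (col g) σ ≈ sgn σ
  col-yes g σ gσ = ≈-reflexive (cong (if_then sgn σ else 0#) (dec-true (fixes? g σ) gσ))

  col-no : ∀ g σ → ¬ Fixes g σ → coeff (col g) σ ≈ 0#
  col-no g σ ¬gσ = ≈-reflexive (cong (if_then sgn σ else 0#) (dec-false (fixes? g σ) ¬gσ))

  row-yes : ∀ f σ → Fixes f σ → coeff (row f) σ ≈ 1#
  row-yes f σ fσ = ≈-reflexive (cong (if_then 1# else 0#) (dec-true (fixes? f σ) fσ))

  row-no : ∀ f σ → ¬ Fixes f σ → coeff (row f) σ ≈ 0#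
  row-no f σ ¬fσ = ≈-reflexive (cong (if_then 1# else 0#) (dec-false (fixes? f σ) ¬fσ))

  -- Translation by `π` brings the surviving term to the identity, where `∑ₚ-id` applies.
  ∑ₚ-single : ∀ (F : Permutation′ n → Carrier) → Respectful F → ∀ π →
              (∀ σ → ¬ σ ≈ₚ π → F σ ≈ 0#) → ∑ₚ F ≈ F π
  ∑ₚ-single F F-resp π F≈0 = begin
    ∑ₚ F                 ≈⟨ ∑ₚ-translate {n} π F F-resp ⟨
    ∑ₚ (λ σ → F (π · σ)) ≈⟨ ∑ₚ-id {n} (λ σ → F (π · σ))
                              (λ σ τ eq → F-resp (π · σ) (π · τ) λ i → cong (π ⟨$⟩ʳ_) (eq i))
                              (λ σ σ≉id → F≈0 (π · σ) λ eq → σ≉id λ i →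
                                 trans (sym (Perm.inverseˡ π)) (trans (cong (π ⟨$⟩ˡ_) (eq i)) (Perm.inverseˡ π))) ⟩
    F (π · Perm.id)      ≈⟨ F-resp (π · Perm.id) π (λ _ → refl) ⟩
    F π                  ∎

  []-yes : ∀ σ τ → σ ≈ₚ τ → coeff [ σ ] τ ≈ 1#
  []-yes σ τ eq = ≈-reflexive (cong (if_then 1# else 0#) (dec-true (σ ≈ₚ? τ) eq))

  []-no : ∀ σ τ → ¬ σ ≈ₚ τ → coeff [ σ ] τ ≈ 0#
  []-no σ τ neq = ≈-reflexive (cong (if_then 1# else 0#) (dec-false (σ ≈ₚ? τ) neq))

  []-*ᴬ : ∀ τ x ρ → coeff ([ τ ] *ᴬ x) ρ ≈ coeff x (τ ⁻¹ · ρ)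
  []-*ᴬ τ x ρ = begin
    ∑ₚ (λ σ → coeff [ τ ] σ * coeff x (σ ⁻¹ · ρ))
      ≈⟨ ∑ₚ-single (λ σ → coeff [ τ ] σ * coeff x (σ ⁻¹ · ρ))
           (λ σ σ′ eq → *-cong (coeff-cong [ τ ] σ σ′ eq)
              (coeff-cong x (σ ⁻¹ · ρ) (σ′ ⁻¹ · ρ) λ i → ⁻¹-cong {σ = σ} {σ′} eq (ρ ⟨$⟩ʳ i)))
           τ (λ σ σ≉τ → ≈-trans (*-congʳ ([]-no τ σ (λ eq → σ≉τ (sym ∘ eq)))) (zeroˡ _)) ⟩
    coeff [ τ ] τ * coeff x (τ ⁻¹ · ρ)   ≈⟨ *-congʳ ([]-yes τ τ (λ _ → refl)) ⟩
    1# * coeff x (τ ⁻¹ · ρ)              ≈⟨ *-identityˡ _ ⟩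
    coeff x (τ ⁻¹ · ρ)                   ∎

  *ᴬ-[] : ∀ x τ ρ → coeff (x *ᴬ [ τ ]) ρ ≈ coeff x (ρ · τ ⁻¹)
  *ᴬ-[] x τ ρ = begin
    ∑ₚ F                                             ≈⟨ ∑ₚ-single F F-resp π F≈0 ⟩
    coeff x π * coeff [ τ ] (π ⁻¹ · ρ)               ≈⟨ *-congˡ ([]-yes τ (π ⁻¹ · ρ) λ i → sym (cong (τ ⟨$⟩ʳ_) (Perm.inverseˡ ρ))) ⟩
    coeff x π * 1#                                   ≈⟨ *-identityʳ _ ⟩
    coeff x π                                        ∎
    where
    π : Permutation′ n
    π = ρ · τ ⁻¹
    F : Permutation′ n → Carrier
    F σ = coeff x σ * coeff [ τ ] (σ ⁻¹ · ρ)
    F-resp : Respectful F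
    F-resp σ σ′ eq = *-cong (coeff-cong x σ σ′ eq)
      (coeff-cong [ τ ] (σ ⁻¹ · ρ) (σ′ ⁻¹ · ρ) λ i → ⁻¹-cong {σ = σ} {σ′} eq (ρ ⟨$⟩ʳ i))
    F≈0 : ∀ σ → ¬ σ ≈ₚ π → F σ ≈ 0#
    F≈0 σ σ≉π = ≈-trans (*-congˡ ([]-no τ (σ ⁻¹ · ρ) λ eq → σ≉π λ i →
      sym (trans (sym (Perm.inverseʳ σ))
        (cong (σ ⟨$⟩ʳ_) (trans (sym (eq (τ ⟨$⟩ˡ i))) (Perm.inverseʳ τ)))))) (zeroʳ _)

  •-*ᴬ : ∀ r x y → (r • x) *ᴬ y ≈ᴬ r • (x *ᴬ y)
  •-*ᴬ r x y ρ = ≈-trans (∑ₚ-cong {n} λ σ → *-assoc r _ _)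
    (≈-sym (*-distribˡ-∑ₚ {n} r (λ σ → coeff x σ * coeff y (σ ⁻¹ · ρ))))

  *ᴬ-• : ∀ r x y → x *ᴬ (r • y) ≈ᴬ r • (x *ᴬ y)
  *ᴬ-• r x y ρ = ≈-trans
    (∑ₚ-cong {n} λ σ → ≈-trans (≈-sym (*-assoc _ r _)) (≈-trans (*-congʳ (*-comm _ r)) (*-assoc r _ _)))
    (≈-sym (*-distribˡ-∑ₚ {n} r (λ σ → coeff x σ * coeff y (σ ⁻¹ · ρ))))

  •-cancel : ∀ {r s} → s * r ≈ 1# → ∀ x → s • (r • x) ≈ᴬ x
  •-cancel sr≈1 x ρ = ≈-trans (≈-sym (*-assoc _ _ _)) (≈-trans (*-congʳ sr≈1) (*-identityˡ _))

  -- Linearity in the middle factor. It reduces every triple product to the products of `x`, `[ σ ]`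
  -- and `z`, which are then kept or killed one `σ` at a time.
  *ᴬ-expand : ∀ x y z ρ → coeff (x *ᴬ (y *ᴬ z)) ρ ≈
              ∑ₚ (λ σ → coeff y σ * coeff (x *ᴬ ([ σ ] *ᴬ z)) ρ)
  *ᴬ-expand x y z ρ = begin
    ∑ₚ (λ τ → coeff x τ * ∑ₚ (λ σ → coeff y σ * coeff z (σ ⁻¹ · (τ ⁻¹ · ρ))))
      ≈⟨ ∑ₚ-cong {n} (λ τ → *-distribˡ-∑ₚ {n} (coeff x τ) (λ σ → coeff y σ * coeff z (σ ⁻¹ · (τ ⁻¹ · ρ)))) ⟩
    ∑ₚ (λ τ → ∑ₚ (λ σ → coeff x τ * (coeff y σ * coeff z (σ ⁻¹ · (τ ⁻¹ · ρ)))))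
      ≈⟨ ∑ₚ-comm {n} {n} (λ τ σ → coeff x τ * (coeff y σ * coeff z (σ ⁻¹ · (τ ⁻¹ · ρ)))) ⟩
    ∑ₚ (λ σ → ∑ₚ (λ τ → coeff x τ * (coeff y σ * coeff z (σ ⁻¹ · (τ ⁻¹ · ρ)))))
      ≈⟨ ∑ₚ-cong {n} (λ σ → ∑ₚ-cong {n} λ τ → ≈-trans (≈-sym (*-assoc _ _ _))
           (≈-trans (*-congʳ (*-comm _ _)) (≈-trans (*-assoc _ _ _)
             (*-congˡ (*-congˡ (≈-sym ([]-*ᴬ σ z (τ ⁻¹ · ρ)))))))) ⟩
    ∑ₚ (λ σ → ∑ₚ (λ τ → coeff y σ * (coeff x τ * coeff ([ σ ] *ᴬ z) (τ ⁻¹ · ρ))))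
      ≈⟨ ∑ₚ-cong {n} (λ σ → *-distribˡ-∑ₚ {n} (coeff y σ) (λ τ → coeff x τ * coeff ([ σ ] *ᴬ z) (τ ⁻¹ · ρ))) ⟨
    ∑ₚ (λ σ → coeff y σ * coeff (x *ᴬ ([ σ ] *ᴬ z)) ρ) ∎

  []-*ᴬ-row : ∀ f τ → Fixes f τ → [ τ ] *ᴬ row f ≈ᴬ row f
  []-*ᴬ-row f τ fτ ρ = ≈-trans ([]-*ᴬ τ (row f) ρ) (row-⇔ f f {τ ⁻¹ · ρ} {ρ}
    (λ h k → trans (sym (Fixes-⁻¹ τ fτ (ρ ⟨$⟩ʳ k))) (h k))
    (Fixes-· (τ ⁻¹) ρ (Fixes-⁻¹ τ fτ)))

  col-*ᴬ-[] : ∀ g τ → Fixes g τ → col g *ᴬ [ τ ] ≈ᴬ sgn τ • col g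
  col-*ᴬ-[] g τ gτ ρ = ≈-trans (*ᴬ-[] (col g) τ ρ) (by (fixes? g ρ))
    where
    by : Dec (Fixes g ρ) → coeff (col g) (ρ · τ ⁻¹) ≈ sgn τ * coeff (col g) ρ
    by (yes gρ) = begin
      coeff (col g) (ρ · τ ⁻¹)  ≈⟨ col-yes g (ρ · τ ⁻¹) (Fixes-· ρ (τ ⁻¹) gρ (Fixes-⁻¹ τ gτ)) ⟩
      sgn (ρ · τ ⁻¹)            ≈⟨ sgn-· ρ (τ ⁻¹) ⟩
      sgn ρ * sgn (τ ⁻¹)        ≈⟨ *-comm _ _ ⟩
      sgn (τ ⁻¹) * sgn ρ        ≈⟨ *-cong (sgn-⁻¹ τ) (≈-sym (col-yes g ρ gρ)) ⟩
      sgn τ * coeff (col g) ρ   ∎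
    by (no ¬gρ) = begin
      coeff (col g) (ρ · τ ⁻¹)  ≈⟨ col-no g (ρ · τ ⁻¹) (λ h → ¬gρ λ k →
                                     trans (cong (g ∘ (ρ ⟨$⟩ʳ_)) (sym (Perm.inverseˡ τ))) (trans (h (τ ⟨$⟩ʳ k)) (gτ k))) ⟩
      0#                        ≈⟨ zeroʳ _ ⟨
      sgn τ * 0#                ≈⟨ *-congˡ (col-no g ρ ¬gρ) ⟨
      sgn τ * coeff (col g) ρ   ∎

  -- Relabelling conjugates the row group: a permutation preserves `f ∘ σ` exactly when its
  -- conjugate by `σ` preserves `f`.
  row-conjugate : ∀ f {f′} σ → (∀ k → f (σ ⟨$⟩ʳ k) ≡ f′ k) → row f′ *ᴬ [ σ ⁻¹ ] ≈ᴬ [ σ ⁻¹ ] *ᴬ row f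
  row-conjugate f {f′} σ fσ≡f′ ρ = begin
    coeff (row f′ *ᴬ [ σ ⁻¹ ]) ρ   ≈⟨ *ᴬ-[] (row f′) (σ ⁻¹) ρ ⟩
    coeff (row f′) (ρ · σ)         ≈⟨ row-⇔ f′ f {ρ · σ} {σ · ρ}
      (λ h k → trans (fσ≡f′ (ρ ⟨$⟩ʳ k)) (trans (cong (f′ ∘ (ρ ⟨$⟩ʳ_)) (sym (Perm.inverseʳ σ)))
                 (trans (h (σ ⟨$⟩ˡ k)) (trans (sym (fσ≡f′ (σ ⟨$⟩ˡ k))) (cong f (Perm.inverseʳ σ))))))
      (λ h k → trans (sym (fσ≡f′ (ρ ⟨$⟩ʳ (σ ⟨$⟩ʳ k)))) (trans (h (σ ⟨$⟩ʳ k)) (fσ≡f′ k))) ⟩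
    coeff (row f) (σ · ρ)          ≈⟨ []-*ᴬ (σ ⁻¹) (row f) ρ ⟨
    coeff ([ σ ⁻¹ ] *ᴬ row f) ρ    ∎

  col-conjugate : ∀ g {g′} σ → (∀ k → g (σ ⟨$⟩ʳ k) ≡ g′ k) → col g′ *ᴬ [ σ ⁻¹ ] ≈ᴬ [ σ ⁻¹ ] *ᴬ col g
  col-conjugate g {g′} σ gσ≡g′ ρ = begin
    coeff (col g′ *ᴬ [ σ ⁻¹ ]) ρ   ≈⟨ *ᴬ-[] (col g′) (σ ⁻¹) ρ ⟩
    coeff (col g′) (ρ · σ)         ≈⟨ by (fixes? g′ (ρ · σ)) ⟩
    coeff (col g) (σ · ρ)          ≈⟨ []-*ᴬ (σ ⁻¹) (col g) ρ ⟨
    coeff ([ σ ⁻¹ ] *ᴬ col g) ρ    ∎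
    where
    to : Fixes g′ (ρ · σ) → Fixes g (σ · ρ)
    to h k = trans (gσ≡g′ (ρ ⟨$⟩ʳ k)) (trans (cong (g′ ∘ (ρ ⟨$⟩ʳ_)) (sym (Perm.inverseʳ σ)))
                 (trans (h (σ ⟨$⟩ˡ k)) (trans (sym (gσ≡g′ (σ ⟨$⟩ˡ k))) (cong g (Perm.inverseʳ σ)))))
    from : Fixes g (σ · ρ) → Fixes g′ (ρ · σ)
    from h k = trans (sym (gσ≡g′ (ρ ⟨$⟩ʳ (σ ⟨$⟩ʳ k)))) (trans (h (σ ⟨$⟩ʳ k)) (gσ≡g′ k))
    by : Dec (Fixes g′ (ρ · σ)) → coeff (col g′) (ρ · σ) ≈ coeff (col g) (σ · ρ)
    by (yes fix) = ≈-trans (col-yes g′ (ρ · σ) fix) (≈-trans (sgn-· ρ σ) (≈-trans (*-comm _ _)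
                     (≈-trans (≈-sym (sgn-· σ ρ)) (≈-sym (col-yes g (σ · ρ) (to fix))))))
    by (no ¬fix) = ≈-trans (col-no g′ (ρ · σ) ¬fix) (≈-sym (col-no g (σ · ρ) (¬fix ∘ from)))

  module A∑ₚ = PermutationSum A.+-commutativeMonoid

  private
    ∑ₚ-coeff : ∀ (F : Permutation′ n → Element) ρ → coeff (A∑ₚ.∑ₚ F) ρ ≈ ∑ₚ (λ σ → coeff (F σ) ρ)
    ∑ₚ-coeff F ρ = ∑ₚ-Homomorphism.∑ₚ-homo A.+-commutativeMonoid +-commutativeMonoid
      (λ x → coeff x ρ) ≈-refl (λ _ _ → ≈-refl) {n} F

  -- The expression defining `youngSymmetrizer`, over any `K` and for any pair of labellings; at ℂ
  -- and the coordinates of a filling the two agree by definition.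
  youngElement : (f g : Fin n → ℕ) → Element
  youngElement f g = A∑ₚ.∑-over (fixes? f) λ p → A∑ₚ.∑-over (fixes? g) λ q → sgn q • [ q · p ]

  -- For fixed `q` only `p = q⁻¹ρ` contributes to the coefficient of `ρ`, which leaves the
  -- convolution of the two symmetrizers.
  young : ∀ f g → youngElement f g ≈ᴬ col g *ᴬ row f
  young f g ρ = begin
    coeff (A∑ₚ.∑-over (fixes? f) (λ p → columns p)) ρ
      ≈⟨ ∑ₚ-coeff (λ p → if does (fixes? f p) then columns p else 0ᴬ) ρ ⟩
    ∑ₚ (λ p → coeff (if does (fixes? f p) then columns p else 0ᴬ) ρ)
      ≈⟨ ∑ₚ-cong {n} (λ p → ≈-trans (row-case (does (fixes? f p)) (columns p)) (*-congˡ (columns-coeff p))) ⟩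
    ∑ₚ (λ p → coeff (row f) p * ∑ₚ (λ q → coeff (col g) q * coeff [ q · p ] ρ))
      ≈⟨ ∑ₚ-cong {n} (λ p → *-distribˡ-∑ₚ {n} (coeff (row f) p) (λ q → coeff (col g) q * coeff [ q · p ] ρ)) ⟩
    ∑ₚ (λ p → ∑ₚ (λ q → coeff (row f) p * (coeff (col g) q * coeff [ q · p ] ρ)))
      ≈⟨ ∑ₚ-comm {n} {n} (λ p q → coeff (row f) p * (coeff (col g) q * coeff [ q · p ] ρ)) ⟩
    ∑ₚ (λ q → ∑ₚ (λ p → coeff (row f) p * (coeff (col g) q * coeff [ q · p ] ρ)))
      ≈⟨ ∑ₚ-cong {n} (λ q → ∑ₚ-cong {n} λ p → ≈-trans (≈-sym (*-assoc _ _ _))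
           (≈-trans (*-congʳ (*-comm _ _)) (*-assoc _ _ _))) ⟩
    ∑ₚ (λ q → ∑ₚ (λ p → coeff (col g) q * (coeff (row f) p * coeff [ q · p ] ρ)))
      ≈⟨ ∑ₚ-cong {n} (λ q → *-distribˡ-∑ₚ {n} (coeff (col g) q) (λ p → coeff (row f) p * coeff [ q · p ] ρ)) ⟨
    ∑ₚ (λ q → coeff (col g) q * ∑ₚ (λ p → coeff (row f) p * coeff [ q · p ] ρ))
      ≈⟨ ∑ₚ-cong {n} (λ q → *-congˡ (single q)) ⟩
    ∑ₚ (λ q → coeff (col g) q * coeff (row f) (q ⁻¹ · ρ)) ∎
    where
    columns : Permutation′ n → Element
    columns p = A∑ₚ.∑-over (fixes? g) λ q → sgn q • [ q · p ]

    row-case : ∀ b x → coeff (if b then x else 0ᴬ) ρ ≈ (if b then 1# else 0#) * coeff x ρ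
    row-case true  x = ≈-sym (*-identityˡ _)
    row-case false x = ≈-sym (zeroˡ _)

    col-case : ∀ b q p → coeff (if b then sgn q • [ q · p ] else 0ᴬ) ρ ≈
                         (if b then sgn q else 0#) * coeff [ q · p ] ρ
    col-case true  q p = ≈-refl
    col-case false q p = ≈-sym (zeroˡ _)

    columns-coeff : ∀ p → coeff (columns p) ρ ≈ ∑ₚ (λ q → coeff (col g) q * coeff [ q · p ] ρ)
    columns-coeff p = ≈-trans (∑ₚ-coeff (λ q → if does (fixes? g q) then sgn q • [ q · p ] else 0ᴬ) ρ)
      (∑ₚ-cong {n} λ q → col-case (does (fixes? g q)) q p)

    single : ∀ q → ∑ₚ (λ p → coeff (row f) p * coeff [ q · p ] ρ) ≈ coeff (row f) (q ⁻¹ · ρ)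
    single q = begin
      ∑ₚ (λ p → coeff (row f) p * coeff [ q · p ] ρ)
        ≈⟨ ∑ₚ-cong {n} (λ p → *-congˡ (≈-reflexive (cong (if_then 1# else 0#) (does-⇔
             (mk⇔ (λ eq i → trans (sym (Perm.inverseˡ q)) (cong (q ⟨$⟩ˡ_) (eq i)))
                  (λ eq i → trans (cong (q ⟨$⟩ʳ_) (eq i)) (Perm.inverseʳ q)))
             ((q · p) ≈ₚ? ρ) (p ≈ₚ? (q ⁻¹ · ρ)))))) ⟩
      ∑ₚ (λ p → coeff (row f) p * coeff [ p ] (q ⁻¹ · ρ))
        ≈⟨ ∑ₚ-single (λ p → coeff (row f) p * coeff [ p ] (q ⁻¹ · ρ))
             (λ p p′ eq → *-cong (coeff-cong (row f) p p′ eq) (≈-reflexive (cong (if_then 1# else 0#) (does-⇔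
               (mk⇔ (λ h i → trans (sym (eq i)) (h i)) (λ h i → trans (eq i) (h i)))
               (p ≈ₚ? (q ⁻¹ · ρ)) (p′ ≈ₚ? (q ⁻¹ · ρ))))))
             (q ⁻¹ · ρ)
             (λ p p≉ → ≈-trans (*-congˡ ([]-no p (q ⁻¹ · ρ) p≉)) (zeroʳ _)) ⟩
      coeff (row f) (q ⁻¹ · ρ) * coeff [ q ⁻¹ · ρ ] (q ⁻¹ · ρ)
        ≈⟨ *-congˡ ([]-yes (q ⁻¹ · ρ) (q ⁻¹ · ρ) λ _ → refl) ⟩
      coeff (row f) (q ⁻¹ · ρ) * 1#
        ≈⟨ *-identityʳ _ ⟩
      coeff (row f) (q ⁻¹ · ρ) ∎

-- Triple products of symmetrizers

NaturalsInvertible : ∀ {c ℓ} → CommutativeRing c ℓ → Set _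
NaturalsInvertible K = ∀ m → ∃ λ x → x * (suc m ·1× 1#) ≈ 1#
  where
  open CommutativeRing K
  open MonoidMult +-monoid renaming (_×_ to _·1×_)

count : ∀ {n} {P : Pred (Permutation′ n) 0ℓ} → Decidable P → ℕ
count P? = ℕ∑ₚ.∑ₚ λ σ → 𝟙 (P? σ)

-- The identity is always counted; this keeps the integers arising from `absorb` away from zero.
count-positive : ∀ {n} {P : Pred (Permutation′ n) 0ℓ} (P? : Decidable P) → P Perm.id →
                 (∀ {σ τ} → σ ≈ₚ τ → P σ → P τ) → ∃ λ m → count P? ≡ suc m
count-positive {n} P? P-id P-resp = nonZero (ℕ.≤-trans
  (ℕ.≤-reflexive (sym (cong (if_then 1 else 0) (dec-true (P? Perm.id) P-id))))
  (id-term≤∑ₚ {n} (λ σ → 𝟙 (P? σ)) λ σ τ eq → ℕ.≤-antisym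
    (𝟙-mono-≤ (P? σ) (P? τ) (P-resp {σ} {τ} eq))
    (𝟙-mono-≤ (P? τ) (P? σ) (P-resp {τ} {σ} (sym ∘ eq)))))
  where
  nonZero : ∀ {k} → 1 ≤ k → ∃ λ m → k ≡ suc m
  nonZero {suc m} _ = m , refl

module Straightening {c ℓ} (K : CommutativeRing c ℓ) (inverse : NaturalsInvertible K) (n : ℕ) where
  open CommutativeRing K hiding (zero; ring)
    renaming (refl to ≈-refl; sym to ≈-sym; trans to ≈-trans; reflexive to ≈-reflexive)
  open RingProperties (CommutativeRing.ring K) using (-1*x≈-x)
  open GroupAlgebra K n
  open PermutationSum +-commutativeMonoid
  open Sign K using (sgn²; transposition; ⟨$⟩ʳ-injective)
  open MonoidMult +-monoid using (×-homo-+) renaming (_×_ to _·1×_)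
  open Symmetrizers K n
  module ≈-Reasoning = SetoidReasoning setoid
  module ≈ᴬ-Reasoning = SetoidReasoning A.setoid

  x≈-x⇒x≈0 : ∀ {x} → x ≈ - x → x ≈ 0#
  x≈-x⇒x≈0 {x} x≈-x = begin
    x                        ≈⟨ *-identityˡ x ⟨
    1# * x                   ≈⟨ *-congʳ (proj₂ (inverse 1)) ⟨
    ½ * (2 ·1× 1#) * x       ≈⟨ *-assoc ½ (2 ·1× 1#) x ⟩
    ½ * ((2 ·1× 1#) * x)     ≈⟨ *-congˡ (distribʳ x 1# (1# + 0#)) ⟩
    ½ * (1# * x + (1# + 0#) * x)  ≈⟨ *-congˡ (+-cong (*-identityˡ x) (≈-trans (*-congʳ (+-identityʳ 1#)) (*-identityˡ x))) ⟩
    ½ * (x + x)              ≈⟨ *-congˡ (+-congˡ x≈-x) ⟩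
    ½ * (x + - x)            ≈⟨ *-congˡ (-‿inverseʳ x) ⟩
    ½ * 0#                   ≈⟨ zeroʳ ½ ⟩
    0#                       ∎
    where
    open ≈-Reasoning
    ½ : Carrier
    ½ = proj₁ (inverse 1)

  -- The transposition `t` of `u` and `v` lies in the column group of `g` and in the `σ`-conjugate
  -- of the row group of `f`. Inserted in the middle, it is absorbed on the right for free and on
  -- the left at the price of a sign, so the product equals its own negative.
  col-[]-row≈0 : ∀ g f σ {u v} → u ≢ v → g u ≡ g v → f (σ ⟨$⟩ˡ u) ≡ f (σ ⟨$⟩ˡ v) →
                 col g *ᴬ ([ σ ] *ᴬ row f) ≈ᴬ 0ᴬ
  col-[]-row≈0 g f σ {u} {v} u≢v gu≡gv fu≡fv ρ = x≈-x⇒x≈0 (begin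
    coeff (col g *ᴬ z) ρ                ≈⟨ A.*-congˡ {col g} {[ t ] *ᴬ z} {z} t-fixes-z ρ ⟨
    coeff (col g *ᴬ ([ t ] *ᴬ z)) ρ     ≈⟨ A.*-assoc (col g) [ t ] z ρ ⟨
    coeff ((col g *ᴬ [ t ]) *ᴬ z) ρ     ≈⟨ A.*-congʳ {z} {col g *ᴬ [ t ]} {sgn t • col g} (col-*ᴬ-[] g t (fixes g gu≡gv)) ρ ⟩
    coeff ((sgn t • col g) *ᴬ z) ρ      ≈⟨ •-*ᴬ (sgn t) (col g) z ρ ⟩
    sgn t * coeff (col g *ᴬ z) ρ        ≈⟨ *-congʳ sgn-t ⟩
    - 1# * coeff (col g *ᴬ z) ρ         ≈⟨ -1*x≈-x _ ⟩
    - coeff (col g *ᴬ z) ρ              ∎)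
    where
    open ≈-Reasoning
    z : Element
    z = [ σ ] *ᴬ row f
    t : Permutation′ n
    t = proj₁ (transposition u v u≢v)
    sgn-t : sgn t ≈ - 1#
    sgn-t = proj₁ (proj₂ (transposition u v u≢v))
    fixes : ∀ (h : Fin n → ℕ) → h u ≡ h v → Fixes h t
    fixes = proj₂ (proj₂ (transposition u v u≢v))
    fσ⁻¹t⁻¹ : ∀ k → f (σ ⟨$⟩ˡ (t ⟨$⟩ˡ k)) ≡ f (σ ⟨$⟩ˡ k)
    fσ⁻¹t⁻¹ = Fixes-⁻¹ t (fixes (f ∘ (σ ⟨$⟩ˡ_)) fu≡fv)
    t-fixes-z : [ t ] *ᴬ z ≈ᴬ z
    t-fixes-z ρ = begin
      coeff ([ t ] *ᴬ z) ρ                   ≈⟨ []-*ᴬ t z ρ ⟩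
      coeff z (t ⁻¹ · ρ)                     ≈⟨ []-*ᴬ σ (row f) (t ⁻¹ · ρ) ⟩
      coeff (row f) (σ ⁻¹ · (t ⁻¹ · ρ))      ≈⟨ row-⇔ f f {σ ⁻¹ · (t ⁻¹ · ρ)} {σ ⁻¹ · ρ}
                                                  (λ h k → trans (sym (fσ⁻¹t⁻¹ (ρ ⟨$⟩ʳ k))) (h k))
                                                  (λ h k → trans (fσ⁻¹t⁻¹ (ρ ⟨$⟩ʳ k)) (h k)) ⟩
      coeff (row f) (σ ⁻¹ · ρ)               ≈⟨ []-*ᴬ σ (row f) ρ ⟨
      coeff z ρ                              ∎

  fromℕ∑ₚ : ∀ (F : Permutation′ n → ℕ) → ℕ∑ₚ.∑ₚ F ·1× 1# ≈ ∑ₚ (λ σ → F σ ·1× 1#)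
  fromℕ∑ₚ F = ∑ₚ-Homomorphism.∑ₚ-homo ℕ.+-0-commutativeMonoid +-commutativeMonoid
    (_·1× 1#) ≈-refl (×-homo-+ 1#) {n} F

  -- Every term in the expansion of `y` yields either one full copy of the product of `x` and `z` or
  -- nothing, so the scalar counts the surviving terms.
  absorb : ∀ x y z {P : Pred (Permutation′ n) 0ℓ} (P? : Decidable P) →
           (∀ σ → P σ → coeff y σ • (x *ᴬ ([ σ ] *ᴬ z)) ≈ᴬ x *ᴬ z) →
           (∀ σ → ¬ P σ → coeff y σ • (x *ᴬ ([ σ ] *ᴬ z)) ≈ᴬ 0ᴬ) →
           x *ᴬ (y *ᴬ z) ≈ᴬ (count P? ·1× 1#) • (x *ᴬ z)
  absorb x y z {P} P? keep kill ρ = begin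
    coeff (x *ᴬ (y *ᴬ z)) ρ
      ≈⟨ *ᴬ-expand x y z ρ ⟩
    ∑ₚ (λ σ → coeff y σ * coeff (x *ᴬ ([ σ ] *ᴬ z)) ρ)
      ≈⟨ ∑ₚ-cong {n} (λ σ → case σ (P? σ)) ⟩
    ∑ₚ (λ σ → (𝟙 (P? σ) ·1× 1#) * coeff (x *ᴬ z) ρ)
      ≈⟨ *-distribʳ-∑ₚ {n} (coeff (x *ᴬ z) ρ) (λ σ → 𝟙 (P? σ) ·1× 1#) ⟨
    ∑ₚ (λ σ → 𝟙 (P? σ) ·1× 1#) * coeff (x *ᴬ z) ρ
      ≈⟨ *-congʳ (fromℕ∑ₚ λ σ → 𝟙 (P? σ)) ⟨
    (count P? ·1× 1#) * coeff (x *ᴬ z) ρ ∎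
    where
    open ≈-Reasoning
    case : ∀ σ (Pσ? : Dec (P σ)) →
           coeff y σ * coeff (x *ᴬ ([ σ ] *ᴬ z)) ρ ≈ (𝟙 Pσ? ·1× 1#) * coeff (x *ᴬ z) ρ
    case σ (yes Pσ) = ≈-trans (keep σ Pσ ρ)
      (≈-sym (≈-trans (*-congʳ (+-identityʳ 1#)) (*-identityˡ _)))
    case σ (no ¬Pσ) = ≈-trans (kill σ ¬Pσ ρ) (≈-sym (zeroˡ _))

  Multiple : Element → Element → Set _
  Multiple x y = ∃ λ m → x ≈ᴬ (suc m ·1× 1#) • y

  private
    multiple : ∀ {x y : Element} f f′ →
               x ≈ᴬ (count (λ (σ : Permutation′ n) → fixes? f σ ×-dec fixes? f′ σ) ·1× 1#) • y → Multiple x y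
    multiple {x} {y} f f′ x≈ =
      let m , count≡ = count-positive {n} (λ σ → fixes? f σ ×-dec fixes? f′ σ) ((λ _ → refl) , (λ _ → refl))
                         (λ {σ} {τ} eq (fσ , f′σ) → Fixes-resp {σ = σ} {τ} eq fσ , Fixes-resp {σ = σ} {τ} eq f′σ)
      in m , λ ρ → ≈-trans (x≈ ρ) (*-congʳ (≈-reflexive (cong (_·1× 1#) count≡)))

    zeroCoeff : ∀ {r} x → r ≈ 0# → r • x ≈ᴬ 0ᴬ
    zeroCoeff x r≈0 ρ = ≈-trans (*-congʳ r≈0) (zeroˡ _)

    zeroElement : ∀ r {x} → x ≈ᴬ 0ᴬ → r • x ≈ᴬ 0ᴬ
    zeroElement r x≈0 ρ = ≈-trans (*-congˡ (x≈0 ρ)) (zeroʳ r)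

    col-[]-row≈0′ : ∀ g f σ {x y} → x ≢ y → f x ≡ f y → g (σ ⟨$⟩ʳ x) ≡ g (σ ⟨$⟩ʳ y) →
                    col g *ᴬ ([ σ ] *ᴬ row f) ≈ᴬ 0ᴬ
    col-[]-row≈0′ g f σ x≢y fx≡fy gσx≡gσy = col-[]-row≈0 g f σ
      (x≢y ∘ ⟨$⟩ʳ-injective σ) gσx≡gσy
      (trans (cong f (Perm.inverseˡ σ)) (trans fx≡fy (cong f (sym (Perm.inverseˡ σ)))))

  -- A row permutation of `f` that also preserves `f′` is absorbed by `row f′`; any other collides
  -- and contributes nothing.
  absorb-row : ∀ {f f′ g a b} → IsMove f f′ g a b →
               Multiple (col g *ᴬ (row f *ᴬ row f′)) (col g *ᴬ row f′)
  absorb-row {f} {f′} {g} move = multiple {col g *ᴬ (row f *ᴬ row f′)} {col g *ᴬ row f′} f f′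
    (absorb (col g) (row f) (row f′) (λ σ → fixes? f σ ×-dec fixes? f′ σ) keep kill)
    where
    keep : ∀ σ → Fixes f σ × Fixes f′ σ →
           coeff (row f) σ • (col g *ᴬ ([ σ ] *ᴬ row f′)) ≈ᴬ col g *ᴬ row f′
    keep σ (fσ , f′σ) ρ = ≈-trans (*-cong (row-yes f σ fσ)
      (A.*-congˡ {col g} {[ σ ] *ᴬ row f′} {row f′} ([]-*ᴬ-row f′ σ f′σ) ρ)) (*-identityˡ _)
    kill : ∀ σ → ¬ (Fixes f σ × Fixes f′ σ) →
           coeff (row f) σ • (col g *ᴬ ([ σ ] *ᴬ row f′)) ≈ᴬ 0ᴬ
    kill σ ¬fix = case (fixes? f σ)
      where
      case : Dec (Fixes f σ) → coeff (row f) σ • (col g *ᴬ ([ σ ] *ᴬ row f′)) ≈ᴬ 0ᴬ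
      case (no ¬fσ) = zeroCoeff (col g *ᴬ ([ σ ] *ᴬ row f′)) (row-no f σ ¬fσ)
      case (yes fσ) with fixes-or-collides move σ fσ
      ... | inj₁ f′σ = contradiction (fσ , f′σ) ¬fix
      ... | inj₂ (_ , _ , x≢y , f′x≡f′y , gσx≡gσy) =
        zeroElement _ {col g *ᴬ ([ σ ] *ᴬ row f′)} (col-[]-row≈0′ g f′ σ x≢y f′x≡f′y gσx≡gσy)

  -- The columns `h` on the left may differ from the columns `g` that govern the move. With
  -- collisions in `h` for every `σ`, even those preserving `f′`, no term survives.
  annihilate-row : ∀ {f f′ g a b} (move : IsMove f f′ g a b) h → (∀ σ fσ → Collision move σ fσ h) →
                   col h *ᴬ (row f *ᴬ row f′) ≈ᴬ 0ᴬ
  annihilate-row {f} {f′} move h collides ρ = ≈-trans (*ᴬ-expand (col h) (row f) (row f′) ρ)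
    (∑ₚ-0 {n} λ σ → case σ (fixes? f σ))
    where
    case : ∀ σ → Dec (Fixes f σ) → coeff (row f) σ * coeff (col h *ᴬ ([ σ ] *ᴬ row f′)) ρ ≈ 0#
    case σ (no ¬fσ) = zeroCoeff (col h *ᴬ ([ σ ] *ᴬ row f′)) (row-no f σ ¬fσ) ρ
    case σ (yes fσ) with collides σ fσ
    ... | _ , _ , x≢y , f′x≡f′y , hσx≡hσy =
      zeroElement _ {col h *ᴬ ([ σ ] *ᴬ row f′)} (col-[]-row≈0′ h f′ σ x≢y f′x≡f′y hσx≡hσy) ρ

  absorb-col : ∀ {g g′ f a b} → IsMove g g′ f a b →
               Multiple (col g′ *ᴬ (col g *ᴬ row f)) (col g′ *ᴬ row f)
  absorb-col {g} {g′} {f} move = multiple {col g′ *ᴬ (col g *ᴬ row f)} {col g′ *ᴬ row f} g g′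
    (absorb (col g′) (col g) (row f) (λ σ → fixes? g σ ×-dec fixes? g′ σ) keep kill)
    where
    keep : ∀ σ → Fixes g σ × Fixes g′ σ →
           coeff (col g) σ • (col g′ *ᴬ ([ σ ] *ᴬ row f)) ≈ᴬ col g′ *ᴬ row f
    keep σ (gσ , g′σ) ρ = begin
      coeff (col g) σ * coeff (col g′ *ᴬ ([ σ ] *ᴬ row f)) ρ   ≈⟨ *-cong (col-yes g σ gσ) (≈-sym (A.*-assoc (col g′) [ σ ] (row f) ρ)) ⟩
      sgn σ * coeff ((col g′ *ᴬ [ σ ]) *ᴬ row f) ρ             ≈⟨ *-congˡ (A.*-congʳ {row f} {col g′ *ᴬ [ σ ]} {sgn σ • col g′} (col-*ᴬ-[] g′ σ g′σ) ρ) ⟩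
      sgn σ * coeff ((sgn σ • col g′) *ᴬ row f) ρ              ≈⟨ *-congˡ (•-*ᴬ (sgn σ) (col g′) (row f) ρ) ⟩
      sgn σ * (sgn σ * coeff (col g′ *ᴬ row f) ρ)              ≈⟨ •-cancel (sgn² σ) (col g′ *ᴬ row f) ρ ⟩
      coeff (col g′ *ᴬ row f) ρ                                ∎
      where open ≈-Reasoning
    kill : ∀ σ → ¬ (Fixes g σ × Fixes g′ σ) →
           coeff (col g) σ • (col g′ *ᴬ ([ σ ] *ᴬ row f)) ≈ᴬ 0ᴬ
    kill σ ¬fix = case (fixes? g σ)
      where
      case : Dec (Fixes g σ) → coeff (col g) σ • (col g′ *ᴬ ([ σ ] *ᴬ row f)) ≈ᴬ 0ᴬ
      case (no ¬gσ) = zeroCoeff (col g′ *ᴬ ([ σ ] *ᴬ row f)) (col-no g σ ¬gσ)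
      -- The moved labelling now belongs to the factor left of `[ σ ]`, so the colliding pair is
      -- taken before applying `σ ⁻¹` rather than `σ`.
      case (yes gσ) with fixes-or-collides move (σ ⁻¹) (Fixes-⁻¹ σ gσ)
      ... | inj₁ g′σ⁻¹ = contradiction (gσ , Fixes-⁻¹ (σ ⁻¹) g′σ⁻¹) ¬fix
      ... | inj₂ (_ , _ , x≢y , g′x≡g′y , fσ⁻¹x≡fσ⁻¹y) =
        zeroElement _ {col g′ *ᴬ ([ σ ] *ᴬ row f)} (col-[]-row≈0 g′ f σ x≢y g′x≡g′y fσ⁻¹x≡fσ⁻¹y)

  open ≈ᴬ-Reasoning

  •-cong : ∀ r {x y} → x ≈ᴬ y → r • x ≈ᴬ r • y
  •-cong r x≈y ρ = *-congˡ (x≈y ρ)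

  col-cong : ∀ {g g′} → g ≗ g′ → col g ≈ᴬ col g′
  col-cong {g} {g′} g≗g′ σ = if-cong (fixes? g σ) (fixes? g′ σ)
    (λ h k → trans (sym (g≗g′ (σ ⟨$⟩ʳ k))) (trans (h k) (g≗g′ k)))
    (λ h k → trans (g≗g′ (σ ⟨$⟩ʳ k)) (trans (h k) (sym (g≗g′ k)))) ≈-refl

  -- Divides `absorb-col` by its integer. This places the left ideal of the diagram after a column
  -- move inside that of the original one.
  col-move-inside : ∀ {g g′ f a b} → IsMove g g′ f a b →
                    ∃ λ v → col g′ *ᴬ row f ≈ᴬ v *ᴬ (col g *ᴬ row f)
  col-move-inside {g} {g′} {f} move = N⁻¹ • col g′ , (begin
    col g′ *ᴬ row f                        ≈⟨ •-cancel (proj₂ (inverse m)) (col g′ *ᴬ row f) ⟨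
    N⁻¹ • N • (col g′ *ᴬ row f)            ≈⟨ •-cong N⁻¹ {col g′ *ᴬ (col g *ᴬ row f)} {N • (col g′ *ᴬ row f)} (proj₂ (absorb-col move)) ⟨
    N⁻¹ • (col g′ *ᴬ (col g *ᴬ row f))     ≈⟨ •-*ᴬ N⁻¹ (col g′) (col g *ᴬ row f) ⟨
    (N⁻¹ • col g′) *ᴬ (col g *ᴬ row f)     ∎)
    where
    m = proj₁ (absorb-col move)
    N N⁻¹ : Carrier
    N = suc m ·1× 1#
    N⁻¹ = proj₁ (inverse m)

  module _ {f f′ g a b} (move : IsMove f f′ g a b) (F G : Fin n → ℕ) (σ : Permutation′ n)
           (Fσ≗f′ : ∀ k → F (σ ⟨$⟩ʳ k) ≡ f′ k) (Gσ≗g : ∀ k → G (σ ⟨$⟩ʳ k) ≡ g k) where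

    -- The right factor inducing the surjection: `row f′` performs the row move, and `[ σ ⁻¹ ]`
    -- passes to the entries of the new filling, whose labels are `F` and `G`.
    straighten : Element
    straighten = row f′ *ᴬ [ σ ⁻¹ ]

    []-inverse : [ σ ] *ᴬ [ σ ⁻¹ ] ≈ᴬ 1ᴬ
    []-inverse ρ = ≈-trans ([]-*ᴬ σ [ σ ⁻¹ ] ρ) (if-cong ((σ ⁻¹) ≈ₚ? (σ ⁻¹ · ρ)) (Perm.id ≈ₚ? ρ)
      (λ eq i → trans (sym (Perm.inverseʳ σ)) (trans (cong (σ ⟨$⟩ʳ_) (eq i)) (Perm.inverseʳ σ)))
      (λ eq i → cong (σ ⟨$⟩ˡ_) (eq i)) ≈-refl)

    conjugate : col g *ᴬ straighten ≈ᴬ [ σ ⁻¹ ] *ᴬ (col G *ᴬ row F)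
    conjugate = begin
      col g *ᴬ (row f′ *ᴬ [ σ ⁻¹ ])      ≈⟨ A.*-congˡ {col g} {row f′ *ᴬ [ σ ⁻¹ ]} {[ σ ⁻¹ ] *ᴬ row F} (row-conjugate F σ Fσ≗f′) ⟩
      col g *ᴬ ([ σ ⁻¹ ] *ᴬ row F)       ≈⟨ A.*-assoc (col g) [ σ ⁻¹ ] (row F) ⟨
      (col g *ᴬ [ σ ⁻¹ ]) *ᴬ row F       ≈⟨ A.*-congʳ {row F} {col g *ᴬ [ σ ⁻¹ ]} {[ σ ⁻¹ ] *ᴬ col G} (col-conjugate G σ Gσ≗g) ⟩
      ([ σ ⁻¹ ] *ᴬ col G) *ᴬ row F       ≈⟨ A.*-assoc [ σ ⁻¹ ] (col G) (row F) ⟩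
      [ σ ⁻¹ ] *ᴬ (col G *ᴬ row F)       ∎

    regroup : ∀ x → (x *ᴬ row f) *ᴬ straighten ≈ᴬ (x *ᴬ (row f *ᴬ row f′)) *ᴬ [ σ ⁻¹ ]
    regroup x = begin
      (x *ᴬ row f) *ᴬ (row f′ *ᴬ [ σ ⁻¹ ])      ≈⟨ A.*-assoc (x *ᴬ row f) (row f′) [ σ ⁻¹ ] ⟨
      ((x *ᴬ row f) *ᴬ row f′) *ᴬ [ σ ⁻¹ ]      ≈⟨ A.*-congʳ {[ σ ⁻¹ ]} {(x *ᴬ row f) *ᴬ row f′} {x *ᴬ (row f *ᴬ row f′)} (A.*-assoc x (row f) (row f′)) ⟩
      (x *ᴬ (row f *ᴬ row f′)) *ᴬ [ σ ⁻¹ ]      ∎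

    -- The image of the generator is an integer multiple of a translate of the new generator. The
    -- left inverse `w` of the factor `u` is recorded because surjectivity rests on it.
    straighten-generator : ∃₂ λ u w →
      (col g *ᴬ row f) *ᴬ straighten ≈ᴬ u *ᴬ (col G *ᴬ row F) × w *ᴬ u ≈ᴬ 1ᴬ
    straighten-generator = N • [ σ ⁻¹ ] , N⁻¹ • [ σ ] , image , (begin
      (N⁻¹ • [ σ ]) *ᴬ (N • [ σ ⁻¹ ])      ≈⟨ •-*ᴬ N⁻¹ [ σ ] (N • [ σ ⁻¹ ]) ⟩
      N⁻¹ • ([ σ ] *ᴬ (N • [ σ ⁻¹ ]))      ≈⟨ •-cong N⁻¹ {[ σ ] *ᴬ (N • [ σ ⁻¹ ])} {N • ([ σ ] *ᴬ [ σ ⁻¹ ])} (*ᴬ-• N [ σ ] [ σ ⁻¹ ]) ⟩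
      N⁻¹ • N • ([ σ ] *ᴬ [ σ ⁻¹ ])        ≈⟨ •-cancel (proj₂ (inverse m)) ([ σ ] *ᴬ [ σ ⁻¹ ]) ⟩
      [ σ ] *ᴬ [ σ ⁻¹ ]                    ≈⟨ []-inverse ⟩
      1ᴬ                                   ∎)
      where
      m = proj₁ (absorb-row move)
      N N⁻¹ : Carrier
      N = suc m ·1× 1#
      N⁻¹ = proj₁ (inverse m)
      image : (col g *ᴬ row f) *ᴬ straighten ≈ᴬ (N • [ σ ⁻¹ ]) *ᴬ (col G *ᴬ row F)
      image = begin
        (col g *ᴬ row f) *ᴬ straighten                     ≈⟨ regroup (col g) ⟩
        (col g *ᴬ (row f *ᴬ row f′)) *ᴬ [ σ ⁻¹ ]           ≈⟨ A.*-congʳ {[ σ ⁻¹ ]} {col g *ᴬ (row f *ᴬ row f′)} {N • (col g *ᴬ row f′)} (proj₂ (absorb-row move)) ⟩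
        (N • (col g *ᴬ row f′)) *ᴬ [ σ ⁻¹ ]                ≈⟨ •-*ᴬ N (col g *ᴬ row f′) [ σ ⁻¹ ] ⟩
        N • ((col g *ᴬ row f′) *ᴬ [ σ ⁻¹ ])                ≈⟨ •-cong N {(col g *ᴬ row f′) *ᴬ [ σ ⁻¹ ]} {col g *ᴬ straighten} (A.*-assoc (col g) (row f′) [ σ ⁻¹ ]) ⟩
        N • (col g *ᴬ straighten)                          ≈⟨ •-cong N {col g *ᴬ straighten} {[ σ ⁻¹ ] *ᴬ (col G *ᴬ row F)} conjugate ⟩
        N • ([ σ ⁻¹ ] *ᴬ (col G *ᴬ row F))                 ≈⟨ •-*ᴬ N [ σ ⁻¹ ] (col G *ᴬ row F) ⟨
        (N • [ σ ⁻¹ ]) *ᴬ (col G *ᴬ row F)                 ∎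

    straighten-earlier : ∀ h → (∀ τ fτ → Collision move τ fτ h) →
                         (col h *ᴬ row f) *ᴬ straighten ≈ᴬ 0ᴬ
    straighten-earlier h collides = begin
      (col h *ᴬ row f) *ᴬ straighten              ≈⟨ regroup (col h) ⟩
      (col h *ᴬ (row f *ᴬ row f′)) *ᴬ [ σ ⁻¹ ]    ≈⟨ A.*-congʳ {[ σ ⁻¹ ]} {col h *ᴬ (row f *ᴬ row f′)} {0ᴬ} (annihilate-row move h collides) ⟩
      0ᴬ *ᴬ [ σ ⁻¹ ]                              ≈⟨ A.zeroˡ [ σ ⁻¹ ] ⟩
      0ᴬ                                          ∎

-- Filtrations of a left ideal

module IdealFiltration {c ℓ} (R : Ring c ℓ) {p : ℕ} (y : Ring.Carrier R) (e : Fin p → Ring.Carrier R) where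
  open Ring R hiding (zero) renaming (refl to ≈-refl; sym to ≈-sym; trans to ≈-trans; reflexive to ≈-reflexive)
  open RingProperties R using (-‿distribˡ-*)
  open GroupProperties +-group using (x∙y⁻¹≈ε⇒x≈y)
  open CommutativeMonoidSum +-commutativeMonoid
  open SemiringSum semiring using (*-distribˡ-sum; *-distribʳ-sum)
  open SetoidReasoning setoid

  sum-single : ∀ {m} (s : Fin m → Carrier) l → (∀ i → i ≢ l → s i ≈ 0#) → sum s ≈ s l
  sum-single {suc m} s l s≈0 = begin
    sum s                              ≈⟨ sum-remove s ⟩
    s l + sum (s ∘ Fin.punchIn l)      ≈⟨ +-congˡ (sum-cong-≋ λ i → s≈0 _ (Fin.punchInᵢ≢i l i)) ⟩
    s l + sum {m} (λ _ → 0#)           ≈⟨ +-congˡ (sum-replicate-zero m) ⟩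
    s l + 0#                           ≈⟨ +-identityʳ (s l) ⟩
    s l                                ∎

  combination : (Fin p → Carrier) → Carrier
  combination a = sum λ i → a i * e i

  SupportedBelow : ℕ → (Fin p → Carrier) → Set ℓ
  SupportedBelow k a = ∀ i → k ≤ toℕ i → a i ≈ 0#

  only : Fin p → Carrier → Fin p → Carrier
  only l b i = if does (i Fin.≟ l) then b else 0#

  only-≡ : ∀ l b → only l b l ≈ b
  only-≡ l b = ≈-reflexive (cong (if_then b else 0#) (dec-true (l Fin.≟ l) refl))

  only-≢ : ∀ {l i} b → i ≢ l → only l b i ≈ 0#
  only-≢ {l} {i} b i≢l = ≈-reflexive (cong (if_then b else 0#) (dec-false (i Fin.≟ l) i≢l))

  combination-only : ∀ l b → combination (only l b) ≈ b * e l
  combination-only l b = ≈-trans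
    (sum-single (λ i → only l b i * e i) l λ i i≢l → ≈-trans (*-congʳ (only-≢ b i≢l)) (zeroˡ (e i)))
    (*-congʳ (only-≡ l b))

  SupportedBelow-only : ∀ l b → SupportedBelow (suc (toℕ l)) (only l b)
  SupportedBelow-only l b i l<i = only-≢ {l} {i} b λ { refl → ℕ.<-irrefl refl l<i }

  combination-* : ∀ a h → combination a * h ≈ sum λ i → a i * (e i * h)
  combination-* a h = ≈-trans (*-distribʳ-sum h λ i → a i * e i) (sum-cong-≋ λ i → *-assoc (a i) (e i) h)

  -- The sum of the left ideals generated by the first `k` of the `e i`. Coefficients are families
  -- on all of `Fin p` that vanish from `k` on, so a member of one step belongs to a later one with
  -- the same coefficients.
  step : ℕ → Submodule (toModule (leftIdeal {R = R} y)) (c ⊔ ℓ)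
  step k = record
    { Member   = λ (x , _) → ∃ λ a → SupportedBelow k a × x ≈ combination a
    ; resp     = λ x≈x′ (a , a≈0 , x≈) → a , a≈0 , ≈-trans (≈-sym x≈x′) x≈
    ; 0-closed = (λ _ → 0#) , (λ _ _ → ≈-refl) ,
                 ≈-sym (≈-trans (sum-cong-≋ λ i → zeroˡ (e i)) (sum-replicate-zero p))
    ; +-closed = λ (a , a≈0 , x≈) (b , b≈0 , x′≈) →
                 (λ i → a i + b i) , (λ i k≤i → ≈-trans (+-cong (a≈0 i k≤i) (b≈0 i k≤i)) (+-identityˡ 0#)) ,
                 ≈-trans (+-cong x≈ x′≈) (≈-trans (≈-sym (∑-distrib-+ (λ i → a i * e i) (λ i → b i * e i)))
                   (sum-cong-≋ λ i → ≈-sym (distribʳ (e i) (a i) (b i))))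
    ; *-closed = λ r (a , a≈0 , x≈) →
                 (λ i → r * a i) , (λ i k≤i → ≈-trans (*-congˡ (a≈0 i k≤i)) (zeroʳ r)) ,
                 ≈-trans (*-congˡ x≈) (≈-trans (*-distribˡ-sum r λ i → a i * e i)
                   (sum-cong-≋ λ i → ≈-sym (*-assoc r (a i) (e i))))
    }

  step-0 : IsZero (step 0)
  step-0 (a , a≈0 , x≈) = ≈-trans x≈ (≈-trans
    (sum-cong-≋ λ i → ≈-trans (*-congʳ (a≈0 i z≤n)) (zeroˡ (e i))) (sum-replicate-zero p))

  step-mono : ∀ {k l} → k ≤ l → step k ⊆ᴹ step l
  step-mono k≤l (a , a≈0 , x≈) = a , (λ i l≤i → a≈0 i (ℕ.≤-trans k≤l l≤i)) , x≈

  step-whole : ∀ l → e l ≈ y → IsWhole (step (suc (toℕ l)))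
  step-whole l eₗ≈y (x , b , x≈by) = only l b , SupportedBelow-only l b ,
    ≈-trans x≈by (≈-trans (*-congˡ (≈-sym eₗ≈y)) (≈-sym (combination-only l b)))

  module _ (k : Fin p) (h y′ u w : Carrier)
           (earlier : ∀ i → toℕ i < toℕ k → e i * h ≈ 0#)
           (eₖh≈uy′ : e k * h ≈ u * y′) (wu≈1 : w * u ≈ 1#)
           (v : Carrier) (eₖ≈vy : e k ≈ v * y) where

    private
      below-* : ∀ a → SupportedBelow (toℕ k) a → combination a * h ≈ 0#
      below-* a a≈0 = ≈-trans (combination-* a h)
        (≈-trans (sum-cong-≋ vanish) (sum-replicate-zero p))
        where
        vanish : ∀ i → a i * (e i * h) ≈ 0#
        vanish i with toℕ i ℕ.<? toℕ k
        ... | yes i<k = ≈-trans (*-congˡ (earlier i i<k)) (zeroʳ (a i))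
        ... | no  i≮k = ≈-trans (*-congʳ (a≈0 i (ℕ.≮⇒≥ i≮k))) (zeroˡ _)

      upTo-* : ∀ a → SupportedBelow (suc (toℕ k)) a → combination a * h ≈ (a k * u) * y′
      upTo-* a a≈0 = begin
        combination a * h                ≈⟨ combination-* a h ⟩
        sum (λ i → a i * (e i * h))      ≈⟨ sum-single (λ i → a i * (e i * h)) k vanish ⟩
        a k * (e k * h)                  ≈⟨ *-congˡ eₖh≈uy′ ⟩
        a k * (u * y′)                   ≈⟨ *-assoc (a k) u y′ ⟨
        (a k * u) * y′                   ∎
        where
        vanish : ∀ i → i ≢ k → a i * (e i * h) ≈ 0#
        vanish i i≢k with ℕ.<-cmp (toℕ i) (toℕ k)
        ... | tri< i<k _ _ = ≈-trans (*-congˡ (earlier i i<k)) (zeroʳ (a i))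
        ... | tri≈ _ i≡k _ = contradiction (Fin.toℕ-injective i≡k) i≢k
        ... | tri> _ _ k<i = ≈-trans (*-congʳ (a≈0 i k<i)) (zeroˡ _)

    -- Right multiplication by `h` is left linear and kills every `e i` before `k`, hence all of
    -- `N`. The submodule `N` is kept general because in the filtration it is the step at
    -- `toℕ (inject₁ k)`, which agrees with `toℕ k` only propositionally.
    step-surjection : ∀ {N : Submodule (toModule (leftIdeal {R = R} y)) (c ⊔ ℓ)} → N ⊆ᴹ step (toℕ k) →
                      toModule (step (suc (toℕ k))) / (N within step (suc (toℕ k))) ↠ᴹ
                      toModule (leftIdeal {R = R} y′)
    step-surjection {N} N⊆ = f , f-homo , f-surjective
      where
      module Q = LeftModule (toModule (step (suc (toℕ k))) / (N within step (suc (toℕ k))))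
      module S = LeftModule (toModule (leftIdeal {R = R} y′))

      f : Q.Carrierᴹ → S.Carrierᴹ
      f ((x , _) , a , a≈0 , x≈) = x * h , a k * u , ≈-trans (*-congʳ x≈) (upTo-* a a≈0)

      f-cong : ∀ {x x′} → x Q.≈ᴹ x′ → f x S.≈ᴹ f x′
      f-cong {(x , _) , _} {(x′ , _) , _} x∼x′ = x∙y⁻¹≈ε⇒x≈y _ _ (begin
        x * h - x′ * h          ≈⟨ +-congˡ (-‿distribˡ-* x′ h) ⟩
        x * h + - x′ * h        ≈⟨ distribʳ h x (- x′) ⟨
        (x - x′) * h            ≈⟨ *-congʳ (proj₂ (proj₂ (N⊆ x∼x′))) ⟩
        combination _ * h       ≈⟨ below-* _ (proj₁ (proj₂ (N⊆ x∼x′))) ⟩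
        0#                      ∎)

      f-homo : LeftModuleMorphisms.IsLeftModuleHomomorphism Q.rawLeftModule S.rawLeftModule f
      f-homo = record
        { +ᴹ-isGroupHomomorphism = record
          { isMonoidHomomorphism = record
            { isMagmaHomomorphism = record
              { isRelHomomorphism = record { cong = λ {x} {x′} → f-cong {x} {x′} }
              ; homo = λ ((x , _) , _) ((x′ , _) , _) → distribʳ h x x′
              }
            ; ε-homo = zeroˡ h
            }
          ; ⁻¹-homo = λ ((x , _) , _) → ≈-sym (-‿distribˡ-* x h)
          }
        ; *ₗ-homo = λ r ((x , _) , _) → *-assoc r x h
        }

      f-surjective : ∀ z → ∃ λ x → ∀ {x′} → x′ Q.≈ᴹ x → f x′ S.≈ᴹ z
      f-surjective (z , b , z≈by′) = x , λ {x′} x′∼x → ≈-trans (f-cong {x′} {x} x′∼x) fx≈z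
        where
        -- The preimage of `b * y′` is `b * w * e k`: by `wu≈1` the factors `w` and `u` cancel after
        -- multiplication by `h`, and `eₖ≈vy` shows that it lies in the left ideal of `y`.
        a : Carrier
        a = b * w
        x : Q.Carrierᴹ
        x = (a * e k , a * v , ≈-trans (*-congˡ eₖ≈vy) (≈-sym (*-assoc a v y)))
          , only k a , SupportedBelow-only k a , ≈-sym (combination-only k a)
        fx≈z : (a * e k) * h ≈ z
        fx≈z = begin
          (a * e k) * h         ≈⟨ *-assoc a (e k) h ⟩
          a * (e k * h)         ≈⟨ *-congˡ eₖh≈uy′ ⟩
          b * w * (u * y′)      ≈⟨ *-assoc (b * w) u y′ ⟨
          b * w * u * y′        ≈⟨ *-congʳ (*-assoc b w u) ⟩
          b * (w * u) * y′      ≈⟨ *-congʳ (*-congˡ wu≈1) ⟩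
          b * 1# * y′           ≈⟨ *-congʳ (*-identityʳ b) ⟩
          b * y′                ≈⟨ z≈by′ ⟨
          z                     ∎

-- Natural numbers are invertible in ℂ

module ℂ = CommutativeRing ℂ
module ℂMult = MonoidMult ℂ.+-monoid
module ℚMult = MonoidMult ℚ.+-0-monoid

≗⇒≈ʳ : ∀ x y → (∀ n → ℝ.seq x n ≡ ℝ.seq y n) → x ≈ʳ y
≗⇒≈ʳ x y x≗y ε 0<ε = 0 , λ n _ → subst (ℚ._< ε)
  (sym (cong ∣_∣ (trans (cong (ℚ._- ℝ.seq y n) (x≗y n)) (ℚ.+-inverseʳ (ℝ.seq y n))))) 0<ε

ℚ⇒ℂ : ℚ → ℂ.Carrier
ℚ⇒ℂ q = fromℚ q , fromℚ 0ℚ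

ℚ⇒ℂ-+ : ∀ q r → ℚ⇒ℂ q ℂ.+ ℚ⇒ℂ r ℂ.≈ ℚ⇒ℂ (q ℚ.+ r)
ℚ⇒ℂ-+ q r = ≗⇒≈ʳ (fromℚ q +ʳ fromℚ r) (fromℚ (q ℚ.+ r)) (λ _ → refl)
          , ≗⇒≈ʳ (fromℚ 0ℚ +ʳ fromℚ 0ℚ) (fromℚ 0ℚ) (λ _ → refl)

ℚ⇒ℂ-* : ∀ q r → ℚ⇒ℂ q ℂ.* ℚ⇒ℂ r ℂ.≈ ℚ⇒ℂ (q ℚ.* r)
ℚ⇒ℂ-* q r = ≗⇒≈ʳ (fromℚ q *ʳ fromℚ r +ʳ -ʳ (fromℚ 0ℚ *ʳ fromℚ 0ℚ)) (fromℚ (q ℚ.* r))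
              (λ _ → ℚ.+-identityʳ (q ℚ.* r))
          , ≗⇒≈ʳ (fromℚ q *ʳ fromℚ 0ℚ +ʳ fromℚ 0ℚ *ʳ fromℚ r) (fromℚ 0ℚ)
              (λ _ → cong₂ ℚ._+_ (ℚ.*-zeroʳ q) (ℚ.*-zeroˡ r))

×1-ℂ : ∀ m → m ℂMult.× ℂ.1# ℂ.≈ ℚ⇒ℂ (m ℚMult.× 1ℚ)
×1-ℂ zero    = ℂ.refl {ℂ.0#}
×1-ℂ (suc m) = begin
  ℂ.1# ℂ.+ m ℂMult.× ℂ.1#           ≈⟨ ℂ.+-congˡ {ℂ.1#} {m ℂMult.× ℂ.1#} {ℚ⇒ℂ (m ℚMult.× 1ℚ)} (×1-ℂ m) ⟩
  ℚ⇒ℂ 1ℚ ℂ.+ ℚ⇒ℂ (m ℚMult.× 1ℚ)     ≈⟨ ℚ⇒ℂ-+ 1ℚ (m ℚMult.× 1ℚ) ⟩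
  ℚ⇒ℂ (suc m ℚMult.× 1ℚ)            ∎
  where open SetoidReasoning ℂ.setoid

×1-nonNegative : ∀ m → ℚ.NonNegative (m ℚMult.× 1ℚ)
×1-nonNegative zero    = _
×1-nonNegative (suc m) = ℚ.nonNeg+nonNeg⇒nonNeg 1ℚ (m ℚMult.× 1ℚ) {{×1-nonNegative m}}

-- A positive integer is the image of a positive rational, so the inverse can be taken in ℚ and no
-- Cauchy sequence has to be inverted.
ℂ-naturalsInvertible : NaturalsInvertible ℂ
ℂ-naturalsInvertible m = ℚ⇒ℂ (ℚ.1/ s) , (begin
  ℚ⇒ℂ (ℚ.1/ s) ℂ.* (suc m ℂMult.× ℂ.1#)   ≈⟨ ℂ.*-congˡ {ℚ⇒ℂ (ℚ.1/ s)} {suc m ℂMult.× ℂ.1#} {ℚ⇒ℂ s} (×1-ℂ (suc m)) ⟩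
  ℚ⇒ℂ (ℚ.1/ s) ℂ.* ℚ⇒ℂ s                  ≈⟨ ℚ⇒ℂ-* (ℚ.1/ s) s ⟩
  ℚ⇒ℂ (ℚ.1/ s ℚ.* s)                      ≡⟨ cong ℚ⇒ℂ (ℚ.*-inverseˡ s) ⟩
  ℂ.1#                                    ∎)
  where
  open SetoidReasoning ℂ.setoid
  s : ℚ
  s = suc m ℚMult.× 1ℚ
  instance
    s≢0 : ℚ.NonZero s
    s≢0 = ℚ.pos⇒nonZero s {{ℚ.pos+nonNeg⇒pos 1ℚ (m ℚMult.× 1ℚ) {{×1-nonNegative m}}}}

-- Diagrams and fillings

∈↔Fin : ∀ {A : Set} {n} (xs : Vec A n) → (∃ λ x → x ∈ xs) ↔ Fin n
∈↔Fin xs = mk↔ₛ′ (λ (_ , x∈xs) → Any.index x∈xs) (λ i → Vec.lookup xs i , ∈-lookup i xs)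
  (λ i → index-∈-lookup i xs) (λ (_ , x∈xs) → recover x∈xs)
  where
  recover : ∀ {A : Set} {n} {xs : Vec A n} {x} (x∈xs : x ∈ xs) →
            (Vec.lookup xs (Any.index x∈xs) , ∈-lookup (Any.index x∈xs) xs) ≡ (x , x∈xs)
  recover (here refl)  = refl
  recover (there x∈xs) = cong (λ (x , x∈xs) → x , there x∈xs) (recover x∈xs)

module _ {n} {D : Diagram n} (T : Filling D) where

  position : Permutation′ n
  position = ∈↔Fin (cells D) ↔-∘ ↔-sym (entry T)

  cellOf-lookup : ∀ k → cellOf T k ≡ Vec.lookup (cells D) (position ⟨$⟩ʳ k)
  cellOf-lookup k = lookup-index (proj₂ (Inverse.from (entry T) k))

-- Entries k of T and relabel T T′ k of T′ sit at the same place of the vectors of cells.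
relabel : ∀ {n} {D D′ : Diagram n} → Filling D → Filling D′ → Permutation′ n
relabel T T′ = position T′ ⁻¹ · position T

cellOf-relabel : ∀ {n} {D D′ : Diagram n} (T : Filling D) (T′ : Filling D′) m →
                 cells D′ ≡ Vec.map m (cells D) →
                 ∀ k → cellOf T′ (relabel T T′ ⟨$⟩ʳ k) ≡ m (cellOf T k)
cellOf-relabel {D = D} {D′} T T′ m cells≡ k =
  trans (cellOf-lookup T′ (relabel T T′ ⟨$⟩ʳ k))
  (trans (cong (Vec.lookup (cells D′)) (Perm.inverseʳ (position T′)))
  (trans (cong (λ xs → Vec.lookup xs (position T ⟨$⟩ʳ k)) cells≡)
  (trans (lookup-map (position T ⟨$⟩ʳ k) m (cells D))
         (cong m (sym (cellOf-lookup T k))))))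

-- A filling reduced to the coordinates of its entries. The diagram between the column move and the
-- row move acquires such labels from `T` without a filling of its own.
record Labels {n} (D : Diagram n) (f g : Fin n → ℕ) : Set where
  field
    inside : ∀ k → (f k , g k) ∈ᴰ D
    covers : ∀ {c} → c ∈ᴰ D → ∃ λ k → (f k , g k) ≡ c

Filling-labels : ∀ {n} {D : Diagram n} (T : Filling D) → Labels D (proj₁ ∘ cellOf T) (proj₂ ∘ cellOf T)
Filling-labels T = record
  { inside = λ k → proj₂ (Inverse.from (entry T) k)
  ; covers = λ {c} c∈D → Inverse.to (entry T) (c , c∈D) , cong proj₁ (Inverse.strictlyInverseʳ (entry T) (c , c∈D))
  }

record Moves {n} (D D′ : Diagram n) (P : Pred Cell 0ℓ) (g : Cell → Cell) : Set where
  field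
    move       : Cell → Cell
    cells-move : cells D′ ≡ Vec.map move (cells D)
    moves      : ∀ {c} → P c → g c ∉ cells D → move c ≡ g c
    stays      : ∀ {c} → ¬ (P c × g c ∉ cells D) → move c ≡ c

Labels-move : ∀ {n} {D D′ : Diagram n} {P g} (M : Moves D D′ P g) {r s r′ s′} → Labels D r s →
              (∀ k → Moves.move M (r k , s k) ≡ (r′ k , s′ k)) → Labels D′ r′ s′
Labels-move {D = D} {D′} M {r′ = r′} {s′} L eq = record
  { inside = λ k → subst₂ (λ c xs → c ∈ xs) (eq k) (sym cells-move) (∈-map⁺ move (inside k))
  ; covers = λ c∈D′ → covers′ (subst (λ xs → _ ∈ xs) cells-move c∈D′)
  }
  where
  open Moves M
  open Labels L
  covers′ : ∀ {c} → c ∈ Vec.map move (cells D) → ∃ λ k → (r′ k , s′ k) ≡ c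
  covers′ c∈ =
    let k , eqₖ = covers (∈-lookup (Any.index c∈) (cells D))
    in k , trans (sym (eq k)) (trans (cong move eqₖ)
             (trans (sym (lookup-map (Any.index c∈) move (cells D))) (sym (lookup-index c∈))))

moveCells-moves : ∀ {n} (D : Diagram n) {P : Pred Cell 0ℓ} (P? : Decidable P) (g : Cell → Cell)
                  (inj : ∀ {c d} → P c → P d → g c ≡ g d → c ≡ d)
                  (pos : ∀ {i j} → 1 ≤ i × 1 ≤ j → 1 ≤ proj₁ (g (i , j)) × 1 ≤ proj₂ (g (i , j))) →
                  Moves D (moveCells D P? g inj pos) P g
moveCells-moves D P? g inj pos = record
  { move       = moveCell D P? g inj pos
  ; cells-move = refl
  ; moves      = λ Pc gc∉D → moveCell-moves D P? g inj pos (Pc , gc∉D)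
  ; stays      = moveCell-stays D P? g inj pos
  }

R-moves : ∀ {n} a b .{{_ : ℕ.NonZero b}} (D : Diagram n) →
          Moves D (R[ a ⇒ b ] D) (λ (i , _) → i ≡ a) (λ (_ , j) → b , j)
R-moves a b D = moveCells-moves D _ _ _ _

C-moves : ∀ {n} c d .{{_ : ℕ.NonZero d}} (D : Diagram n) →
          Moves D (C[ c ⇒ d ] D) (λ (_ , j) → j ≡ c) (λ (i , _) → i , d)
C-moves c d D = moveCells-moves D _ _ _ _

-- A target position `(b , g x)` is occupied exactly when some entry carries these labels, so being
-- held in place translates into `Blocked`.
R-isMove : ∀ {n} {D D′ : Diagram n} {a b f g f′} →
           (M : Moves D D′ (λ (i , _) → i ≡ a) (λ (_ , j) → b , j)) → Labels D f g →
           (∀ k → proj₁ (Moves.move M (f k , g k)) ≡ f′ k) → IsMove f f′ g a b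
R-isMove {a = a} {b} {f} {g} M L eq = record
  { moved   = λ {x} fx≡a ¬bl → trans (sym (eq x)) (cong proj₁ (moves fx≡a λ c∈D →
                let y , ≡c = covers c∈D in ¬bl (fx≡a , y , cong proj₁ ≡c , cong proj₂ ≡c)))
  ; blocked = λ {x} (fx≡a , y , fy≡b , gy≡gx) → trans (trans (sym (eq x)) (cong proj₁ (stays λ (_ , c∉D) →
                c∉D (subst (λ c → c ∈ _) (cong₂ _,_ fy≡b gy≡gx) (inside y))))) fx≡a
  ; other   = λ {x} fx≢a → trans (sym (eq x)) (cong proj₁ (stays λ (fx≡a , _) → fx≢a fx≡a))
  }
  where
  open Moves M
  open Labels L

R-column : ∀ {n} {D D′ : Diagram n} {a b f g} →
           (M : Moves D D′ (λ (i , _) → i ≡ a) (λ (_ , j) → b , j)) → Labels D f g →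
           ∀ k → proj₂ (Moves.move M (f k , g k)) ≡ g k
R-column {a = a} {b} {f} {g} M L k with f k ℕ.≟ a | Fin.any? (λ y → (f y ℕ.≟ b) ×-dec (g y ℕ.≟ g k))
... | no fk≢a  | _ = cong proj₂ (Moves.stays M λ (fk≡a , _) → fk≢a fk≡a)
... | yes fk≡a | yes (y , fy≡b , gy≡gk) = cong proj₂ (Moves.stays M λ (_ , c∉D) →
  c∉D (subst (λ c → c ∈ _) (cong₂ _,_ fy≡b gy≡gk) (Labels.inside L y)))
... | yes fk≡a | no none = cong proj₂ (Moves.moves M fk≡a λ c∈D →
  let y , ≡c = Labels.covers L c∈D in none (y , cong proj₁ ≡c , cong proj₂ ≡c))

C-isMove : ∀ {n} {D D′ : Diagram n} {a b f g g′} →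
           (M : Moves D D′ (λ (_ , j) → j ≡ a) (λ (i , _) → i , b)) → Labels D f g →
           (∀ k → proj₂ (Moves.move M (f k , g k)) ≡ g′ k) → IsMove g g′ f a b
C-isMove {a = a} {b} {f} {g} M L eq = record
  { moved   = λ {x} gx≡a ¬bl → trans (sym (eq x)) (cong proj₂ (moves gx≡a λ c∈D →
                let y , ≡c = covers c∈D in ¬bl (gx≡a , y , cong proj₂ ≡c , cong proj₁ ≡c)))
  ; blocked = λ {x} (gx≡a , y , gy≡b , fy≡fx) → trans (trans (sym (eq x)) (cong proj₂ (stays λ (_ , c∉D) →
                c∉D (subst (λ c → c ∈ _) (cong₂ _,_ fy≡fx gy≡b) (inside y))))) gx≡a
  ; other   = λ {x} gx≢a → trans (sym (eq x)) (cong proj₂ (stays λ (gx≡a , _) → gx≢a gx≡a))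
  }
  where
  open Moves M
  open Labels L

C-row : ∀ {n} {D D′ : Diagram n} {a b f g} →
        (M : Moves D D′ (λ (_ , j) → j ≡ a) (λ (i , _) → i , b)) → Labels D f g →
        ∀ k → proj₁ (Moves.move M (f k , g k)) ≡ f k
C-row {a = a} {b} {f} {g} M L k with g k ℕ.≟ a | Fin.any? (λ y → (f y ℕ.≟ f k) ×-dec (g y ℕ.≟ b))
... | no gk≢a  | _ = cong proj₁ (Moves.stays M λ (gk≡a , _) → gk≢a gk≡a)
... | yes gk≡a | yes (y , fy≡fk , gy≡b) = cong proj₁ (Moves.stays M λ (_ , c∉D) →
  c∉D (subst (λ c → c ∈ _) (cong₂ _,_ fy≡fk gy≡b) (Labels.inside L y)))
... | yes gk≡a | no none = cong proj₁ (Moves.moves M gk≡a λ c∈D →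
  let y , ≡c = Labels.covers L c∈D in none (y , cong proj₁ ≡c , cong proj₂ ≡c))

-- Rows p and q = p - j + 1 have one more column in common in C_{p→i} D than in C_{p→j} D, because
-- the cell (p , p) moves to (p , i) in the former and to (p , j) in the latter, where D contains
-- (q , i) but not (q , j).
module _ {n p} {D : Diagram n} (contains : Containsδ·1 p D) {f g : Fin n → ℕ} (L : Labels D f g)
         {i j} (1≤i : 1 ≤ i) (i<j : i < j) (j≤p : j ≤ p) {cᵢ cⱼ : Fin n → ℕ}
         (moveᵢ : IsMove g cᵢ f p i) (moveⱼ : IsMove g cⱼ f p j) where

  private
    open Labels L

    1≤j : 1 ≤ j
    1≤j = ℕ.≤-trans 1≤i (ℕ.<⇒≤ i<j)
    i<p : i < p
    i<p = ℕ.<-≤-trans i<j j≤p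
    1≤p : 1 ≤ p
    1≤p = ℕ.≤-trans 1≤j j≤p

    q : ℕ
    -- Row `q` of the staircase has length `p - q = j - 1`.
    q = suc (p ∸ j)

    q+j : q ℕ.+ j ≡ suc p
    q+j = cong suc (ℕ.m∸n+n≡m j≤p)
    q<p : q < p
    q<p = ℕ.s≤s⁻¹ (subst₂ _≤_ (ℕ.+-comm q 2) q+j (ℕ.+-monoʳ-≤ q (ℕ.≤-trans (s≤s 1≤i) i<j)))
    q+i≤p : q ℕ.+ i ≤ p
    q+i≤p = ℕ.s≤s⁻¹ (subst (q ℕ.+ i <_) q+j (ℕ.+-monoʳ-< q i<j))

    outside : ∀ {a b} → 1 ≤ a → a ≤ p → 1 ≤ b → b ≤ p → p < a ℕ.+ b → (a , b) ≢ (p , p) →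
              ∀ {y} → f y ≡ a → g y ≢ b
    outside {a} {b} 1≤a a≤p 1≤b b≤p p<a+b ≢pp {y} fy≡a gy≡b
      with Equivalence.to (contains a b 1≤a a≤p 1≤b b≤p)
             (subst (λ c → c ∈ cells D) (cong₂ _,_ fy≡a gy≡b) (inside y))
    ... | inj₁ a+b≤p = ℕ.<⇒≱ p<a+b a+b≤p
    ... | inj₂ ≡pp   = ≢pp ≡pp

    -- Avoiding column `p` means that both column moves leave row `q` untouched; avoiding column `j`
    -- means that it does not meet the new column of the corner cell under `cⱼ`.
    q-row : ∀ {y} → f y ≡ q → g y ≢ p × g y ≢ j
    q-row fy≡q =
        outside (s≤s z≤n) (ℕ.<⇒≤ q<p) 1≤p ℕ.≤-refl (ℕ.+-monoˡ-≤ p (s≤s z≤n)) q≢p fy≡q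
      , outside (s≤s z≤n) (ℕ.<⇒≤ q<p) 1≤j j≤p (ℕ.≤-reflexive (sym q+j)) q≢p fy≡q
      where
      q≢p : ∀ {b} → (q , b) ≢ (p , p)
      q≢p eq = ℕ.<⇒≢ q<p (cong proj₁ eq)

    -- Within the square, row `p` contains only `(p , p)`, so the target `(p , k)` is free unless
    -- `k = p`, when the move is the identity.
    corner : ∀ {k c} → 1 ≤ k → k ≤ p → IsMove g c f p k → ∀ {x} → f x ≡ p → g x ≡ p → c x ≡ k
    corner {k} 1≤k k≤p move {x} fx≡p gx≡p with k ℕ.≟ p
    ... | yes refl = trans (move-id move x) gx≡p
    ... | no k≢p = IsMove.moved move gx≡p λ (_ , y , gy≡k , fy≡fx) →
      outside 1≤p ℕ.≤-refl 1≤k k≤p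
        (ℕ.≤-trans (ℕ.≤-reflexive (ℕ.+-comm 1 p)) (ℕ.+-monoʳ-≤ p 1≤k))
        (λ eq → k≢p (cong proj₂ eq)) (trans fy≡fx fx≡p) gy≡k

  -- Under `cⱼ` the corner entry sits in column `j`, which row `q` misses. So `x` is not the corner
  -- entry, and neither `x` nor its partner is touched by either column move.
  common-column : ∀ {x} → Blocked f cⱼ p q x → Blocked f cᵢ p q x
  common-column {x} (fx≡p , y , fy≡q , cⱼy≡cⱼx) = fx≡p , y , fy≡q ,
    trans (IsMove.other moveᵢ gy≢p) (trans gy≡cⱼx (trans (IsMove.other moveⱼ gx≢p) (sym (IsMove.other moveᵢ gx≢p))))
    where
    gy≢p : g y ≢ p
    gy≢p = proj₁ (q-row fy≡q)
    gy≡cⱼx : g y ≡ cⱼ x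
    gy≡cⱼx = trans (sym (IsMove.other moveⱼ gy≢p)) cⱼy≡cⱼx
    gx≢p : g x ≢ p
    gx≢p gx≡p = proj₂ (q-row fy≡q) (trans gy≡cⱼx (corner 1≤j j≤p moveⱼ fx≡p gx≡p))

  new-common-column : ∃ λ x → Blocked f cᵢ p q x × ¬ Blocked f cⱼ p q x
  new-common-column = x ,
    (fx≡p , y , fy≡q , trans (IsMove.other moveᵢ (proj₁ (q-row fy≡q)))
                         (trans gy≡i (sym (corner 1≤i (ℕ.<⇒≤ i<p) moveᵢ fx≡p gx≡p)))) ,
    λ (_ , z , fz≡q , cⱼz≡cⱼx) → proj₂ (q-row fz≡q)
      (trans (sym (IsMove.other moveⱼ (proj₁ (q-row fz≡q)))) (trans cⱼz≡cⱼx (corner 1≤j j≤p moveⱼ fx≡p gx≡p)))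
    where
    pp : ∃ λ x → (f x , g x) ≡ (p , p)
    pp = covers (Equivalence.from (contains p p 1≤p ℕ.≤-refl 1≤p ℕ.≤-refl) (inj₂ refl))
    qi : ∃ λ y → (f y , g y) ≡ (q , i)
    qi = covers (Equivalence.from (contains q i (s≤s z≤n) (ℕ.<⇒≤ q<p) 1≤i (ℕ.<⇒≤ i<p)) (inj₁ q+i≤p))
    x y : Fin n
    x = proj₁ pp
    y = proj₁ qi
    fx≡p : f x ≡ p
    fx≡p = cong proj₁ (proj₂ pp)
    gx≡p : g x ≡ p
    gx≡p = cong proj₂ (proj₂ pp)
    fy≡q : f y ≡ q
    fy≡q = cong proj₁ (proj₂ qi)
    gy≡i : g y ≡ i
    gy≡i = cong proj₂ (proj₂ qi)

  -- The entries blocked for `cⱼ` form a proper subset of those blocked for `cᵢ`. Counting therefore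
  -- gives, for every row permutation `σ`, an entry that changes rows in the move although `σ` sends
  -- it to a common column for `cᵢ`.
  collides-with-earlier : ∀ {f′} (move : IsMove f f′ cⱼ p q) σ fσ → Collision move σ fσ cᵢ
  collides-with-earlier move σ fσ =
    let _ , bl , ¬bl = new-common-column
        _ , blσx , ¬blx = pigeonhole (blocked? f cᵢ p q) (blocked? f cⱼ p q) σ common-column bl ¬bl
    in collision move σ fσ (ℕ.<⇒≢ q<p ∘ sym) cᵢ blσx ¬blx

-- Assembly of the filtration of the Specht module

module _ {n} {p : ℕ} {D : Diagram n} {R : Ring 0ℓ 0ℓ} where

  Quotients : Set₁
  Quotients = ∀ (k : Fin p) → let j = suc (toℕ k) in
    Filling (R[ p ⇒ suc (p ∸ j) ] (C[ p ⇒ j ] D)) → LeftModule R 0ℓ 0ℓ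

  HasFiltration : LeftModule R 0ℓ 0ℓ → Quotients → Set₁
  HasFiltration X Q =
    Σ[ M ∈ (Fin (suc p) → Submodule X 0ℓ) ]
    IsZero (M zero) ×
    IsWhole (M (fromℕ p)) ×
    (∀ (k : Fin p) → M (inject₁ k) ⊆ᴹ M (suc k)) ×
    (∀ (k : Fin p) → let j = suc (toℕ k) in
    (T′ : Filling (R[ p ⇒ suc (p ∸ j) ] (C[ p ⇒ j ] D))) →
    toModule (M (suc k)) / (M (inject₁ k) within M (suc k)) ↠ᴹ Q k T′)

  HasFiltration-resp-≡ : ∀ {X X′} {Q Q′ : Quotients} → X ≡ X′ → (∀ k T′ → Q k T′ ≡ Q′ k T′) →
                         HasFiltration X Q → HasFiltration X′ Q′
  HasFiltration-resp-≡ refl Q≡ (M , M-zero , M-whole , M-mono , M-surj) =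
    M , (λ {x} → M-zero {x}) , M-whole , (λ k {x} → M-mono k {x}) ,
    λ k T′ → subst (toModule (M (suc k)) / (M (inject₁ k) within M (suc k)) ↠ᴹ_) (Q≡ k T′) (M-surj k T′)

module JamesPeel (K : CommutativeRing 0ℓ 0ℓ) (inverse : NaturalsInvertible K) {n}
  (youngOf : ∀ {D : Diagram n} → Filling D → GroupAlgebra.Element K n)
  (youngOf≡ : ∀ {D : Diagram n} (T : Filling D) →
     youngOf T ≡ Symmetrizers.youngElement K n (proj₁ ∘ cellOf T) (proj₂ ∘ cellOf T))
  {p′} (D : Diagram n) (contains : Containsδ·1 (suc p′) D) (T : Filling D) where
  open GroupAlgebra K n
  open Symmetrizers K n
  open Straightening K inverse n
  open SetoidReasoning A.setoid

  f g : Fin n → ℕ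
  f = proj₁ ∘ cellOf T
  g = proj₂ ∘ cellOf T

  L : Labels D f g
  L = Filling-labels T

  youngOf-col-row : ∀ {D : Diagram n} (T : Filling D) →
                    youngOf T ≈ᴬ col (proj₂ ∘ cellOf T) *ᴬ row (proj₁ ∘ cellOf T)
  youngOf-col-row T = subst (_≈ᴬ col (proj₂ ∘ cellOf T) *ᴬ row (proj₁ ∘ cellOf T)) (sym (youngOf≡ T))
    (young (proj₁ ∘ cellOf T) (proj₂ ∘ cellOf T))

  colMoves : ∀ (k : Fin (suc p′)) → Moves D (C[ suc p′ ⇒ suc (toℕ k) ] D) (λ (_ , j) → j ≡ suc p′) (λ (i , _) → i , suc (toℕ k))
  colMoves k = C-moves (suc p′) (suc (toℕ k)) D

  c : Fin (suc p′) → Fin n → ℕ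
  c k x = proj₂ (Moves.move (colMoves k) (f x , g x))

  c-isMove : ∀ k → IsMove g (c k) f (suc p′) (suc (toℕ k))
  c-isMove k = C-isMove (colMoves k) L (λ _ → refl)

  colMoves-cell : ∀ k x → Moves.move (colMoves k) (f x , g x) ≡ (f x , c k x)
  colMoves-cell k x = cong (_, c k x) (C-row (colMoves k) L x)

  e : Fin (suc p′) → Element
  e k = col (c k) *ᴬ row f

  -- The last index stands for `j = p`, where the column move is the identity; hence the last step
  -- is the whole module.
  e-last : e (fromℕ p′) ≈ᴬ youngOf T
  e-last = begin
    col (c (fromℕ p′)) *ᴬ row f     ≈⟨ A.*-congʳ {row f} {col (c (fromℕ p′))} {col g} (col-cong {c (fromℕ p′)} {g} (move-id
                                         (subst (λ j → IsMove g (c (fromℕ p′)) f (suc p′) (suc j)) (Fin.toℕ-fromℕ p′) (c-isMove (fromℕ p′))))) ⟩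
    col g *ᴬ row f                  ≈⟨ youngOf-col-row T ⟨
    youngOf T              ∎

  open IdealFiltration ring (youngOf T) e public

  inside-T : ∀ k → ∃ λ v → e k ≈ᴬ v *ᴬ youngOf T
  inside-T k = let v , e≈ = col-move-inside (c-isMove k) in v , (begin
    e k                             ≈⟨ e≈ ⟩
    v *ᴬ (col g *ᴬ row f)           ≈⟨ A.*-congˡ {v} {youngOf T} {col g *ᴬ row f} (youngOf-col-row T) ⟨
    v *ᴬ youngOf T                  ∎)

  module _ (k : Fin (suc p′)) (T′ : Filling (R[ suc p′ ⇒ suc (suc p′ ∸ suc (toℕ k)) ] (C[ suc p′ ⇒ suc (toℕ k) ] D))) where

    q : ℕ
    q = suc (suc p′ ∸ suc (toℕ k))

    L₁ : Labels (C[ suc p′ ⇒ suc (toℕ k) ] D) f (c k)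
    L₁ = Labels-move (colMoves k) L (colMoves-cell k)

    rowMoves : Moves (C[ suc p′ ⇒ suc (toℕ k) ] D) (R[ suc p′ ⇒ q ] (C[ suc p′ ⇒ suc (toℕ k) ] D)) (λ (i , _) → i ≡ suc p′) (λ (_ , j) → q , j)
    rowMoves = R-moves (suc p′) q (C[ suc p′ ⇒ suc (toℕ k) ] D)

    f′ F G : Fin n → ℕ
    f′ x = proj₁ (Moves.move rowMoves (f x , c k x))
    F = proj₁ ∘ cellOf T′
    G = proj₂ ∘ cellOf T′

    f′-isMove : IsMove f f′ (c k) (suc p′) q
    f′-isMove = R-isMove rowMoves L₁ (λ _ → refl)

    σ : Permutation′ n
    σ = relabel T T′

    cellOf-σ : ∀ x → cellOf T′ (σ ⟨$⟩ʳ x) ≡ Moves.move rowMoves (f x , c k x)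
    cellOf-σ x = trans
      (cellOf-relabel T T′ (Moves.move rowMoves ∘ Moves.move (colMoves k))
        (sym (map-∘ (Moves.move rowMoves) (Moves.move (colMoves k)) (cells D))) x)
      (cong (Moves.move rowMoves) (colMoves-cell k x))

    Fσ≗f′ : ∀ x → F (σ ⟨$⟩ʳ x) ≡ f′ x
    Fσ≗f′ x = cong proj₁ (cellOf-σ x)

    Gσ≗c : ∀ x → G (σ ⟨$⟩ʳ x) ≡ c k x
    Gσ≗c x = trans (cong proj₂ (cellOf-σ x)) (R-column rowMoves L₁ x)

    surjection : ∀ {N : Submodule (toModule (leftIdeal {R = ring} (youngOf T))) 0ℓ} → N ⊆ᴹ step (toℕ k) →
                 toModule (step (suc (toℕ k))) / (N within step (suc (toℕ k))) ↠ᴹ toModule (leftIdeal {R = ring} (youngOf T′))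
    surjection {N} = step-surjection k h (youngOf T′) u w earlier
      (begin
        e k *ᴬ h                      ≈⟨ image ⟩
        u *ᴬ (col G *ᴬ row F)         ≈⟨ A.*-congˡ {u} {youngOf T′} {col G *ᴬ row F} (youngOf-col-row T′) ⟨
        u *ᴬ youngOf T′               ∎)
      wu≈1 (proj₁ (inside-T k)) (proj₂ (inside-T k)) {N}
      where
      h u w : Element
      h = straighten f′-isMove F G σ Fσ≗f′ Gσ≗c
      u = proj₁ (straighten-generator f′-isMove F G σ Fσ≗f′ Gσ≗c)
      w = proj₁ (proj₂ (straighten-generator f′-isMove F G σ Fσ≗f′ Gσ≗c))
      image : e k *ᴬ h ≈ᴬ u *ᴬ (col G *ᴬ row F)
      image = proj₁ (proj₂ (proj₂ (straighten-generator f′-isMove F G σ Fσ≗f′ Gσ≗c)))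
      wu≈1 : w *ᴬ u ≈ᴬ 1ᴬ
      wu≈1 = proj₂ (proj₂ (proj₂ (straighten-generator f′-isMove F G σ Fσ≗f′ Gσ≗c)))
      earlier : ∀ i → toℕ i < toℕ k → e i *ᴬ h ≈ᴬ 0ᴬ
      earlier i i<k = straighten-earlier f′-isMove F G σ Fσ≗f′ Gσ≗c (c i)
        (collides-with-earlier contains L (s≤s z≤n) (s≤s i<k) (Fin.toℕ<n k) (c-isMove i) (c-isMove k) f′-isMove)

  filtration : HasFiltration {p = suc p′} {D} (toModule (leftIdeal {R = ring} (youngOf T)))
                             (λ _ T′ → toModule (leftIdeal {R = ring} (youngOf T′)))
  filtration =
      (λ k → step (toℕ k))
    , (λ {x} → step-0 {x})
    , step-whole (fromℕ p′) e-last
    , (λ k {x} → step-mono (ℕ.m≤n⇒m≤1+n (ℕ.≤-reflexive (Fin.toℕ-inject₁ k))) {x})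
    , (λ k T′ → surjection k T′ {step (toℕ (inject₁ k))} λ {x} → step-mono (ℕ.≤-reflexive (Fin.toℕ-inject₁ k)) {x})

-- K[Sₙ], y_T and S^T enter up to ≡, so that at K = ℂ they can be ℂ[S n ], youngSymmetrizer T and
-- Specht T themselves: comparing the whole statement after unfolding these is infeasible.
hasFiltration : ∀ (K : CommutativeRing 0ℓ 0ℓ) → NaturalsInvertible K → ∀ {n}
  (R : Ring 0ℓ 0ℓ) (R≡ : R ≡ GroupAlgebra.ring K n)
  (youngOf : ∀ {D : Diagram n} → Filling D → Ring.Carrier R) →
  (∀ {D : Diagram n} (T : Filling D) →
     subst Ring.Carrier R≡ (youngOf T) ≡ Symmetrizers.youngElement K n (proj₁ ∘ cellOf T) (proj₂ ∘ cellOf T)) →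
  (S : ∀ {D : Diagram n} → Filling D → LeftModule R 0ℓ 0ℓ) →
  (∀ {D : Diagram n} (T : Filling D) → S T ≡ toModule (leftIdeal {R = R} (youngOf T))) →
  ∀ {p′} (D : Diagram n) → Containsδ·1 (suc p′) D → (T : Filling D) →
  HasFiltration {p = suc p′} {D} (S T) (λ _ T′ → S T′)
hasFiltration K inverse _ refl youngOf youngOf≡ S S≡ D contains T =
  HasFiltration-resp-≡ (sym (S≡ T)) (λ _ T′ → sym (S≡ T′))
    (JamesPeel.filtration K inverse youngOf youngOf≡ D contains T)

theorem3p5 : ∀ {n : ℕ} (p : ℕ) → 1 ≤ p →
    (D : Diagram n) → Containsδ·1 p D → (T : Filling D) →
    Σ[ M ∈ (Fin (suc p) → Submodule (Specht T) 0ℓ) ]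
    IsZero (M zero) ×
    IsWhole (M (fromℕ p)) ×
    (∀ (k : Fin p) → M (inject₁ k) ⊆ᴹ M (suc k)) ×
    (∀ (k : Fin p) → let j = suc (toℕ k) in
    (T′ : Filling (R[ p ⇒ suc (p ∸ j) ] (C[ p ⇒ j ] D))) →
    toModule (M (suc k)) / (M (inject₁ k) within M (suc k)) ↠ᴹ Specht T′)
theorem3p5 {n} (suc p′) _ D contains T =
  hasFiltration ℂ ℂ-naturalsInvertible ℂ[S n ] refl youngSymmetrizer (λ _ → refl) Specht (λ _ → refl) D contains T
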